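{- Let $n$ be a positive integer and let $\mu,\nu,\lambda$ be partitions of lengths $\ell(\mu),\ell(\nu),\ell(\lambda)\leq n$. Then $$n_{\mu,\nu}^{\lambda}=\#\,\mathcal{K}^{(n)}(\mu,\nu;\lambda),$$ where $\mathcal{K}^{(n)}(\mu,\nu;\lambda)$ is the set of composite $n$-hives with lower boundary $(\mu,\nu)$ and upper boundary $\lambda$.
   Context: Newell--Littlewood coefficients: $n_{\mu,\nu}^{\lambda}=\sum_{\alpha,\beta,\gamma} c_{\alpha,\beta}^{\mu}c_{\alpha,\gamma}^{\nu}c_{\beta,\gamma}^{\lambda}$, summed over all partitions $\alpha,\beta,\gamma$, where $c_{\mu,\nu}^{\lambda}$ is the Littlewood--Richardson coefficient (coefficient of the Schur function $s_\lambda$ in $s_\mu s_\nu$). Partitions of length $\le n$ are padded with zeros to $n$ parts. Composite $n$-hives. Let $T_n=\{(i,j)\in\mathbb{Z}^2: 0\leq i\leq 2n,\ i\leq j\leq \min(i+n,2n)\}$. These are the vertices of a trapezoidal piece of the triangular lattice (with $(1,0)$ pointing down-right, $(0,1)$ up-right and $(1,1)$ horizontally right), which is a union of three triangles of side $n$: $T_\mu=\{0\leq i\leq j\leq n\}$, $T_\nu=\{n\leq i\leq j\leq 2n\}$ and $T^\lambda=\{0\leq i\leq n\leq j\leq i+n\}$. An element of $\mathcal{K}^{(n)}(\mu,\nu;\lambda)$ is a labelling $(a_{i,j})_{(i,j)\in T_n}$ by integers with $a_{0,0}=0$ such that: (1) (lower and upper boundaries) for $1\leq i\leq n$: $a_{i,i}-a_{i-1,i-1}=\mu_i$,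 $a_{n+i,n+i}-a_{n+i-1,n+i-1}=\nu_i$, $a_{i,n+i}-a_{i-1,n+i-1}=\lambda_i$; (2) (rhombus constraints) for all $i,j$, each of the following inequalities holds whenever the four vertices appearing in it all lie in one and the same triangle $T_\mu$, $T_\nu$ or $T^\lambda$: $$a_{i-1,j-1}+a_{i,j-1}\geq a_{i,j}+a_{i-1,j-2},\qquad a_{i-1,j-1}+a_{i,j}\geq a_{i-1,j}+a_{i,j-1},\qquad a_{i,j-1}+a_{i,j}\geq a_{i-1,j-1}+a_{i+1,j};$$ (3) (matching of left and right boundaries) $a_{0,j}-a_{0,j-1}=a_{n+j,2n}-a_{n+j-1,2n}$ for $1\leq j\leq n$; (4) the sequences $\alpha_j=a_{0,j}-a_{0,j-1}$, $\beta_j=a_{j,n}-a_{j-1,n}$, $\gamma_j=a_{n,n+j}-a_{n,n+j-1}$ ($1\leq j\leq n$) are partitions; given (2), this amounts to $\alpha_n,\beta_n,\gamma_n\geq0$. -}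

module Defs where

open import Level using (0ℓ)
open import Data.Nat as ℕ using (ℕ; suc; _∸_)
import Data.Nat.Properties as ℕ
open import Data.Integer as ℤ using (ℤ; +_; 0ℤ)
open import Data.Fin as Fin using (Fin)
import Data.Fin.Properties as Fin
open import Data.List using (List; []; _∷_; [_]; length; map; filter; concat;
  foldr; replicate; upTo; allFin; cartesianProductWith)
open import Data.List.Membership.Propositional using (_∉_)
open import Data.List.Relation.Unary.All using (All; all?)
open import Data.List.Relation.Unary.Linked using (Linked; linked?)
open import Data.List.Relation.Unary.Unique.Propositional using (Unique)
open import Data.List.Relation.Binary.Prefix.Heterogeneous using (Prefix)
open import Data.List.Relation.Binary.Prefix.Heterogeneous.Properties using (prefix?)
open import Data.Vec as Vec using (Vec)
import Data.Vec.Properties as Vec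
open import Data.Product using (_×_; _,_; ∃)
open import Function.Bundles using (Inverse)
open import Relation.Binary.Bundles using (Setoid)
open import Relation.Binary.PropositionalEquality using (_≡_; refl; sym; trans; setoid)
open import Relation.Nullary.Decidable using (Dec; _×-dec_)

-- Sums over an arbitrary index type, for functions of finite support.

sumℤ : List ℤ → ℤ
sumℤ = foldr ℤ._+_ 0ℤ

record HasSum {A : Set} (f : A → ℤ) (s : ℤ) : Set where
  field
    support  : List A
    distinct : Unique support
    vanishes : ∀ x → x ∉ support → f x ≡ 0ℤ
    total    : sumℤ (map f support) ≡ s

HasCardinality : Setoid 0ℓ 0ℓ → ℕ → Set
HasCardinality S N = Inverse (setoid (Fin N)) S

-- Both proof fields are propositional, so a partition is determined by its
-- parts and _≡_ is the right equality on partitions.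

record Partition : Set where
  constructor mkPartition
  field
    parts      : List ℕ
    decreasing : Linked ℕ._≥_ parts
    positive   : All (0 ℕ.<_) parts

open Partition public

ℓ : Partition → ℕ
ℓ μ = length (parts μ)

-- entry μ i is the (i + 1)-st part of μ, with μ padded by zeros.

nth : List ℕ → ℕ → ℕ
nth []       _       = 0
nth (x ∷ _)  0       = x
nth (_ ∷ xs) (suc i) = nth xs i

entry : Partition → ℕ → ℕ
entry μ = nth (parts μ)

-- A tableau in the alphabet Fin k is its list of rows, from top to bottom.

Tableau : ℕ → Set
Tableau k = List (List (Fin k))

-- Every entry of the lower row exceeds the entry immediately above it.

_Above_ : ∀ {k} → List (Fin k) → List (Fin k) → Set
upper Above lower = Prefix Fin._>_ lower upper

Semistandard : ∀ {k} → Tableau k → Set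
Semistandard t = All (Linked Fin._≤_) t × Linked _Above_ t

semistandard? : ∀ {k} (t : Tableau k) → Dec (Semistandard t)
semistandard? t =
  all? (linked? Fin._≤?_) t
    ×-dec linked? (λ upper lower → prefix? (λ x y → y Fin.<? x) lower upper) t

content : ∀ {k} → Tableau k → Vec ℕ k
content t = Vec.tabulate λ i → length (filter (i Fin.≟_) (concat t))

-- choices [ xs₁ , … , xsₘ ] lists all [ x₁ , … , xₘ ] with xᵢ taken from xsᵢ.

choices : {A : Set} → List (List A) → List (List A)
choices = foldr (cartesianProductWith _∷_) [ [] ]

-- All tableaux of the given shape, semistandard or not, each listed once.

fillings : ∀ k → Partition → List (Tableau k)
fillings k μ = choices (map (λ p → choices (replicate p (allFin k))) (parts μ))

-- A formal power series in x₁, x₂, … given by its coefficients: the value at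
-- (m₁ , … , mₖ) is the coefficient of x₁^m₁ ⋯ xₖ^mₖ.  Every monomial occurs,
-- since k is arbitrary.

Series : Set
Series = ∀ {k} → Vec ℕ k → ℤ

-- s_μ = Σ x^{content t} over the semistandard tableaux t of shape μ.

schur : Partition → Series
schur μ {k} m =
  + length (filter (λ t → semistandard? t ×-dec Vec.≡-dec ℕ._≟_ (content t) m)
                   (fillings k μ))

-- The pairs of exponent vectors with sum m.

splits : ∀ {k} → Vec ℕ k → List (Vec ℕ k × Vec ℕ k)
splits Vec.[]       = [ (Vec.[] , Vec.[]) ]
splits (m Vec.∷ ms) =
  cartesianProductWith (λ { i (a , b) → (i Vec.∷ a , (m ∸ i) Vec.∷ b) })
                       (upTo (suc m)) (splits ms)

_⊛_ : Series → Series → Series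
(f ⊛ g) m = sumℤ (map (λ { (a , b) → f a ℤ.* g b }) (splits m))

-- c μ ν κ is the coefficient of s_κ in s_μ s_ν, that is, s_μ s_ν = Σ_κ c μ ν κ s_κ.

IsLittlewoodRichardson : (Partition → Partition → Partition → ℤ) → Set
IsLittlewoodRichardson c =
  ∀ μ ν {k} (m : Vec ℕ k) →
    HasSum (λ κ → c μ ν κ ℤ.* schur κ m) ((schur μ ⊛ schur ν) m)

-- s is the Newell–Littlewood coefficient of μ, ν and κ.  The
-- Littlewood–Richardson coefficients are introduced by their defining property;
-- the first component says that they exist, so that the second is not vacuous.

IsNewellLittlewood : Partition → Partition → Partition → ℤ → Set
IsNewellLittlewood μ ν κ s =
  ∃ IsLittlewoodRichardson ×
  (∀ c → IsLittlewoodRichardson c →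
    HasSum {Partition × Partition × Partition}
           (λ { (α , β , γ) → c α β μ ℤ.* c α γ ν ℤ.* c β γ κ }) s)

InTrapezoid : ℕ → ℕ → ℕ → Set
InTrapezoid n i j =
  i ℕ.≤ 2 ℕ.* n × i ℕ.≤ j × j ℕ.≤ (i ℕ.+ n) ℕ.⊓ (2 ℕ.* n)

LeftTriangle RightTriangle UpperTriangle : ℕ → ℕ → ℕ → Set
LeftTriangle  n i j = i ℕ.≤ j × j ℕ.≤ n
RightTriangle n i j = n ℕ.≤ i × i ℕ.≤ j × j ℕ.≤ 2 ℕ.* n
UpperTriangle n i j = i ℕ.≤ n × n ℕ.≤ j × j ℕ.≤ i ℕ.+ n

-- The smallest row and column index of each rhombus is called i and j here, so
-- that all indices are natural numbers.

record Rhombi (Δ : ℕ → ℕ → Set) (a : ℕ → ℕ → ℤ) : Set where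
  field
    rhombus₁ : ∀ i j →
      Δ i (1 ℕ.+ j) → Δ (1 ℕ.+ i) (1 ℕ.+ j) → Δ (1 ℕ.+ i) (2 ℕ.+ j) → Δ i j →
      a i (1 ℕ.+ j) ℤ.+ a (1 ℕ.+ i) (1 ℕ.+ j) ℤ.≥ a (1 ℕ.+ i) (2 ℕ.+ j) ℤ.+ a i j
    rhombus₂ : ∀ i j →
      Δ i j → Δ (1 ℕ.+ i) (1 ℕ.+ j) → Δ i (1 ℕ.+ j) → Δ (1 ℕ.+ i) j →
      a i j ℤ.+ a (1 ℕ.+ i) (1 ℕ.+ j) ℤ.≥ a i (1 ℕ.+ j) ℤ.+ a (1 ℕ.+ i) j
    rhombus₃ : ∀ i j →
      Δ (1 ℕ.+ i) j → Δ (1 ℕ.+ i) (1 ℕ.+ j) → Δ i j → Δ (2 ℕ.+ i) (1 ℕ.+ j) →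
      a (1 ℕ.+ i) j ℤ.+ a (1 ℕ.+ i) (1 ℕ.+ j) ℤ.≥ a i j ℤ.+ a (2 ℕ.+ i) (1 ℕ.+ j)

-- The finite sequence b 0, …, b (n - 1) is a partition padded by zeros.

record IsPartitionSeq (n : ℕ) (b : ℕ → ℤ) : Set where
  field
    antitone    : ∀ j → suc j ℕ.< n → b (suc j) ℤ.≤ b j
    nonnegative : ∀ j → j ℕ.< n → 0ℤ ℤ.≤ b j

-- A labelling of the trapezoid is a function on ℕ × ℕ of which only the values
-- inside the trapezoid matter: no condition below mentions a vertex outside
-- it, and compositeHives identifies labellings that agree on it.

record CompositeHive (n : ℕ) (μ ν κ : Partition) : Set where
  field
    label : ℕ → ℕ → ℤ

    origin : label 0 0 ≡ 0ℤ

    lowerLeft  : ∀ i → i ℕ.< n →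
      label (suc i) (suc i) ℤ.- label i i ≡ + entry μ i
    lowerRight : ∀ i → i ℕ.< n →
      label (n ℕ.+ suc i) (n ℕ.+ suc i) ℤ.- label (n ℕ.+ i) (n ℕ.+ i) ≡ + entry ν i
    upper      : ∀ i → i ℕ.< n →
      label (suc i) (n ℕ.+ suc i) ℤ.- label i (n ℕ.+ i) ≡ + entry κ i

    rhombiLeft  : Rhombi (LeftTriangle n) label
    rhombiRight : Rhombi (RightTriangle n) label
    rhombiUpper : Rhombi (UpperTriangle n) label

    matching : ∀ j → j ℕ.< n →
      label 0 (suc j) ℤ.- label 0 j
        ≡ label (n ℕ.+ suc j) (2 ℕ.* n) ℤ.- label (n ℕ.+ j) (2 ℕ.* n)

    partitionα : IsPartitionSeq n λ j → label 0 (suc j) ℤ.- label 0 j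
    partitionβ : IsPartitionSeq n λ j → label (suc j) n ℤ.- label j n
    partitionγ : IsPartitionSeq n λ j → label n (n ℕ.+ suc j) ℤ.- label n (n ℕ.+ j)

open CompositeHive public using (label)

compositeHives : ℕ → Partition → Partition → Partition → Setoid 0ℓ 0ℓ
compositeHives n μ ν κ = record
  { Carrier       = CompositeHive n μ ν κ
  ; _≈_           = λ a b → ∀ i j → InTrapezoid n i j → label a i j ≡ label b i j
  ; isEquivalence = record
      { refl  = λ i j p → refl
      ; sym   = λ e i j p → sym (e i j p)
      ; trans = λ e f i j p → trans (e i j p) (f i j p)
      }
  }

{-# OPTIONS --safe #-}
module Submission where

-- A Gelfand–Tsetlin pattern, that is, a semistandard tableau, is built row by
-- row, and so is a tetrahedral array of labels whose faces are two patterns, a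
-- hive and a third pattern.  One octahedron recurrence passes from each layer to
-- the next; it preserves the rhombus inequalities and is invertible, so pairs of
-- patterns of shapes μ, ν correspond to hives with edges μ, ν, κ together with a
-- pattern of shape κ, and weights add.  Hence hives count the coefficients of
-- s_κ in s_μ s_ν.  The coefficients are determined by this expansion, because
-- Kostka numbers are unitriangular; in particular they are symmetric in μ, ν.
-- Cutting a composite hive into its three triangles, the upper one transposed,
-- leaves hives with edges (α, β, μ), (γ, α, ν), (β, γ, κ), and such triples glue
-- along the common edges β and γ, while the two edges α match.

-- The Newell-Littlewood sum is stated for every family with the defining property of the
-- Littlewood-Richardson coefficients, so existence (`lr-IsLR`) and uniqueness (`lr-unique`) are
-- both proved. Symmetry enters because the sides of the right triangle come in the order `γ`, `α`,
-- while the coefficient has `α`, `γ`; it is drawn from uniqueness and not from a map on hives. The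
-- Schur expansion in `k` variables produces hives of side `k`, the theorem has hives of side `n`;
-- the two counts agree because vanishing last parts force the last column of a hive to repeat the
-- one before. Labels range over all integers, so finiteness of a set of hives is not visible from
-- its definition; it is carried over from pairs of tableaux. The octahedron recurrence works
-- because a maximum bounds both of its terms and equals one of them: the first fact gives two
-- inequalities at every octahedron, the second gives one more, at the price of a case distinction.

open import Defs
open import Level using (0ℓ)
open import Data.Nat as ℕ using (ℕ; zero; suc; NonZero; _≤_; _<_; z≤n; s≤s)
import Data.Nat.Properties as ℕₚ
open import Data.Integer as ℤ using (ℤ; +_; 0ℤ; 1ℤ)
import Data.Integer.Properties as ℤₚ
open import Data.Fin as Fin using (Fin)
import Data.Fin.Properties as Finₚ
open import Data.Vec as Vec using (Vec)
import Data.Vec.Properties as Vecₚ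
open import Data.List using (List; []; _∷_; [_]; length; map; filter; concat; _++_;
  replicate; upTo; applyUpTo; allFin; cartesianProductWith; cartesianProduct; deduplicate)
import Data.List.Properties as Listₚ
open import Data.List.Membership.Propositional using (_∈_; _∉_; mapWith∈)
open import Data.List.Membership.Propositional.Properties
open import Data.List.Relation.Unary.Any as Any using (here; there)
open import Data.List.Relation.Unary.All as All using (All; []; _∷_)
import Data.List.Relation.Unary.All.Properties as Allₚ
import Data.List.Relation.Unary.Any.Properties as Anyₚ
open import Data.List.Relation.Unary.AllPairs using ([]; _∷_)
open import Data.List.Relation.Unary.Linked as Linked using (Linked; []; [-]; _∷_)
open import Data.List.Relation.Unary.Unique.Propositional using (Unique)
import Data.List.Relation.Unary.Unique.Propositional.Properties as Uniqueₚ
open import Data.List.Relation.Binary.Prefix.Heterogeneous using ([]; _∷_)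
open import Data.Product using (∃-syntax; _×_; _,_; proj₁; proj₂; uncurry)
open import Data.Product.Properties using (≡-dec)
open import Data.Sum using (_⊎_; inj₁; inj₂)
open import Data.Unit using (⊤; tt)
open import Data.Empty using (⊥; ⊥-elim)
open import Function using (_∘_; id; case_of_)
open import Relation.Binary.Bundles using (Setoid)
open import Relation.Nullary using (Dec; yes; no; ¬_; contradiction)
open import Relation.Nullary.Decidable using (_×-dec_; map′)
open import Relation.Binary.Definitions using (DecidableEquality; tri<; tri≈; tri>)
open import Relation.Binary.PropositionalEquality
  using (_≡_; _≢_; refl; sym; trans; cong; cong₂; subst; subst₂)
open import Data.Integer.Tactic.RingSolver using (solve-∀)

-- Finite enumerations

unique-length-≤ : ∀ {A : Set} {xs ys : List A} → Unique xs → (∀ {x} → x ∈ xs → x ∈ ys) →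
  length xs ≤ length ys
unique-length-≤ []       _   = z≤n
unique-length-≤ {xs = x ∷ xs} (x∉ ∷ u) sub with ∈-∃++ (sub (here refl))
... | as , bs , refl = subst (suc (length xs) ≤_) (sym len)
        (s≤s (unique-length-≤ u λ z∈ → drop-mid (λ z≡x → All.lookup x∉ z∈ (sym z≡x)) (sub (there z∈))))
  where
  drop-mid : ∀ {z} → z ≢ x → z ∈ as ++ x ∷ bs → z ∈ as ++ bs
  drop-mid z≢x z∈ with ∈-++⁻ as z∈
  ... | inj₁ p           = ∈-++⁺ˡ p
  ... | inj₂ (here eq)   = contradiction eq z≢x
  ... | inj₂ (there p)   = ∈-++⁺ʳ as p
  len : length (as ++ x ∷ bs) ≡ suc (length (as ++ bs))
  len = trans (Listₚ.length-++ as) (trans (ℕₚ.+-suc _ _) (cong suc (sym (Listₚ.length-++ as))))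

mapWith∈-unique : ∀ {A B : Set} {xs : List A} (f : ∀ {x} → x ∈ xs → B) →
  (∀ {x y} (p : x ∈ xs) (q : y ∈ xs) → f p ≡ f q → x ≡ y) → Unique xs → Unique (mapWith∈ xs f)
mapWith∈-unique f inj [] = []
mapWith∈-unique {xs = x ∷ xs} f inj (x∉ ∷ u) =
  All.tabulate (λ {z} z∈ eq → fresh z∈ eq)
    ∷ mapWith∈-unique (f ∘ there) (λ p q → inj (there p) (there q)) u
  where
  fresh : ∀ {z} → z ∈ mapWith∈ xs (f ∘ there) → f (here refl) ≡ z → ⊥
  fresh z∈ refl with Anyₚ.mapWith∈⁻ xs (f ∘ there) z∈
  ... | y , y∈ , eq = All.lookup x∉ y∈ (inj (here refl) (there y∈) eq)

length-mapWith∈ : ∀ {A B : Set} (xs : List A) {f : ∀ {x} → x ∈ xs → B} → length (mapWith∈ xs f) ≡ length xs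
length-mapWith∈ []       = refl
length-mapWith∈ (x ∷ xs) = cong suc (length-mapWith∈ xs)

length-cartesianProduct : ∀ {A B : Set} (xs : List A) (ys : List B) →
  length (cartesianProduct xs ys) ≡ length xs ℕ.* length ys
length-cartesianProduct []       ys = refl
length-cartesianProduct (x ∷ xs) ys = trans (Listₚ.length-++ (map (x ,_) ys))
  (cong₂ ℕ._+_ (Listₚ.length-map (x ,_) ys) (length-cartesianProduct xs ys))

-- A finite subset of `A`, given by a predicate and a listing without repetitions. Elements are
-- counted, not proofs of `P x`, so `P` may be proof-relevant; by `size-≡` the size does not depend
-- on the listing.
record Enum {A : Set} (P : A → Set) : Set where
  field
    elements : List A
    unique   : Unique elements
    sound    : ∀ {x} → x ∈ elements → P x
    complete : ∀ {x} → P x → x ∈ elements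
  size : ℕ
  size = length elements

open Enum

-- The maps may use the proofs, but their values must not depend on them.
record Bij {A B : Set} (P : A → Set) (Q : B → Set) : Set where
  field
    to      : ∀ {x} → P x → B
    from    : ∀ {y} → Q y → A
    to-ok   : ∀ {x} (p : P x) → Q (to p)
    from-ok : ∀ {y} (q : Q y) → P (from q)
    from-to : ∀ {x} (p : P x) (q : Q (to p)) → from q ≡ x
    to-from : ∀ {y} (q : Q y) (p : P (from q)) → to p ≡ y

size-≤ : ∀ {A : Set} {P Q : A → Set} (E : Enum P) (F : Enum Q) → (∀ {x} → P x → Q x) → size E ≤ size F
size-≤ E F f = unique-length-≤ (unique E) (complete F ∘ f ∘ sound E)

size-≡ : ∀ {A : Set} {P Q : A → Set} (E : Enum P) (F : Enum Q) →
  (∀ {x} → P x → Q x) → (∀ {x} → Q x → P x) → size E ≡ size F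
size-≡ E F f g = ℕₚ.≤-antisym (size-≤ E F f) (size-≤ F E g)

abstract
  transport : ∀ {A B : Set} {P : A → Set} {Q : B → Set} → Bij P Q → Enum P → Enum Q
  transport {P = P} {Q} β E = record
    { elements = mapWith∈ (elements E) (to ∘ sound E)
    ; unique   = mapWith∈-unique (to ∘ sound E) inj (unique E)
    ; sound    = snd
    ; complete = λ {y} q → subst (_∈ mapWith∈ (elements E) (to ∘ sound E)) (to-from q _)
                   (Anyₚ.mapWith∈⁺ (to ∘ sound E) (from q , complete E (from-ok q) , refl))
    }
    where
    open Bij β
    inj : ∀ {x y} (p : x ∈ elements E) (q : y ∈ elements E) → to (sound E p) ≡ to (sound E q) → x ≡ y
    inj {y = y} p q eq = trans (sym (from-to (sound E p) (to-ok (sound E p))))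
      (from-cong eq (to-ok (sound E p)))
      where
      from-cong : ∀ {z} → z ≡ to (sound E q) → (r : Q z) → from r ≡ y
      from-cong refl r = from-to (sound E q) r
    snd : ∀ {y} → y ∈ mapWith∈ (elements E) (to ∘ sound E) → Q y
    snd y∈ with Anyₚ.mapWith∈⁻ (elements E) (to ∘ sound E) y∈
    ... | x , x∈ , refl = to-ok (sound E x∈)

  size-transport : ∀ {A B : Set} {P : A → Set} {Q : B → Set} (β : Bij P Q) (E : Enum P) →
    size (transport β E) ≡ size E
  size-transport β E = length-mapWith∈ (elements E)

size-Bij : ∀ {A B : Set} {P : A → Set} {Q : B → Set} → Bij P Q → (E : Enum P) (F : Enum Q) → size E ≡ size F
size-Bij β E F = trans (sym (size-transport β E)) (size-≡ (transport β E) F id id)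

enum-⇔ : ∀ {A : Set} {P Q : A → Set} → (∀ {x} → P x → Q x) → (∀ {x} → Q x → P x) → Enum P → Enum Q
enum-⇔ f g E = record { elements = elements E ; unique = unique E ; sound = f ∘ sound E ; complete = complete E ∘ g }

enum-filter : ∀ {A : Set} {P Q : A → Set} → (∀ x → Dec (Q x)) → Enum P → Enum (λ x → P x × Q x)
enum-filter Q? E = record
  { elements = filter Q? (elements E)
  ; unique   = Uniqueₚ.filter⁺ Q? (unique E)
  ; sound    = λ x∈ → let y = ∈-filter⁻ Q? x∈ in sound E (proj₁ y) , proj₂ y
  ; complete = λ { (p , q) → ∈-filter⁺ Q? (complete E p) q }
  }

infixr 4 _⊗_
_⊗_ : ∀ {A B : Set} → (A → Set) → (B → Set) → A × B → Set
(P ⊗ Q) z = P (proj₁ z) × Q (proj₂ z)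

enum-× : ∀ {A B : Set} {P : A → Set} {Q : B → Set} → Enum P → Enum Q → Enum (P ⊗ Q)
enum-× E F = record
  { elements = cartesianProduct (elements E) (elements F)
  ; unique   = Uniqueₚ.cartesianProduct⁺ (unique E) (unique F)
  ; sound    = λ z∈ → let y = ∈-cartesianProduct⁻ (elements E) (elements F) z∈ in sound E (proj₁ y) , sound F
      (proj₂ y)
  ; complete = λ { (p , q) → ∈-cartesianProduct⁺ (complete E p) (complete F q) }
  }

size-× : ∀ {A B : Set} {P : A → Set} {Q : B → Set} (E : Enum P) (F : Enum Q) → size (enum-× E F) ≡ size E ℕ.* size F
size-× E F = length-cartesianProduct (elements E) (elements F)

enum-Σ : ∀ {A B : Set} {P : A → Set} {Q : A → B → Set} → Enum P → (∀ {x} → P x → Enum (Q x)) →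
  Enum {A × B} (λ z → P (proj₁ z) × Q (proj₁ z) (proj₂ z))
enum-Σ {A} {B} {P} {Q} E F = record
  { elements = go (elements E) (sound E)
  ; unique   = uniq (elements E) (sound E) (unique E)
  ; sound    = λ z∈ → let x∈ , q = snd (elements E) (sound E) z∈ in sound E x∈ , q
  ; complete = λ { (p , q) → cmp (elements E) (sound E) (complete E p) q }
  }
  where
  go : (xs : List A) → (∀ {x} → x ∈ xs → P x) → List (A × B)
  go []       _ = []
  go (x ∷ xs) s = map (x ,_) (elements (F (s (here refl)))) ++ go xs (λ z → s (there z))

  snd : ∀ xs (s : ∀ {x} → x ∈ xs → P x) {x y} → (x , y) ∈ go xs s → x ∈ xs × Q x y
  snd (x ∷ xs) s z∈ with ∈-++⁻ (map (x ,_) (elements (F (s (here refl))))) z∈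
  ... | inj₁ p with ∈-map⁻ (x ,_) p
  ...   | y , y∈ , refl = here refl , sound (F (s (here refl))) y∈
  snd (x ∷ xs) s z∈ | inj₂ p = let x∈ , q = snd xs (λ z → s (there z)) p in there x∈ , q

  cmp : ∀ xs (s : ∀ {x} → x ∈ xs → P x) {x y} → x ∈ xs → Q x y → (x , y) ∈ go xs s
  cmp (x ∷ xs) s (here refl) q = ∈-++⁺ˡ (∈-map⁺ (x ,_) (complete (F (s (here refl))) q))
  cmp (x ∷ xs) s (there x∈)  q = ∈-++⁺ʳ _ (cmp xs (λ z → s (there z)) x∈ q)

  uniq : ∀ xs (s : ∀ {x} → x ∈ xs → P x) → Unique xs → Unique (go xs s)
  uniq []       s []       = []
  uniq (x ∷ xs) s (x∉ ∷ u) =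
    Uniqueₚ.++⁺ (Uniqueₚ.map⁺ (λ { refl → refl }) (unique (F (s (here refl))))) (uniq xs (λ z → s (there z)) u) disj
    where
    disj : ∀ {z} → z ∈ map (x ,_) (elements (F (s (here refl)))) × z ∈ go xs (λ z → s (there z)) → ⊥
    disj (p , q) with ∈-map⁻ (x ,_) p
    ... | y , y∈ , refl = All.lookup x∉ (proj₁ (snd xs (λ z → s (there z)) q)) refl

-- Sums over finite supports

sum-zero : ∀ {A : Set} (f : A → ℤ) xs → (∀ {x} → x ∈ xs → f x ≡ 0ℤ) → sumℤ (map f xs) ≡ 0ℤ
sum-zero f []       z = refl
sum-zero f (x ∷ xs) z = cong₂ ℤ._+_ (z (here refl)) (sum-zero f xs (z ∘ there))

sum-cong : ∀ {A : Set} {f g : A → ℤ} xs → (∀ {x} → x ∈ xs → f x ≡ g x) → sumℤ (map f xs) ≡ sumℤ (map g xs)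
sum-cong []       e = refl
sum-cong (x ∷ xs) e = cong₂ ℤ._+_ (e (here refl)) (sum-cong xs (e ∘ there))

sum-+ : ∀ {A : Set} (f g : A → ℤ) xs →
  sumℤ (map (λ x → f x ℤ.+ g x) xs) ≡ sumℤ (map f xs) ℤ.+ sumℤ (map g xs)
sum-+ f g []       = refl
sum-+ f g (x ∷ xs) = trans (cong (ℤ._+_ (f x ℤ.+ g x)) (sum-+ f g xs))
  (solve-four (f x) (g x) (sumℤ (map f xs)) (sumℤ (map g xs)))
  where
  solve-four : ∀ a b c d → a ℤ.+ b ℤ.+ (c ℤ.+ d) ≡ a ℤ.+ c ℤ.+ (b ℤ.+ d)
  solve-four = solve-∀

sum-++ : ∀ {A : Set} (f : A → ℤ) xs ys →
  sumℤ (map f (xs ++ ys)) ≡ sumℤ (map f xs) ℤ.+ sumℤ (map f ys)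
sum-++ f []       ys = sym (ℤₚ.+-identityˡ _)
sum-++ f (x ∷ xs) ys = trans (cong (ℤ._+_ (f x)) (sum-++ f xs ys)) (sym (ℤₚ.+-assoc (f x) _ _))

-- The terms that `ys` has beyond `xs` vanish. Hence the total in `HasSum` does not depend on the
-- support chosen.
sum-support : ∀ {A : Set} (f : A → ℤ) {xs ys} → Unique xs → Unique ys → (∀ {x} → x ∈ xs → x ∈ ys) →
  (∀ {x} → x ∈ ys → x ∉ xs → f x ≡ 0ℤ) → sumℤ (map f xs) ≡ sumℤ (map f ys)
sum-support f {ys = ys} [] uy sub van = sym (sum-zero f ys λ x∈ → van x∈ λ ())
sum-support f {xs = x ∷ xs} (x∉ ∷ ux) uy sub van with ∈-∃++ (sub (here refl))
... | as , bs , refl =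
  trans (cong (ℤ._+_ (f x)) (sum-support f ux (unique-mid as uy) sub′ van′)) (sym mid)
  where
  unique-mid : ∀ as {x bs} → Unique (as ++ x ∷ bs) → Unique (as ++ bs)
  unique-mid []       (_ ∷ u) = u
  unique-mid (a ∷ as) (p ∷ u) =
    Allₚ.++⁺ (Allₚ.++⁻ˡ as p) (All.tail (Allₚ.++⁻ʳ as p)) ∷ unique-mid as u
  x∉mid : ∀ as {bs} → Unique (as ++ x ∷ bs) → x ∉ as ++ bs
  x∉mid []       (p ∷ u) x∈ = All.lookup p x∈ refl
  x∉mid (a ∷ as) (p ∷ u) (here refl) = All.lookup p (∈-++⁺ʳ as (here refl)) refl
  x∉mid (a ∷ as) (p ∷ u) (there x∈) = x∉mid as u x∈
  drop-mid : ∀ {z} → z ≢ x → z ∈ as ++ x ∷ bs → z ∈ as ++ bs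
  drop-mid z≢x z∈ with ∈-++⁻ as z∈
  ... | inj₁ p           = ∈-++⁺ˡ p
  ... | inj₂ (here eq)   = contradiction eq z≢x
  ... | inj₂ (there p)   = ∈-++⁺ʳ as p
  add-mid : ∀ {z} → z ∈ as ++ bs → z ∈ as ++ x ∷ bs
  add-mid z∈ with ∈-++⁻ as z∈
  ... | inj₁ p = ∈-++⁺ˡ p
  ... | inj₂ p = ∈-++⁺ʳ as (there p)
  sub′ : ∀ {z} → z ∈ xs → z ∈ as ++ bs
  sub′ z∈ = drop-mid (λ z≡x → All.lookup x∉ z∈ (sym z≡x)) (sub (there z∈))
  van′ : ∀ {z} → z ∈ as ++ bs → z ∉ xs → f z ≡ 0ℤ
  van′ z∈ z∉ = van (add-mid z∈) λ { (here refl) → x∉mid as uy z∈ ; (there p) → z∉ p }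
  mid : sumℤ (map f (as ++ x ∷ bs)) ≡ f x ℤ.+ sumℤ (map f (as ++ bs))
  mid = trans (sum-++ f as (x ∷ bs))
    (trans (rot (sumℤ (map f as)) (f x) (sumℤ (map f bs))) (cong (ℤ._+_ (f x)) (sym (sum-++ f as bs))))
    where
    rot : ∀ a b c → a ℤ.+ (b ℤ.+ c) ≡ b ℤ.+ (a ℤ.+ c)
    rot = solve-∀

sum-single : ∀ {A : Set} (f : A → ℤ) {x ys} → Unique ys → x ∈ ys → (∀ {y} → y ∈ ys → y ≢ x → f y ≡ 0ℤ) →
  sumℤ (map f ys) ≡ f x
sum-single f {x} u x∈ van = trans (sym (sum-support f {xs = [ x ]} ([] ∷ []) u (λ { (here refl) → x∈ })
    (λ y∈ y∉ → van y∈ (λ y≡x → y∉ (here y≡x))))) (ℤₚ.+-identityʳ _)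

module _ {A : Set} (_≟_ : DecidableEquality A) where
  open import Data.List.Relation.Unary.Unique.DecPropositional.Properties _≟_ using (deduplicate-!)

  -- Sums with unrelated supports become comparable over one list; `zs` forces further elements into
  -- it, so that a term of interest is sure to occur.
  common-support : ∀ {f g : A → ℤ} {s t} → HasSum f s → HasSum g t → ∀ zs →
    ∃[ ys ] Unique ys × (∀ {x} → x ∈ zs → x ∈ ys) × sumℤ (map f ys) ≡ s × sumℤ (map g ys) ≡ t
  common-support {f} {g} F G zs =
    ys , deduplicate-! all , (λ z → keep (∈-++⁺ʳ (F.support ++ G.support) z)) ,
    trans (sym (sum-support f F.distinct (deduplicate-! all) (keep ∘ ∈-++⁺ˡ ∘ ∈-++⁺ˡ) (λ _ → F.vanishes _))) F.total ,
    trans (sym (sum-support g G.distinct (deduplicate-! all) (keep ∘ ∈-++⁺ˡ ∘ ∈-++⁺ʳ F.support)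
        (λ _ → G.vanishes _))) G.total
    where
    module F = HasSum F
    module G = HasSum G
    all ys : List A
    all = (F.support ++ G.support) ++ zs
    ys  = deduplicate _≟_ all
    keep : ∀ {x} → x ∈ all → x ∈ ys
    keep = ∈-deduplicate⁺ _≟_

  -- Fubini for a family Q of finite sets of which only finitely many are inhabited.
  hasSum-fibres : ∀ {B : Set} {Q : A → B → Set} (E : Enum (uncurry Q)) (F : ∀ a → Enum (Q a)) →
    HasSum (λ a → + size (F a)) (+ size E)
  hasSum-fibres {B} {Q} E F = record
    { support  = as
    ; distinct = deduplicate-! (map proj₁ (elements E))
    ; vanishes = λ a a∉ → trans (cong +_ (fibre a)) (cong +_ (noneL a (elements E)
        λ z∈ eq → a∉ (∈-deduplicate⁺ _≟_ (subst (_∈ map proj₁ (elements E)) eq (∈-map⁺ proj₁ z∈)))))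
    ; total    = trans (sum-cong as (λ {a} _ → cong +_ (fibre a))) (tot (elements E) λ z∈ → ∈-deduplicate⁺
        _≟_ (∈-map⁺ proj₁ z∈))
    }
    where
    as : List A
    as = deduplicate _≟_ (map proj₁ (elements E))
    over? : ∀ a (z : A × B) → Dec (proj₁ z ≡ a)
    over? a z = proj₁ z ≟ a
    count : A → List (A × B) → ℕ
    count a zs = length (filter (over? a) zs)
    fibre : ∀ a → size (F a) ≡ count a (elements E)
    fibre a = size-Bij β (F a) (enum-filter (over? a) E)
      where
      β : Bij (Q a) (λ z → uncurry Q z × proj₁ z ≡ a)
      β = record
        { to = λ {y} _ → a , y ; from = λ {z} _ → proj₂ z
        ; to-ok = λ q → q , refl ; from-ok = λ { (q , refl) → q }
        ; from-to = λ _ _ → refl ; to-from = λ { (q , refl) _ → refl } }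
    noneL : ∀ a zs → (∀ {z} → z ∈ zs → proj₁ z ≢ a) → count a zs ≡ 0
    noneL a zs no-z = cong length (Listₚ.filter-none (over? a) (All.tabulate no-z))
    one : ∀ z a → ℤ
    one z a = + count a [ z ]
    one-hit : ∀ z → one z (proj₁ z) ≡ 1ℤ
    one-hit z = cong (λ l → + length l) (Listₚ.filter-accept (over? (proj₁ z)) refl)
    split : ∀ z zs a → + count a (z ∷ zs) ≡ one z a ℤ.+ + count a zs
    split z zs a with proj₁ z ≟ a
    ... | yes _ = refl
    ... | no  _ = refl
    tot : ∀ zs → (∀ {z} → z ∈ zs → proj₁ z ∈ as) → sumℤ (map (λ a → + count a zs) as) ≡ + length zs
    tot []       _   = sum-zero (λ _ → 0ℤ) as (λ _ → refl)
    -- Each listed element adds the indicator of its first component, whose sum over `as` is 1.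
    tot (z ∷ zs) sub = trans (sum-cong as (λ {a} _ → split z zs a)) (trans (sum-+ (one z) (λ a → + count a zs) as)
      (cong₂ ℤ._+_
        (trans (sum-single (one z) (deduplicate-! (map proj₁ (elements E))) (sub (here refl))
          (λ {a} _ a≢ → cong +_ (noneL a [ z ] (λ { (here refl) eq → a≢ (sym eq) })))) (one-hit z))
        (tot zs (sub ∘ there))))

hasSum-cong : ∀ {A : Set} {f g : A → ℤ} {s} → (∀ x → f x ≡ g x) → HasSum f s → HasSum g s
hasSum-cong e H = record { support = H.support ; distinct = H.distinct
  ; vanishes = λ x x∉ → trans (sym (e x)) (H.vanishes x x∉)
  ; total = trans (sum-cong H.support (λ {x} _ → sym (e x))) H.total }
  where module H = HasSum H

-- The octahedron recurrence

-- A record, so that the four labels can be inferred from the type of a proof and chains of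
-- inequalities need no explicit arguments.
record Rh (a b c d : ℤ) : Set where
  constructor rh
  field ineq : a ℤ.+ b ℤ.≤ c ℤ.+ d


sl : ∀ {a b c d} → Rh a b c d → Rh b a c d
sl {a} {b} {c} {d} (rh h) = rh (subst (ℤ._≤ c ℤ.+ d) (ℤₚ.+-comm a b) h)

sr : ∀ {a b c d} → Rh a b c d → Rh a b d c
sr {a} {b} {c} {d} (rh h) = rh (subst (a ℤ.+ b ℤ.≤_) (ℤₚ.+-comm c d) h)

infixl 5 _⨾_
-- When the two inequalities are added, `p` and `q` stand on both sides and cancel.
_⨾_ : ∀ {a b c d p q} → Rh a p c q → Rh q b p d → Rh a b c d
_⨾_ {a} {b} {c} {d} {p} {q} (rh h) (rh h′) = rh
  (ℤₚ.≤-trans (ℤₚ.≤-reflexive (l a b p q)) (ℤₚ.≤-trans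
    (ℤₚ.+-monoˡ-≤ (ℤ.- p ℤ.+ ℤ.- q) (ℤₚ.+-mono-≤ h h′)) (ℤₚ.≤-reflexive (sym (r c d p q)))))
  where
  r : ∀ c d p q → c ℤ.+ d ≡ c ℤ.+ q ℤ.+ (p ℤ.+ d) ℤ.+ (ℤ.- p ℤ.+ ℤ.- q)
  r = solve-∀
  l : ∀ a b p q → a ℤ.+ b ≡ a ℤ.+ p ℤ.+ (q ℤ.+ b) ℤ.+ (ℤ.- p ℤ.+ ℤ.- q)
  l = solve-∀

-- The tropical octahedron relation: `x` and `y`, `r` and `s`, `u` and `v` label the three pairs of
-- opposite vertices of an octahedron.
record Octa (x y r s u v : ℤ) : Set where
  constructor octa
  field eq : x ℤ.+ y ≡ (r ℤ.+ s) ℤ.⊔ (u ℤ.+ v)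

lowA : ∀ {x y r s u v} → Octa x y r s u v → Rh r s x y
lowA {r = r} {s} {u} {v} (octa e) = rh (subst (r ℤ.+ s ℤ.≤_) (sym e) (ℤₚ.i≤i⊔j (r ℤ.+ s) (u ℤ.+ v)))

lowB : ∀ {x y r s u v} → Octa x y r s u v → Rh u v x y
lowB {r = r} {s} {u} {v} (octa e) = rh (subst (u ℤ.+ v ℤ.≤_) (sym e) (ℤₚ.i≤j⊔i (r ℤ.+ s) (u ℤ.+ v)))

-- One of the terms attains the maximum, so the reverse of `lowA` or of `lowB` holds. The rhombi in
-- `Up` arise from this split at one octahedron and an unconditional bound at a neighbouring one.
upper : ∀ {x y r s u v} {C : Set} → Octa x y r s u v → (Rh x y r s → C) → (Rh x y u v → C) → C
upper {r = r} {s} {u} {v} (octa e) f g with ℤₚ.⊔-sel (r ℤ.+ s) (u ℤ.+ v)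
... | inj₁ m = f (rh (ℤₚ.≤-reflexive (trans e m)))
... | inj₂ m = g (rh (ℤₚ.≤-reflexive (trans e m)))

Labels : Set
Labels = ℕ → ℕ → ℤ

-- In diagonal coordinates: b d i is the label of the vertex (i , i + d), and
-- R₁, R₂, R₃ are the rhombus conditions in the order of Rhombi.

R₁ R₂ R₃ : Labels → ℕ → ℕ → Set
R₁ b d i = Rh (b (1 ℕ.+ d) (1 ℕ.+ i)) (b d i) (b (1 ℕ.+ d) i) (b d (1 ℕ.+ i))
R₂ b d i = Rh (b (2 ℕ.+ d) i) (b d (1 ℕ.+ i)) (b (1 ℕ.+ d) i) (b (1 ℕ.+ d) (1 ℕ.+ i))
R₃ b d i = Rh (b d (2 ℕ.+ i)) (b (1 ℕ.+ d) i) (b d (1 ℕ.+ i)) (b (1 ℕ.+ d) (1 ℕ.+ i))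

record IsHive (n : ℕ) (b : Labels) : Set where
  field
    r₁ : ∀ d i → suc (d ℕ.+ i) < n → R₁ b d i
    r₂ : ∀ d i → suc (d ℕ.+ i) < n → R₂ b d i
    r₃ : ∀ d i → suc (d ℕ.+ i) < n → R₃ b d i

sucʳ-< : ∀ {n} d i → suc (d ℕ.+ i) < n → d ℕ.+ suc i < n
sucʳ-< {n} d i = subst (_< n) (sym (ℕₚ.+-suc d i))

pred-< : ∀ {m n} → suc m < n → m < n
pred-< = ℕₚ.<-trans (ℕₚ.n<1+n _)

-- In the tetrahedral lattice, t labels the layer above b.  P₁ and P₂ say that
-- the diagonals of b and t interlace, L₁ and L₂ say this of the left edges and
-- E₁ and E₂ of the right edges.
module Layer (n : ℕ) (b t : Labels)
  (oct : ∀ d i → d ℕ.+ i < n →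
    Octa (t (suc d) i) (b d (suc i)) (t d i) (b (suc d) (suc i)) (t d (suc i)) (b (suc d) i)) where

  P₁ P₂ L₁ L₂ E₁ E₂ : ℕ → ℕ → Set
  P₁ d i = Rh (t d (1 ℕ.+ i)) (b d i) (t d i) (b d (1 ℕ.+ i))
  P₂ d i = Rh (b d (2 ℕ.+ i)) (t d i) (b d (1 ℕ.+ i)) (t d (1 ℕ.+ i))
  L₁ d i = Rh (t (1 ℕ.+ d) i) (b d i) (t d i) (b (1 ℕ.+ d) i)
  L₂ d i = Rh (b (2 ℕ.+ d) i) (t d i) (b (1 ℕ.+ d) i) (t (1 ℕ.+ d) i)
  E₁ d i = Rh (t d (1 ℕ.+ i)) (b (2 ℕ.+ d) i) (t (1 ℕ.+ d) i) (b (1 ℕ.+ d) (1 ℕ.+ i))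
  E₂ d i = Rh (b d (2 ℕ.+ i)) (t (1 ℕ.+ d) i) (t d (1 ℕ.+ i)) (b (1 ℕ.+ d) (1 ℕ.+ i))

  module Up (hive : IsHive (suc n) b)
            (p₁⁰ : ∀ i → i < n → P₁ 0 i) (p₂⁰ : ∀ i → i < n → P₂ 0 i) where
    open IsHive hive

    -- Interlacing passes from line `d` to line `suc d`: if the first term attains the maximum, a
    -- rhombus of `b` enters, otherwise the inequality on line `d`.
    p₁ : ∀ d i → d ℕ.+ i < n → P₁ d i
    p₁ zero    i h = p₁⁰ i h
    p₁ (suc d) i h = let h′ = sucʳ-< d i h ; o = oct d i (pred-< h) in upper (oct d (suc i) h′)
      (λ u → sr ((sr (u ⨾ sr (r₁ d (suc i) (s≤s h′)))) ⨾ sr (lowB o)))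
      (λ u → sr ((sr u ⨾ sr (p₁ d (suc i) h′)) ⨾ sr (lowB o)))

    p₂ : ∀ d i → d ℕ.+ i < n → P₂ d i
    p₂ zero    i h = p₂⁰ i h
    p₂ (suc d) i h = let h₀ = pred-< h ; o′ = oct d (suc i) (sucʳ-< d i h) in upper (oct d i h₀)
      (λ u → sl ((sr u ⨾ sl (p₂ d i h₀)) ⨾ sr (lowA o′)))
      (λ u → sl ((sr (u ⨾ sl (r₃ d i (s≤s h₀)))) ⨾ sr (lowA o′)))

    hive′ : IsHive n t
    hive′ = record
      { r₁ = λ d i h → let h′ = sucʳ-< d i h ; o = oct d i (pred-< h) in upper (oct d (suc i) h′)
          (λ u → sr ((u ⨾ sr (r₁ d (suc i) (s≤s h′))) ⨾ sl (sr (lowA o))))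
          (λ u → sr ((sr (sr u ⨾ sr (p₁ d (suc i) h′))) ⨾ sl (sr (lowA o))))
      ; r₂ = λ d i h → let h′ = sucʳ-< d i h ; h₀ = pred-< h in upper (oct (suc d) i h)
          (λ u → (u ⨾ r₂ d (suc i) (s≤s h′)) ⨾ sl (sr (lowA (oct d (suc i) h′))))
          (λ u → sr ((u ⨾ sr (r₂ d i (s≤s h₀))) ⨾ sl (sr (lowB (oct d i h₀)))))
      ; r₃ = λ d i h → let h₀ = pred-< h ; o′ = oct d (suc i) (sucʳ-< d i h) in upper (oct d i h₀)
          (λ u → sl ((sr (sr u ⨾ sl (p₂ d i h₀))) ⨾ sl (sr (lowB o′))))
          (λ u → sl ((u ⨾ sl (r₃ d i (s≤s h₀))) ⨾ sl (sr (lowB o′))))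
      }

    l₁ : ∀ d → d ℕ.+ 0 < n → L₁ d 0
    l₁ d h = upper (oct d 0 h) (λ u → u ⨾ sr (r₁ d 0 (s≤s h))) (λ u → sr (sr u ⨾ sr (p₁ d 0 h)))

    l₂ : ∀ d → d ℕ.+ 0 < n → L₂ d 0
    l₂ d h = r₂ d 0 (s≤s h) ⨾ sl (sr (lowA (oct d 0 h)))

    e₁ : ∀ d i → d ℕ.+ i < n → E₁ d i
    e₁ d i h = lowB (oct d i h) ⨾ sl (r₂ d i (s≤s h))

    e₂ : ∀ d i → d ℕ.+ i < n → E₂ d i
    e₂ d i h = upper (oct d i h) (λ u → sr (p₂ d i h) ⨾ sl u) (λ u → sl (u ⨾ sl (r₃ d i (s≤s h))))

  -- Here interlacing is known on the left and right edges. It spreads from there over the whole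
  -- layer, and the rhombi of `b` follow.
  module Down (hive : IsHive n t)
              (l₁⁰ : ∀ d → d ℕ.+ 0 < n → L₁ d 0) (l₂⁰ : ∀ d → d ℕ.+ 0 < n → L₂ d 0)
              (e₁⁰ : ∀ d i → suc (d ℕ.+ i) ≡ n → E₁ d i) (e₂⁰ : ∀ d i → suc (d ℕ.+ i) ≡ n → E₂ d i) where
    open IsHive hive

    -- The two families are proved together: `l₁` at `d` and `suc i` may call `p₁` at `suc d` and
    -- `i`, which rests on `l₁` at the same place. So `i` decreases until the left edge is reached.
    l₁ : ∀ d i → d ℕ.+ i < n → L₁ d i
    p₁ : ∀ d i → d ℕ.+ i < n → P₁ d i
    l₁ d zero    h = l₁⁰ d h
    l₁ d (suc i) h = let h′ = subst (_< n) (ℕₚ.+-suc d i) h in upper (oct d i (pred-< h′))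
      (λ u → sr (r₁ d i h′) ⨾ u)
      (λ u → sl (sl u ⨾ sl (p₁ (suc d) i h′)))
    p₁ d i h = sr (sr (lowB (oct d i h)) ⨾ sr (l₁ d i h))

    last? : ∀ d i → d ℕ.+ i < n → suc (d ℕ.+ i) < n ⊎ suc (d ℕ.+ i) ≡ n
    last? d i = ℕₚ.m≤n⇒m<n∨m≡n

    e₂-step : ∀ d i → suc (d ℕ.+ i) < n → P₂ (suc d) i → E₂ d i
    e₂-step d i h p = upper (oct d (suc i) (sucʳ-< d i h)) (λ u → sl u ⨾ sr p) (λ u → sl (sl (r₃ d i h) ⨾ u))

    p₂-step : ∀ d i → d ℕ.+ i < n → E₂ d i → P₂ d i
    p₂-step d i h e = sr (e ⨾ sl (lowA (oct d i h)))

    -- The recursion increases `d` towards the right edge, where the inequality is given; `fuel`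
    -- bounds the distance left.
    e₂-fuel : ∀ fuel d i → n ≤ fuel ℕ.+ suc (d ℕ.+ i) → d ℕ.+ i < n → E₂ d i
    e₂-fuel zero    d i f h = e₂⁰ d i (ℕₚ.≤-antisym h f)
    e₂-fuel (suc k) d i f h with last? d i h
    ... | inj₁ h′ = e₂-step d i h′ (p₂-step (suc d) i h′
                      (e₂-fuel k (suc d) i (subst (n ≤_) (sym (ℕₚ.+-suc k _)) f) h′))
    ... | inj₂ h′ = e₂⁰ d i h′

    e₂ : ∀ d i → d ℕ.+ i < n → E₂ d i
    e₂ d i = e₂-fuel n d i (ℕₚ.m≤m+n n _)

    p₂ : ∀ d i → d ℕ.+ i < n → P₂ d i
    p₂ d i h = p₂-step d i h (e₂ d i h)

    l₂ : ∀ d i → d ℕ.+ i < n → L₂ d i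
    l₂ d zero    h = l₂⁰ d h
    l₂ d (suc i) h = let h′ = subst (_< n) (ℕₚ.+-suc d i) h in sl (sr (lowA (oct (suc d) i h′))) ⨾ r₂ d i h′

    e₁ : ∀ d i → d ℕ.+ i < n → E₁ d i
    e₁ d i h with last? d i h
    ... | inj₁ h′ = sl (r₂ d i h′) ⨾ lowB (oct (suc d) i h′)
    ... | inj₂ h′ = e₁⁰ d i h′

    hive′ : IsHive (suc n) b
    hive′ = record
      { r₁ = λ { d i (s≤s h) → sr (sl (sr (lowA (oct d i h))) ⨾ l₁ d i h) }
      ; r₂ = λ { d i (s≤s h) → upper (oct d i h) (λ u → l₂ d i h ⨾ u) (λ u → sl (sl (sr u) ⨾ e₁ d i h)) }
      ; r₃ = λ { d i (s≤s h) → sr (sr (e₂ d i h) ⨾ lowB (oct d i h)) }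
      }

-- Triangular arrays

_!_ : ∀ {n} → Vec ℤ n → ℕ → ℤ
Vec.[]       ! _     = 0ℤ
(x Vec.∷ _)  ! zero  = x
(_ Vec.∷ xs) ! suc i = xs ! i

tab : ∀ n → (ℕ → ℤ) → Vec ℤ n
tab zero    f = Vec.[]
tab (suc n) f = f 0 Vec.∷ tab n (f ∘ suc)

!-tab : ∀ {n} f {i} → i < n → tab n f ! i ≡ f i
!-tab {suc n} f {zero}  _       = refl
!-tab {suc n} f {suc i} (s≤s h) = !-tab (f ∘ suc) h

!-ext : ∀ {n} {v w : Vec ℤ n} → (∀ {i} → i < n → v ! i ≡ w ! i) → v ≡ w
!-ext {v = Vec.[]}     {Vec.[]}     e = refl
!-ext {v = x Vec.∷ xs} {y Vec.∷ ys} e = cong₂ Vec._∷_ (e (s≤s z≤n)) (!-ext (λ h → e (s≤s h)))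

-- Row d of an element of Tri n has length n ∸ d; beyond it, at is zero.
Tri : ℕ → Set
Tri zero    = ⊤
Tri (suc n) = Vec ℤ (suc n) × Tri n

at : ∀ {n} → Tri n → Labels
at {zero}  _       _       _ = 0ℤ
at {suc n} (r , _) zero    i = r ! i
at {suc n} (_ , g) (suc d) i = at g d i

tri : ∀ n → Labels → Tri n
tri zero    f = tt
tri (suc n) f = tab (suc n) (f 0) , tri n (f ∘ suc)

at-tri : ∀ {n} f d i → d ℕ.+ i < n → at (tri n f) d i ≡ f d i
at-tri {suc n} f zero    i h       = !-tab (f 0) h
at-tri {suc n} f (suc d) i (s≤s h) = at-tri (f ∘ suc) d i h

at-ext : ∀ {n} {g h : Tri n} → (∀ d i → d ℕ.+ i < n → at g d i ≡ at h d i) → g ≡ h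
at-ext {zero}  e = refl
at-ext {suc n} e = cong₂ _,_ (!-ext (λ {i} → e 0 i)) (at-ext (λ d i h → e (suc d) i (s≤s h)))

_≟ᵀ_ : ∀ {n} → DecidableEquality (Tri n)
_≟ᵀ_ {zero}  _ _ = yes refl
_≟ᵀ_ {suc n} = ≡-dec (Vecₚ.≡-dec ℤ._≟_) _≟ᵀ_

-- Patterns, and hives with prescribed edges

psum : (ℕ → ℤ) → ℕ → ℤ
psum f zero    = 0ℤ
psum f (suc i) = psum f i ℤ.+ f i

psum-cong : ∀ {f g : ℕ → ℤ} n → (∀ i → i < n → f i ≡ g i) → psum f n ≡ psum g n
psum-cong zero    e = refl
psum-cong (suc n) e = cong₂ ℤ._+_ (psum-cong n (λ i h → e i (ℕₚ.m≤n⇒m≤1+n h))) (e n ℕₚ.≤-refl)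

psum-unique : ∀ {f c : ℕ → ℤ} n → c 0 ≡ 0ℤ → (∀ i → i < n → c (suc i) ≡ c i ℤ.+ f i) → ∀ i → i ≤ n → c i ≡ psum f i
psum-unique         n z s zero    h = z
psum-unique {f} {c} n z s (suc i) h = trans (s i h) (cong (ℤ._+ f i) (psum-unique {f} {c} n z s i (ℕₚ.<⇒≤ h)))

record IsGT (k : ℕ) (g : Labels) : Set where
  field
    inter₁ : ∀ d i → suc (d ℕ.+ i) < k → g (suc d) i ℤ.≤ g d i
    inter₂ : ∀ d i → suc (d ℕ.+ i) < k → g d (suc i) ℤ.≤ g (suc d) i
    nonneg : ∀ d i → d ℕ.+ i < k → 0ℤ ℤ.≤ g d i

-- In diagonal coordinates the left edge runs from (0 , 0) to (n , 0), the right edge on to (0 , n),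
-- and the diagonal directly from (0 , 0) to (0 , n).
record LRHive (n : ℕ) (α β κ : ℕ → ℤ) (b : Labels) : Set where
  field
    hive   : IsHive n b
    origin : b 0 0 ≡ 0ℤ
    left   : ∀ j → j < n → b (suc j) 0 ≡ b j 0 ℤ.+ α j
    right  : ∀ d i → suc (d ℕ.+ i) ≡ n → b d (suc i) ≡ b (suc d) i ℤ.+ β i
    diag   : ∀ i → i < n → b 0 (suc i) ≡ b 0 i ℤ.+ κ i

  left-psum : ∀ j → j ≤ n → b j 0 ≡ psum α j
  left-psum = psum-unique {c = λ j → b j 0} n origin left

  diag-psum : ∀ i → i ≤ n → b 0 i ≡ psum κ i
  diag-psum = psum-unique {c = b 0} n origin diag

  right-psum : ∀ d i → d ℕ.+ i ≡ n → b d i ≡ psum α n ℤ.+ psum β i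
  right-psum d zero    e = trans (left-psum d (ℕₚ.≤-reflexive e′)) (trans (cong (psum α) e′) (sym (ℤₚ.+-identityʳ _)))
    where e′ = trans (sym (ℕₚ.+-identityʳ d)) e
  right-psum d (suc i) e = let e′ = trans (sym (ℕₚ.+-suc d i)) e in
    trans (right d i e′) (trans (cong (ℤ._+ β i) (right-psum (suc d) i e′)) (ℤₚ.+-assoc (psum α n) _ _))

  sum-edges : psum κ n ≡ psum α n ℤ.+ psum β n
  sum-edges = trans (sym (diag-psum n ℕₚ.≤-refl)) (right-psum 0 n refl)

NonNeg : ℕ → (ℕ → ℤ) → Set
NonNeg n f = ∀ i → i < n → 0ℤ ℤ.≤ f i

record _≻[_]_ (α : ℕ → ℤ) (n : ℕ) (ρ : ℕ → ℤ) : Set where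
  constructor interlace
  field
    below : ∀ i → i < n → ρ i ℤ.≤ α i
    above : ∀ i → i < n → α (suc i) ℤ.≤ ρ i

open _≻[_]_

-- A rhombus inequality compares the increments along two parallel edges; `step` and `unstep` pass
-- between the two readings.
step : ∀ {x x′ y y′ p q} → x′ ≡ x ℤ.+ p → y′ ≡ y ℤ.+ q → p ℤ.≤ q → Rh x′ y x y′
step {x} {y = y} {p = p} {q} refl refl h = rh (subst₂ ℤ._≤_ (l x y p) (ℤₚ.+-assoc x y q) (ℤₚ.+-monoʳ-≤ (x ℤ.+ y) h))
  where
  l : ∀ x y p → x ℤ.+ y ℤ.+ p ≡ x ℤ.+ p ℤ.+ y
  l = solve-∀

unstep : ∀ {x x′ y y′ p q} → x′ ≡ x ℤ.+ p → y′ ≡ y ℤ.+ q → Rh x′ y x y′ → p ℤ.≤ q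
unstep {x} {y = y} {p = p} {q} refl refl (rh h) = subst₂ ℤ._≤_ (l x y p) (r x y q) (ℤₚ.+-monoˡ-≤ (ℤ.- x ℤ.+ ℤ.- y) h)
  where
  l : ∀ x y p → x ℤ.+ p ℤ.+ y ℤ.+ (ℤ.- x ℤ.+ ℤ.- y) ≡ p
  l = solve-∀
  r : ∀ x y q → x ℤ.+ (y ℤ.+ q) ℤ.+ (ℤ.- x ℤ.+ ℤ.- y) ≡ q
  r = solve-∀

Δ-step : ∀ x y → x ≡ y ℤ.+ (x ℤ.- y)
Δ-step = solve-∀

Δ-≤ : ∀ {x x′ y y′} → Rh x′ y x y′ → x′ ℤ.- x ℤ.≤ y′ ℤ.- y
Δ-≤ {x} {x′} {y} {y′} = unstep (Δ-step x′ x) (Δ-step y′ y)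

unΔ : ∀ {x y p} → x ≡ y ℤ.+ p → x ℤ.- y ≡ p
unΔ {y = y} {p} refl = l y p
  where
  l : ∀ y p → y ℤ.+ p ℤ.- y ≡ p
  l = solve-∀

leftOf diagOf : Labels → ℕ → ℤ
leftOf b j = b (suc j) 0 ℤ.- b j 0
diagOf b i = b 0 (suc i) ℤ.- b 0 i

rightOf : ℕ → Labels → ℕ → ℤ
rightOf n b i = b (n ℕ.∸ suc i) (suc i) ℤ.- b (suc (n ℕ.∸ suc i)) i

rightOf-at : ∀ {n} (b : Labels) d i → suc (d ℕ.+ i) ≡ n → rightOf n b i ≡ b d (suc i) ℤ.- b (suc d) i
rightOf-at b d i refl = cong (λ e → b e (suc i) ℤ.- b (suc e) i) (ℕₚ.m+n∸n≡m d i)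

edge : ∀ {n} i → i < n → suc (n ℕ.∸ suc i ℕ.+ i) ≡ n
edge {n} i h = trans (sym (ℕₚ.+-suc (n ℕ.∸ suc i) i)) (ℕₚ.m∸n+n≡m h)

module _ {n α β κ b} (H : LRHive n α β κ b) where
  open LRHive H
  open IsHive hive

  -- By `r₂` the increments parallel to the left edge weakly increase as `i` grows with `d + i`
  -- fixed.
  left-edge : ∀ d i → d ℕ.+ i < n → α (d ℕ.+ i) ℤ.≤ b (suc d) i ℤ.- b d i
  left-edge d zero    h = ℤₚ.≤-reflexive (trans (cong α e) (sym (unΔ (left d (subst (_< n) e h)))))
    where e = ℕₚ.+-identityʳ d
  left-edge d (suc i) h = let h′ = subst (_< n) (ℕₚ.+-suc d i) h in
    subst (λ m → α m ℤ.≤ b (suc d) (suc i) ℤ.- b d (suc i)) (sym (ℕₚ.+-suc d i))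
      (ℤₚ.≤-trans (left-edge (suc d) i h′)
        (Δ-≤ (r₂ d i h′)))

  -- By `r₃` the increment at `i` is at least that at `suc i` for the same `d`; the walk ends on the
  -- right edge. Callers use only the sign of `β j`, hence the existential.
  right-edge : ∀ d i → d ℕ.+ i < n → ∃[ j ] j < n × β j ℤ.≤ b d (suc i) ℤ.- b (suc d) i
  right-edge d i h = n ℕ.∸ suc d , j<n , go (n ℕ.∸ suc (d ℕ.+ i)) i (trans (ℕₚ.m∸n+n≡m h) refl)
    where
    j<n : n ℕ.∸ suc d < n
    j<n = ℕₚ.∸-monoʳ-< {n} {suc d} {0} (s≤s z≤n) (ℕₚ.≤-trans (s≤s (ℕₚ.m≤m+n d i)) h)
    go : ∀ e i → e ℕ.+ suc (d ℕ.+ i) ≡ n → β (n ℕ.∸ suc d) ℤ.≤ b d (suc i) ℤ.- b (suc d) i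
    go zero    i refl = ℤₚ.≤-reflexive (trans (cong β (ℕₚ.m+n∸m≡n d i)) (sym (unΔ (right d i refl))))
    go (suc e) i eq = ℤₚ.≤-trans
      (go e (suc i) (trans (cong (λ m → e ℕ.+ suc m) (ℕₚ.+-suc d i)) (trans (ℕₚ.+-suc e _) eq)))
      (Δ-≤ (sr (r₃ d i (subst (suc (suc (d ℕ.+ i)) ≤_) eq (s≤s (ℕₚ.m≤n+m _ e))))))

  diag-edge : ∀ d i → d ℕ.+ i < n → b d (suc i) ℤ.- b d i ℤ.≤ κ i
  diag-edge zero    i h = ℤₚ.≤-reflexive (unΔ (diag i h))
  diag-edge (suc d) i h = ℤₚ.≤-trans (Δ-≤ (r₁ d i h)) (diag-edge d i (pred-< h))

  via : ∀ x y z → (y ℤ.- x) ℤ.+ (z ℤ.- y) ≡ z ℤ.- x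
  via = solve-∀

  -- A diagonal step is a step parallel to the left edge followed by one parallel to the right edge,
  -- and the latter is nonnegative. For partitions this is containment of `α` in `κ`.
  left⊆diag : NonNeg n β → ∀ i → i < n → α i ℤ.≤ κ i
  left⊆diag β≥0 i h with right-edge 0 i h
  ... | j , j<n , βj≤ = subst₂ ℤ._≤_ (ℤₚ.+-identityʳ (α i))
          (trans (via (b 0 i) (b 1 i) (b 0 (suc i))) (unΔ (diag i h)))
          (ℤₚ.+-mono-≤ (left-edge 0 i h) (ℤₚ.≤-trans (β≥0 j j<n) βj≤))

  -- The same small triangle is taken at the right edge; `diag-edge` then compares its third side
  -- with the diagonal.
  right⊆diag : NonNeg n α → ∀ i → i < n → β i ℤ.≤ κ i
  right⊆diag α≥0 i h = ℤₚ.≤-trans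
    (subst₂ ℤ._≤_ (ℤₚ.+-identityˡ (β i)) (via (b d i) (b (suc d) i) (b d (suc i)))
      (ℤₚ.+-mono-≤ (ℤₚ.≤-trans (α≥0 (d ℕ.+ i) h′) (left-edge d i h′)) (ℤₚ.≤-reflexive (sym (unΔ (right d i e))))))
    (diag-edge d i h′)
    where
    d  = n ℕ.∸ suc i
    e  = edge i h
    h′ : d ℕ.+ i < n
    h′ = ℕₚ.≤-reflexive e

-- Passing between neighbouring layers

-- The octahedron relation solved for the label of the layer above, starting from a diagonal with
-- increments `ρ`.
lower : Labels → (ℕ → ℤ) → Labels
lower b ρ zero    i = psum ρ i
lower b ρ (suc d) i =
  (lower b ρ d i ℤ.+ b (suc d) (suc i)) ℤ.⊔ (lower b ρ d (suc i) ℤ.+ b (suc d) i) ℤ.- b d (suc i)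

-- raiseAt d e i is the label of the vertex with diagonal coordinates d and i in
-- the layer below t, where d + e + i = n.
module _ (n : ℕ) (t : Labels) (α β : ℕ → ℤ) where
  raiseAt : ℕ → ℕ → ℕ → ℤ
  raiseAt d e       zero    = psum α d
  raiseAt d zero    (suc i) = psum α n ℤ.+ psum β (suc i)
  raiseAt d (suc e) (suc i) =
    (t d i ℤ.+ raiseAt (suc d) e (suc i)) ℤ.⊔ (t d (suc i) ℤ.+ raiseAt (suc d) (suc e) i) ℤ.- t (suc d) i

  raise : Labels
  raise d i = raiseAt d (n ℕ.∸ (d ℕ.+ i)) i

Octahedra : ℕ → Labels → Labels → Set
Octahedra n b t = ∀ d i → d ℕ.+ i < n →
  Octa (t (suc d) i) (b d (suc i)) (t d i) (b (suc d) (suc i)) (t d (suc i)) (b (suc d) i)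

octa-cong : ∀ {x y r s u v x′ y′ r′ s′ u′ v′} → x ≡ x′ → y ≡ y′ → r ≡ r′ → s ≡ s′ → u ≡ u′ → v ≡ v′ →
  Octa x y r s u v → Octa x′ y′ r′ s′ u′ v′
octa-cong refl refl refl refl refl refl o = o

-+-cancel : ∀ m y → m ℤ.- y ℤ.+ y ≡ m
-+-cancel = solve-∀

+-∸ : ∀ {x y m} → x ℤ.+ y ≡ m → x ≡ m ℤ.- y
+-∸ {x} {y} refl = l x y
  where
  l : ∀ x y → x ≡ x ℤ.+ y ℤ.- y
  l = solve-∀

+-∸′ : ∀ {x y m} → x ℤ.+ y ≡ m → y ≡ m ℤ.- x
+-∸′ {x} {y} e = +-∸ (trans (ℤₚ.+-comm y x) e)

1+d+1+i : ∀ {n} d i → d ℕ.+ i < n → suc d ℕ.+ suc i < suc (suc n)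
1+d+1+i {n} d i h = s≤s (s≤s (subst (_≤ n) (sym (ℕₚ.+-suc d i)) h))

d+1+i : ∀ {n} d i → d ℕ.+ i < n → d ℕ.+ suc i < suc n
d+1+i {n} d i h = s≤s (subst (_≤ n) (sym (ℕₚ.+-suc d i)) h)

module _ (n : ℕ) (b : Tri (suc (suc n))) (ρ : ℕ → ℤ) where
  private
    T = at (tri (suc n) (lower (at b) ρ))

  lower-diag : ∀ i → i ≤ n → T 0 i ≡ psum ρ i
  lower-diag i h = at-tri (lower (at b) ρ) 0 i (s≤s h)

  lower-octa : Octahedra n (at b) T
  lower-octa d i h = octa-cong
    (sym (at-tri L (suc d) i (s≤s h))) refl (sym (at-tri L d i (ℕₚ.m≤n⇒m≤1+n h))) refl
    (sym (at-tri L d (suc i) (d+1+i d i h))) refl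
    (octa (-+-cancel _ _))
    where L = lower (at b) ρ

  -- The recurrence forces every label once the diagonal is known. Together with `raise-unique` this
  -- makes the passage between layers invertible.
  lower-unique : ∀ (t : Tri (suc n)) → (∀ i → i ≤ n → at t 0 i ≡ psum ρ i) → Octahedra n (at b) (at t) →
    tri (suc n) (lower (at b) ρ) ≡ t
  lower-unique t z oct = at-ext λ d i h → trans (at-tri (lower (at b) ρ) d i h) (go d i h)
    where
    go : ∀ d i → d ℕ.+ i < suc n → lower (at b) ρ d i ≡ at t d i
    go zero    i (s≤s h) = sym (z i h)
    go (suc d) i (s≤s h) = trans
      (cong₂ (λ x y → (x ℤ.+ at b (suc d) (suc i)) ℤ.⊔ (y ℤ.+ at b (suc d) i) ℤ.- at b d (suc i))
        (go d i (ℕₚ.m≤n⇒m≤1+n h)) (go d (suc i) (d+1+i d i h)))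
      (sym (+-∸ (Octa.eq (oct d i h))))

module _ (n : ℕ) (t : Tri (suc n)) (α β : ℕ → ℤ) where
  private
    N = suc n
    R = raise N (at t) α β
    B = at (tri (suc N) R)

    raise-suc : ∀ d i → d ℕ.+ i < n → R d (suc i) ≡
      (at t d i ℤ.+ R (suc d) (suc i)) ℤ.⊔ (at t d (suc i) ℤ.+ R (suc d) i) ℤ.- at t (suc d) i
    -- The distance `N ∸ (d + suc i)` is a successor here, so the recursive clause of `raiseAt`
    -- applies.
    raise-suc d i h rewrite ℕₚ.+-suc d i | ℕₚ.+-∸-assoc 1 h = refl

  raise-left : ∀ d → d ≤ N → B d 0 ≡ psum α d
  raise-left d h = at-tri R d 0 (s≤s (subst (_≤ N) (sym (ℕₚ.+-identityʳ d)) h))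

  raise-right : ∀ d i → d ℕ.+ i ≡ N → B d i ≡ psum α N ℤ.+ psum β i
  raise-right d zero    e = trans (raise-left d (ℕₚ.≤-reflexive e′)) (trans (cong (psum α) e′)
      (sym (ℤₚ.+-identityʳ _)))
    where e′ = trans (sym (ℕₚ.+-identityʳ d)) e
  raise-right d (suc i) e = trans (at-tri R d (suc i) (s≤s (ℕₚ.≤-reflexive e)))
    (cong (λ m → raiseAt N (at t) α β d m (suc i)) (trans (cong (ℕ._∸ (d ℕ.+ suc i)) (sym e))
        (ℕₚ.n∸n≡0 (d ℕ.+ suc i))))

  raise-octa : Octahedra n B (at t)
  raise-octa d i h = octa-cong refl (sym (at-tri R d (suc i) (ℕₚ.m≤n⇒m≤1+n (d+1+i d i h)))) refl
    (sym (at-tri R (suc d) (suc i) (1+d+1+i d i h))) refl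
    (sym (at-tri R (suc d) i (s≤s (ℕₚ.m≤n⇒m≤1+n h))))
    (octa (trans (cong (ℤ._+_ (at t (suc d) i)) (raise-suc d i h)) (+- _ (at t (suc d) i))))
    where
    +- : ∀ m y → y ℤ.+ (m ℤ.- y) ≡ m
    +- = solve-∀

  raise-unique : ∀ (b : Tri (suc N)) → (∀ d → d ≤ N → at b d 0 ≡ psum α d) →
    (∀ d i → d ℕ.+ i ≡ N → at b d i ≡ psum α N ℤ.+ psum β i) → Octahedra n (at b) (at t) →
    tri (suc N) R ≡ b
  raise-unique b l r oct = at-ext λ { d i (s≤s h) → trans (at-tri R d i (s≤s h))
      (go d _ i (trans (ℕₚ.+-assoc d _ i) (trans (cong (d ℕ.+_) (ℕₚ.+-comm _ i))
          (trans (sym (ℕₚ.+-assoc d i _)) (ℕₚ.m+[n∸m]≡n h))))) }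
    where
    go : ∀ d e i → d ℕ.+ e ℕ.+ i ≡ N → raiseAt N (at t) α β d e i ≡ at b d i
    go d e       zero    eq = sym (l d (ℕₚ.≤-trans (ℕₚ.m≤m+n d e) (ℕₚ.≤-reflexive
        (trans (sym (ℕₚ.+-identityʳ _)) eq))))
    go d zero    (suc i) eq = sym (r d (suc i) (trans (cong (ℕ._+ suc i) (sym (ℕₚ.+-identityʳ d))) eq))
    go d (suc e) (suc i) eq = trans
      (cong₂ (λ x y → (at t d i ℤ.+ x) ℤ.⊔ (at t d (suc i) ℤ.+ y) ℤ.- at t (suc d) i)
        (go (suc d) e (suc i) (trans (cong (ℕ._+ suc i) (sym (ℕₚ.+-suc d e))) eq))
        (go (suc d) (suc e) i (trans (sym (ℕₚ.+-suc (d ℕ.+ suc e) i)) eq)))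
      (sym (+-∸′ (Octa.eq (oct d i (h d e i eq)))))
      where
      h : ∀ d e i → d ℕ.+ suc e ℕ.+ suc i ≡ suc n → d ℕ.+ i < n
      h d e i eq = ℕₚ.≤-trans (s≤s (ℕₚ.+-monoˡ-≤ i (ℕₚ.m≤m+n d e))) (ℕₚ.≤-reflexive (ℕₚ.suc-injective
        (trans (trans (cong suc (sym (cong (ℕ._+ i) (ℕₚ.+-suc d e)))) (sym (ℕₚ.+-suc (d ℕ.+ suc e) i))) eq)))

≻-cong : ∀ {n α α′ ρ ρ′} → (∀ i → i < suc n → α i ≡ α′ i) → (∀ i → i < n → ρ i ≡ ρ′ i) → α ≻[ n ] ρ → α′ ≻[ n ] ρ′
≻-cong e f (interlace p q) = interlace
  (λ i h → subst₂ ℤ._≤_ (f i h) (e i (ℕₚ.m≤n⇒m≤1+n h)) (p i h))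
  (λ i h → subst₂ ℤ._≤_ (e (suc i) (s≤s h)) (f i h) (q i h))

LRHive-cong : ∀ {n α α′ β β′ κ κ′ b} → (∀ i → i < n → α i ≡ α′ i) → (∀ i → i < n → β i ≡ β′ i) →
  (∀ i → i < n → κ i ≡ κ′ i) → LRHive n α β κ b → LRHive n α′ β′ κ′ b
LRHive-cong {b = b} eα eβ eκ H = record
  { hive   = H.hive
  ; origin = H.origin
  ; left   = λ j h → trans (H.left j h) (cong (ℤ._+_ (b j 0)) (eα j h))
  ; right  = λ d i e → trans (H.right d i e) (cong (ℤ._+_ (b (suc d) i))
      (eβ i (ℕₚ.≤-trans (s≤s (ℕₚ.m≤n+m i d)) (ℕₚ.≤-reflexive e))))
  ; diag   = λ i h → trans (H.diag i h) (cong (ℤ._+_ (b 0 i)) (eκ i h))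
  }
  where module H = LRHive H

GT-head : ∀ {n} {v : Vec ℤ (suc n)} {g : Tri n} → IsGT (suc n) (at (v , g)) → (v !_) ≻[ n ] at g 0
GT-head G = interlace (λ i h → inter₁ 0 i (s≤s h)) (λ i h → inter₂ 0 i (s≤s h))
  where open IsGT G

GT-tail : ∀ {n} {v : Vec ℤ (suc n)} {g : Tri n} → IsGT (suc n) (at (v , g)) → IsGT n (at g)
GT-tail G = record
  { inter₁ = λ d i h → inter₁ (suc d) i (s≤s h)
  ; inter₂ = λ d i h → inter₂ (suc d) i (s≤s h)
  ; nonneg = λ d i h → nonneg (suc d) i (s≤s h) }
  where open IsGT G

GT-cons : ∀ {n} {v : Vec ℤ (suc n)} {g : Tri n} → NonNeg (suc n) (v !_) → (v !_) ≻[ n ] at g 0 → IsGT n (at g) →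
  IsGT (suc n) (at (v , g))
GT-cons v≥0 v≻g G = record
  { inter₁ = λ { zero i (s≤s h) → below v≻g i h ; (suc d) i (s≤s h) → inter₁ d i h }
  ; inter₂ = λ { zero i (s≤s h) → above v≻g i h ; (suc d) i (s≤s h) → inter₂ d i h }
  ; nonneg = λ { zero i h → v≥0 i h ; (suc d) i (s≤s h) → nonneg d i h } }
  where open IsGT G

module _ {n α′ β′ ρ} {t : Tri (suc n)} (H : LRHive n α′ β′ ρ (at t)) where
  private
    N = suc n
    module H = LRHive H

  module _ (α β : ℕ → ℤ) (α≻ : α ≻[ n ] α′) (β≻ : β ≻[ n ] β′) where
    private
      B : Labels
      B = at (tri (suc N) (raise N (at t) α β))

      left : ∀ j → j < N → B (suc j) 0 ≡ B j 0 ℤ.+ α j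
      left j h = trans (raise-left n t α β (suc j) h)
        (cong (ℤ._+ α j) (sym (raise-left n t α β j (ℕₚ.<⇒≤ h))))

      right : ∀ d i → suc (d ℕ.+ i) ≡ N → B d (suc i) ≡ B (suc d) i ℤ.+ β i
      right d i e = trans (raise-right n t α β d (suc i) (trans (ℕₚ.+-suc d i) e))
        (trans (sym (ℤₚ.+-assoc (psum α N) (psum β i) (β i)))
          (cong (ℤ._+ β i) (sym (raise-right n t α β (suc d) i e))))

      d+0 : ∀ {d} → d ℕ.+ 0 < n → d < n
      d+0 {d} = subst (_< n) (ℕₚ.+-identityʳ d)

      d+i : ∀ {d i} → suc (d ℕ.+ i) ≡ n → i < n
      d+i {d} {i} e = ℕₚ.≤-trans (s≤s (ℕₚ.m≤n+m i d)) (ℕₚ.≤-reflexive e)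

      module D = Layer.Down n B (at t) (raise-octa n t α β) H.hive
        (λ d h → step (H.left d (d+0 h)) (left d (ℕₚ.m≤n⇒m≤1+n (d+0 h))) (below α≻ d (d+0 h)))
        (λ d h → step (left (suc d) (s≤s (d+0 h))) (H.left d (d+0 h)) (above α≻ d (d+0 h)))
        (λ d i e → step (H.right d i e) (right (suc d) i (cong suc e)) (below β≻ i (d+i {d} e)))
        (λ d i e → sr (step (right d (suc i) (cong suc (trans (ℕₚ.+-suc d i) e))) (H.right d i e)
            (above β≻ i (d+i {d} e))))

    raise-hive : LRHive N α β (diagOf B) B
    raise-hive = record
      { hive   = D.hive′
      ; origin = raise-left n t α β 0 z≤n
      ; left   = left
      ; right  = right
      ; diag   = λ i _ → Δ-step (B 0 (suc i)) (B 0 i)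
      }

    raise-≻ : diagOf B ≻[ n ] ρ
    raise-≻ = interlace
      (λ i h → unstep (H.diag i h) (Δ-step (B 0 (suc i)) (B 0 i)) (D.p₁ 0 i h))
      (λ i h → unstep (Δ-step (B 0 (suc (suc i))) (B 0 (suc i))) (H.diag i h) (D.p₂ 0 i h))

module _ {n α β κ} {b : Tri (suc (suc n))} (H : LRHive (suc n) α β κ (at b)) (ρ : ℕ → ℤ) (κ≻ρ : κ ≻[ n ] ρ) where
  private
    N = suc n
    module H = LRHive H
    B = at b
    T : Labels
    T = at (tri N (lower B ρ))

    diag : ∀ i → i < n → T 0 (suc i) ≡ T 0 i ℤ.+ ρ i
    diag i h = trans (lower-diag n b ρ (suc i) h) (cong (ℤ._+ ρ i) (sym (lower-diag n b ρ i (ℕₚ.<⇒≤ h))))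

    module U = Layer.Up n B T (lower-octa n b ρ) H.hive
      (λ i h → step (diag i h) (H.diag i (ℕₚ.m≤n⇒m≤1+n h)) (below κ≻ρ i h))
      (λ i h → step (H.diag (suc i) (s≤s h)) (diag i h) (above κ≻ρ i h))

    Tleft : ∀ j → T (suc j) 0 ≡ T j 0 ℤ.+ leftOf T j
    Tleft j = Δ-step (T (suc j) 0) (T j 0)

    Tright : ∀ d i → suc (d ℕ.+ i) ≡ n → T d (suc i) ≡ T (suc d) i ℤ.+ rightOf n T i
    Tright d i e = trans (Δ-step (T d (suc i)) (T (suc d) i)) (cong (ℤ._+_ (T (suc d) i)) (sym (rightOf-at T d i e)))

  lower-hive : LRHive n (leftOf T) (rightOf n T) ρ T
  lower-hive = record
    { hive   = U.hive′
    ; origin = lower-diag n b ρ 0 z≤n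
    ; left   = λ j _ → Tleft j
    ; right  = Tright
    ; diag   = diag
    }

  lower-left : α ≻[ n ] leftOf T
  lower-left = interlace
    (λ j h → unstep (Tleft j) (H.left j (ℕₚ.m≤n⇒m≤1+n h)) (U.l₁ j (subst (_< n) (sym (ℕₚ.+-identityʳ j)) h)))
    (λ j h → unstep (H.left (suc j) (s≤s h)) (Tleft j) (U.l₂ j (subst (_< n) (sym (ℕₚ.+-identityʳ j)) h)))

  lower-right : β ≻[ n ] rightOf n T
  lower-right = interlace
    (λ i h → let e = edge i h ; d = n ℕ.∸ suc i in
      unstep (Tright d i e) (H.right (suc d) i (cong suc e)) (U.e₁ d i (ℕₚ.≤-reflexive e)))
    (λ i h → let e = edge i h ; d = n ℕ.∸ suc i in
      unstep (H.right d (suc i) (cong suc (trans (ℕₚ.+-suc d i) e))) (Tright d i e)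
          (sr (U.e₂ d i (ℕₚ.≤-reflexive e))))

-- The bijection behind the Littlewood–Richardson rule: a pair of Gelfand–Tsetlin
-- patterns corresponds to a hive together with a pattern for its diagonal.

Φ : ∀ k → Tri k → Tri k → Tri (suc k) × Tri k
Φ zero    _        _        = (0ℤ Vec.∷ Vec.[] , tt) , tt
Φ (suc k) (μ , g₁) (ν , g₂) =
  let t , g = Φ k g₁ g₂
      b     = tri (suc (suc k)) (raise (suc k) (at t) (μ !_) (ν !_))
  in b , tab (suc k) (diagOf (at b)) , g

Ψ : ∀ k → Tri (suc k) → Tri k → Tri k × Tri k
Ψ zero    _ _       = tt , tt
Ψ (suc k) b (κ , g) =
  let g₁ , g₂ = Ψ k (tri (suc k) (lower (at b) (at g 0))) g
  in (tab (suc k) (leftOf (at b)) , g₁) , (tab (suc k) (rightOf (suc k) (at b)) , g₂)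

Φ-hive : ∀ k (g₁ g₂ : Tri k) → IsGT k (at g₁) → IsGT k (at g₂) → let b , g = Φ k g₁ g₂ in
  LRHive k (at g₁ 0) (at g₂ 0) (at g 0) (at b) × IsGT k (at g)
Φ-hive zero g₁ g₂ G₁ G₂ = record
  { hive = record { r₁ = λ _ _ () ; r₂ = λ _ _ () ; r₃ = λ _ _ () }
  ; origin = refl ; left = λ _ () ; right = λ _ _ () ; diag = λ _ () } , G₁
Φ-hive (suc k) (μ , g₁) (ν , g₂) G₁ G₂ =
    LRHive-cong (λ _ _ → refl) (λ _ _ → refl) eq H′ ,
    GT-cons κ≥0 (≻-cong eq (λ _ _ → refl) (raise-≻ H (μ !_) (ν !_) (GT-head G₁) (GT-head G₂))) (proj₂ rec)
  where
  rec = Φ-hive k g₁ g₂ (GT-tail G₁) (GT-tail G₂)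
  H   = proj₁ rec
  H′  = raise-hive H (μ !_) (ν !_) (GT-head G₁) (GT-head G₂)
  b   = proj₁ (Φ (suc k) (μ , g₁) (ν , g₂))
  eq : ∀ i → i < suc k → diagOf (at b) i ≡ tab (suc k) (diagOf (at b)) ! i
  eq i h = sym (!-tab (diagOf (at b)) h)
  -- The new top row dominates that of the first pattern, which is nonnegative.
  κ≥0 : NonNeg (suc k) (tab (suc k) (diagOf (at b)) !_)
  κ≥0 i h = subst (0ℤ ℤ.≤_) (eq i h)
    (ℤₚ.≤-trans (IsGT.nonneg G₁ 0 i h) (left⊆diag H′ (λ j → IsGT.nonneg G₂ 0 j) i h))

-- Nonnegativity of the edges is inherited by the next layer, because entry `i` of its edge is at
-- least entry `suc i` of the edge before.
Ψ-GT : ∀ k {α β} (b : Tri (suc k)) (g : Tri k) → NonNeg k α → NonNeg k β →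
  LRHive k α β (at g 0) (at b) → IsGT k (at g) → let g₁ , g₂ = Ψ k b g in
  (IsGT k (at g₁) × (∀ i → i < k → at g₁ 0 i ≡ α i)) × (IsGT k (at g₂) × (∀ i → i < k → at g₂ 0 i ≡ β i))
Ψ-GT zero    b g α≥0 β≥0 H G = (G , λ _ ()) , (G , λ _ ())
Ψ-GT (suc k) {α} {β} b (κ , g) α≥0 β≥0 H G =
  let (G₁ , e₁) , (G₂ , e₂) = Ψ-GT k t g (above-≥0 α≥0 lα) (above-≥0 β≥0 lβ) (lower-hive H (at g 0) (GT-head G)) (GT-tail G)
  in (GT-cons (≥0-cong α≡ α≥0) (≻-cong α≡ (λ i h → sym (e₁ i h)) lα) G₁ , λ i h → sym (α≡ i h))
   , (GT-cons (≥0-cong β≡ β≥0) (≻-cong β≡ (λ i h → sym (e₂ i h)) lβ) G₂ , λ i h → sym (β≡ i h))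
  where
  t = tri (suc k) (lower (at b) (at g 0))
  lα = lower-left H (at g 0) (GT-head G)
  lβ = lower-right H (at g 0) (GT-head G)
  α≡ : ∀ i → i < suc k → α i ≡ tab (suc k) (leftOf (at b)) ! i
  α≡ i h = sym (trans (!-tab (leftOf (at b)) h) (unΔ (LRHive.left H i h)))
  β≡ : ∀ i → i < suc k → β i ≡ tab (suc k) (rightOf (suc k) (at b)) ! i
  β≡ i h = sym (trans (!-tab (rightOf (suc k) (at b)) h) (unΔ (LRHive.right H (suc k ℕ.∸ suc i) i (edge i h))))
  above-≥0 : ∀ {α ρ} → NonNeg (suc k) α → α ≻[ k ] ρ → NonNeg k ρ
  above-≥0 α≥0 l i h = ℤₚ.≤-trans (α≥0 (suc i) (s≤s h)) (above l i h)
  ≥0-cong : ∀ {α ρ} → (∀ i → i < suc k → α i ≡ ρ i) → NonNeg (suc k) α → NonNeg (suc k) ρ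
  ≥0-cong e α≥0 i h = subst (0ℤ ℤ.≤_) (e i h) (α≥0 i h)

Ψ-Φ : ∀ k (g₁ g₂ : Tri k) → IsGT k (at g₁) → IsGT k (at g₂) → uncurry (Ψ k) (Φ k g₁ g₂) ≡ (g₁ , g₂)
Ψ-Φ zero    g₁ g₂ G₁ G₂ = refl
Ψ-Φ (suc k) (μ , g₁) (ν , g₂) G₁ G₂ = cong₂ _,_
    (cong₂ _,_ (!-ext λ {i} h → trans (!-tab (leftOf (at b)) h) (unΔ (LRHive.left H′ i h))) (cong proj₁ rec))
    (cong₂ _,_ (!-ext λ {i} h → trans (!-tab (rightOf (suc k) (at b)) h)
        (unΔ (LRHive.right H′ (suc k ℕ.∸ suc i) i (edge i h)))) (cong proj₂ rec))
  where
  t  = proj₁ (Φ k g₁ g₂)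
  g  = proj₂ (Φ k g₁ g₂)
  b  = tri (suc (suc k)) (raise (suc k) (at t) (μ !_) (ν !_))
  H  = proj₁ (Φ-hive k g₁ g₂ (GT-tail G₁) (GT-tail G₂))
  H′ = raise-hive H (μ !_) (ν !_) (GT-head G₁) (GT-head G₂)
  rec : Ψ k (tri (suc k) (lower (at b) (at g 0))) g ≡ (g₁ , g₂)
  -- Lowering undoes raising: `t` itself satisfies the octahedra with `b` and has the prescribed
  -- diagonal.
  rec = trans (cong (λ t → Ψ k t g) (lower-unique k b (at g 0) t (LRHive.diag-psum H) (raise-octa k t (μ !_) (ν !_))))
    (Ψ-Φ k g₁ g₂ (GT-tail G₁) (GT-tail G₂))

Φ-Ψ : ∀ k {α β} (b : Tri (suc k)) (g : Tri k) → LRHive k α β (at g 0) (at b) → IsGT k (at g) →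
  uncurry (Φ k) (Ψ k b g) ≡ (b , g)
Φ-Ψ zero    (x Vec.∷ Vec.[] , tt) tt H G = cong (λ x → (x Vec.∷ Vec.[] , tt) , tt) (sym (LRHive.origin H))
Φ-Ψ (suc k) {α} {β} b (κ , g) H G = trans
    (cong (λ { (t , g) → let b = tri (suc (suc k)) (raise (suc k) (at t) (L !_) (R !_)) in
        b , tab (suc k) (diagOf (at b)) , g })
      (Φ-Ψ k t g (lower-hive H (at g 0) (GT-head G)) (GT-tail G)))
    (cong₂ (λ b κ → b , κ , g) b≡ (trans (cong (tab (suc k) ∘ diagOf ∘ at) b≡)
      (!-ext λ {i} h → trans (!-tab (diagOf (at b)) h) (unΔ (LRHive.diag H i h)))))
  where
  t = tri (suc k) (lower (at b) (at g 0))
  L = tab (suc k) (leftOf (at b))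
  R = tab (suc k) (rightOf (suc k) (at b))
  α≡ : ∀ i → i < suc k → α i ≡ L ! i
  α≡ i h = sym (trans (!-tab (leftOf (at b)) h) (unΔ (LRHive.left H i h)))
  β≡ : ∀ i → i < suc k → β i ≡ R ! i
  β≡ i h = sym (trans (!-tab (rightOf (suc k) (at b)) h) (unΔ (LRHive.right H (suc k ℕ.∸ suc i) i (edge i h))))
  H′ : LRHive (suc k) (L !_) (R !_) (κ !_) (at b)
  H′ = LRHive-cong α≡ β≡ (λ _ _ → refl) H
  b≡ : tri (suc (suc k)) (raise (suc k) (at t) (L !_) (R !_)) ≡ b
  b≡ = raise-unique k t (L !_) (R !_) b (LRHive.left-psum H′) (LRHive.right-psum H′) (lower-octa k b (at g 0))

rowSum : ∀ {k} → Tri k → ℕ → ℤ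
rowSum {k} g d = psum (at g d) (k ℕ.∸ d)

-- Row `d` of the resulting pattern is the diagonal of a hive whose other edges are the rows `d` of
-- `g₁` and `g₂`, so `sum-edges` applies. This is the additivity of weights.
Φ-rowSum : ∀ k (g₁ g₂ : Tri k) → IsGT k (at g₁) → IsGT k (at g₂) →
  ∀ d → rowSum (proj₂ (Φ k g₁ g₂)) d ≡ rowSum g₁ d ℤ.+ rowSum g₂ d
Φ-rowSum zero    g₁ g₂ G₁ G₂ zero    = refl
Φ-rowSum zero    g₁ g₂ G₁ G₂ (suc d) = refl
Φ-rowSum (suc k) g₁ g₂ G₁ G₂ zero    = LRHive.sum-edges (proj₁ (Φ-hive (suc k) g₁ g₂ G₁ G₂))
Φ-rowSum (suc k) (μ , g₁) (ν , g₂) G₁ G₂ (suc d) = Φ-rowSum k g₁ g₂ (GT-tail G₁) (GT-tail G₂) d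

-- Semistandard tableaux and Gelfand–Tsetlin patterns

rowAt : ∀ {A : Set} → List (List A) → ℕ → List A
rowAt []      _       = []
rowAt (r ∷ _) zero    = r
rowAt (_ ∷ t) (suc i) = rowAt t i

bump : ∀ {P : Set} → Dec P → ℕ → ℕ
bump (yes _) n = suc n
bump (no _)  n = n

-- For row `i` of a tableau, `cnt x` is part `i` of the shape formed by the letters below `x`. These
-- numbers determine a sorted row, and column strictness becomes their interlacing.
cnt : ∀ {k} → ℕ → List (Fin k) → ℕ
cnt x []      = 0
cnt x (y ∷ r) = bump (Fin.toℕ y ℕ.<? x) (cnt x r)

cnt-yes : ∀ {k x} {y : Fin k} r → Fin.toℕ y < x → cnt x (y ∷ r) ≡ suc (cnt x r)
cnt-yes {x = x} {y} r h with Fin.toℕ y ℕ.<? x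
... | yes _ = refl
... | no ¬h = contradiction h ¬h

cnt-no : ∀ {k x} {y : Fin k} r → ¬ (Fin.toℕ y < x) → cnt x (y ∷ r) ≡ cnt x r
cnt-no {x = x} {y} r ¬h with Fin.toℕ y ℕ.<? x
... | yes h = contradiction h ¬h
... | no _  = refl

cnt-mono : ∀ {k x x′} (r : List (Fin k)) → x ≤ x′ → cnt x r ≤ cnt x′ r
cnt-mono [] h = z≤n
cnt-mono {x = x} {x′} (y ∷ r) h with Fin.toℕ y ℕ.<? x | Fin.toℕ y ℕ.<? x′
... | yes p | yes q = s≤s (cnt-mono r h)
... | yes p | no ¬q = contradiction (ℕₚ.≤-trans p h) ¬q
... | no ¬p | yes q = ℕₚ.m≤n⇒m≤1+n (cnt-mono r h)
... | no ¬p | no ¬q = cnt-mono r h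

cnt-zero : ∀ {k} (r : List (Fin k)) → cnt 0 r ≡ 0
cnt-zero []      = refl
cnt-zero (y ∷ r) = trans (cnt-no {y = y} r (λ ())) (cnt-zero r)

cnt-all : ∀ {k} (r : List (Fin k)) → cnt k r ≡ length r
cnt-all []      = refl
cnt-all (y ∷ r) = trans (cnt-yes r (Finₚ.toℕ<n y)) (cong suc (cnt-all r))

cnt-++ : ∀ {k} x (r s : List (Fin k)) → cnt x (r ++ s) ≡ cnt x r ℕ.+ cnt x s
cnt-++ x []      s = refl
cnt-++ x (y ∷ r) s with Fin.toℕ y ℕ.<? x
... | yes _ = cong suc (cnt-++ x r s)
... | no _  = cnt-++ x r s

Sorted : ∀ {k} → List (Fin k) → Set
Sorted = Linked Fin._≤_

sorted-head : ∀ {k} {y : Fin k} {r} → Sorted (y ∷ r) → All (y Fin.≤_) r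
sorted-head {r = []}    s        = []
sorted-head {r = z ∷ r} (p ∷ s) = p ∷ All.map (ℕₚ.≤-trans p) (sorted-head s)

cnt-sorted-zero : ∀ {k x} {y : Fin k} {r} → Sorted (y ∷ r) → x ≤ Fin.toℕ y → cnt x (y ∷ r) ≡ 0
cnt-sorted-zero s h = none (h ∷ All.map (ℕₚ.≤-trans h) (sorted-head s))
  where
  none : ∀ {k x} {r : List (Fin k)} → All (λ y → x ≤ Fin.toℕ y) r → cnt x r ≡ 0
  none []      = refl
  none {r = y ∷ r} (p ∷ q) = trans (cnt-no r (ℕₚ.≤⇒≯ p)) (none q)

-- The box above a letter that is at most `x` holds a letter below `x`.
above⇒cnt : ∀ {k} {upper lower : List (Fin k)} → upper Above lower → ∀ x → cnt (suc x) lower ≤ cnt x upper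
above⇒cnt [] x = z≤n
above⇒cnt {upper = z ∷ zs} {y ∷ ys} (z<y ∷ p) x with Fin.toℕ y ℕ.<? suc x | Fin.toℕ z ℕ.<? x
... | yes q | yes r = s≤s (above⇒cnt p x)
... | yes (s≤s q) | no ¬r = contradiction (ℕₚ.≤-trans z<y q) ¬r
... | no ¬q | yes r = ℕₚ.m≤n⇒m≤1+n (above⇒cnt p x)
... | no ¬q | no ¬r = above⇒cnt p x

cnt⇒above : ∀ {k} {upper lower : List (Fin k)} → Sorted upper → Sorted lower →
  (∀ x → x < k → cnt (suc x) lower ≤ cnt x upper) → upper Above lower
cnt⇒above {lower = []} su sl h = []
cnt⇒above {upper = []} {y ∷ lower} su sl h =
  contradiction (subst (_≤ 0) (cnt-yes lower ℕₚ.≤-refl) (h (Fin.toℕ y) (Finₚ.toℕ<n y))) λ ()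
cnt⇒above {upper = z ∷ upper} {y ∷ lower} su sl h = z<y ∷ cnt⇒above (Linked.tail su) (Linked.tail sl) h′
  where
  z<y : Fin.toℕ z < Fin.toℕ y
  z<y = ℕₚ.≰⇒> λ y≤z → contradiction
    (subst₂ _≤_ (cnt-yes lower ℕₚ.≤-refl) (cnt-sorted-zero su y≤z) (h (Fin.toℕ y) (Finₚ.toℕ<n y))) λ ()
  h′ : ∀ x → x < _ → cnt (suc x) lower ≤ cnt x upper
  h′ x x<k with Fin.toℕ y ℕ.<? suc x
  ... | yes (s≤s p) = ℕ.s≤s⁻¹ (subst₂ _≤_ (cnt-yes lower (s≤s p)) (cnt-yes upper (ℕₚ.≤-trans z<y p)) (h x x<k))
  ... | no ¬p = ℕₚ.≤-trans (ℕₚ.≤-reflexive (trans (sym (cnt-no lower ¬p)) (cnt-sorted-zero sl (ℕₚ.≮⇒≥ ¬p)))) z≤n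

sorted-ext : ∀ {k} {r s : List (Fin k)} → Sorted r → Sorted s → (∀ x → x ≤ k → cnt x r ≡ cnt x s) → r ≡ s
sorted-ext {r = []}    {[]}    _ _ e = refl
sorted-ext {r = []}    {z ∷ s} _ _ e = contradiction (trans (e (suc (Fin.toℕ z)) (Finₚ.toℕ<n z))
    (cnt-yes s ℕₚ.≤-refl)) λ ()
sorted-ext {r = y ∷ r} {[]}    _ _ e = contradiction (trans (sym (e (suc (Fin.toℕ y)) (Finₚ.toℕ<n y)))
    (cnt-yes r ℕₚ.≤-refl)) λ ()
sorted-ext {k} {y ∷ r} {z ∷ s} sr sl e = cong₂ _∷_ y≡z (sorted-ext (Linked.tail sr) (Linked.tail sl) e′)
  where
  y≡z : y ≡ z
  y≡z with ℕₚ.<-cmp (Fin.toℕ y) (Fin.toℕ z)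
  ... | tri< y<z _ _ = contradiction
          (trans (sym (cnt-yes r ℕₚ.≤-refl)) (trans (e (suc (Fin.toℕ y)) (Finₚ.toℕ<n y))
              (cnt-sorted-zero sl y<z))) λ ()
  ... | tri≈ _ y≡z _ = Finₚ.toℕ-injective y≡z
  ... | tri> _ _ z<y = contradiction
          (trans (sym (cnt-yes s ℕₚ.≤-refl)) (trans (sym (e (suc (Fin.toℕ z)) (Finₚ.toℕ<n z)))
              (cnt-sorted-zero sr z<y))) λ ()
  e′ : ∀ x → x ≤ k → cnt x r ≡ cnt x s
  e′ x h with e x h
  ... | eq rewrite y≡z with Fin.toℕ z ℕ.<? x
  ...   | yes p = ℕₚ.suc-injective eq
  ...   | no ¬p = eq

-- The inverse of counting: `f` prescribes cumulative counts, and the letters after the smallest are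
-- counted relative to `f 1`.
rowOf : ∀ k → (ℕ → ℕ) → List (Fin k)
rowOf zero    f = []
rowOf (suc k) f = replicate (f 1) Fin.zero ++ map Fin.suc (rowOf k (λ x → f (suc x) ℕ.∸ f 1))

Monotone : ℕ → (ℕ → ℕ) → Set
Monotone k f = ∀ x → x < k → f x ≤ f (suc x)

monotone-from : ∀ {k f} → Monotone k f → ∀ {y} x → y ≤ x → x ≤ k → f y ≤ f x
monotone-from m {y} x y≤x x≤k with ℕₚ.m≤n⇒m<n∨m≡n y≤x
... | inj₂ refl = ℕₚ.≤-refl
monotone-from m (suc x) y≤x x≤k | inj₁ (s≤s y≤x′) = ℕₚ.≤-trans (monotone-from m x y≤x′ (ℕₚ.<⇒≤ x≤k)) (m x x≤k)

monotone-shift : ∀ {k f} → Monotone (suc k) f → Monotone k (λ x → f (suc x) ℕ.∸ f 1)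
monotone-shift {f = f} m x h = ℕₚ.∸-monoˡ-≤ (f 1) (m (suc x) (s≤s h))

cnt-replicate : ∀ {k x} n → cnt {suc k} (suc x) (replicate n Fin.zero) ≡ n
cnt-replicate zero    = refl
cnt-replicate (suc n) = trans (cnt-yes (replicate n Fin.zero) (s≤s z≤n)) (cong suc (cnt-replicate n))

cnt-suc : ∀ {k} x (r : List (Fin k)) → cnt (suc x) (map Fin.suc r) ≡ cnt x r
cnt-suc x []      = refl
cnt-suc x (y ∷ r) with Fin.toℕ y ℕ.<? x
... | yes p = trans (cnt-yes (map Fin.suc r) (s≤s p)) (cong suc (cnt-suc x r))
... | no ¬p = trans (cnt-no (map Fin.suc r) (λ { (s≤s p) → ¬p p })) (cnt-suc x r)

cnt-rowOf : ∀ k {f} → f 0 ≡ 0 → Monotone k f → ∀ x → x ≤ k → cnt x (rowOf k f) ≡ f x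
cnt-rowOf k         z m zero    h       = trans (cnt-zero (rowOf k _)) (sym z)
cnt-rowOf (suc k) {f} z m (suc x) (s≤s h) = trans (cnt-++ (suc x) (replicate (f 1) Fin.zero) _)
  (trans (cong₂ ℕ._+_ (cnt-replicate (f 1))
      (trans (cnt-suc x (rowOf k _)) (cnt-rowOf k (ℕₚ.n∸n≡0 (f 1)) (monotone-shift m) x h)))
    (ℕₚ.m+[n∸m]≡n (monotone-from m (suc x) (s≤s z≤n) (s≤s h))))

rowOf-sorted : ∀ k f → Sorted (rowOf k f)
rowOf-sorted zero    f = []
rowOf-sorted (suc k) f = prepend (f 1) (raise-sorted (rowOf-sorted k _))
  where
  raise-sorted : ∀ {r : List (Fin k)} → Sorted r → Sorted (map Fin.suc r)
  raise-sorted []      = []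
  raise-sorted [-]     = [-]
  raise-sorted (p ∷ s) = s≤s p ∷ raise-sorted s
  prepend : ∀ n {r : List (Fin (suc k))} → Sorted r → Sorted (replicate n Fin.zero ++ r)
  prepend zero          s = s
  prepend (suc zero)    {[]}    s = [-]
  prepend (suc zero)    {x ∷ r} s = z≤n ∷ s
  prepend (suc (suc n)) s = z≤n ∷ prepend (suc n) s

-- Content

-- Partial sums determine an exponent vector, and they are what the row sums of a pattern record.
csum : ∀ {k} → Vec ℕ k → ℕ → ℕ
csum Vec.[]       _       = 0
csum (m Vec.∷ ms) zero    = 0
csum (m Vec.∷ ms) (suc x) = m ℕ.+ csum ms x

csum-injective : ∀ {k} {m m′ : Vec ℕ k} → (∀ x → x ≤ k → csum m x ≡ csum m′ x) → m ≡ m′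
csum-injective {m = Vec.[]}     {Vec.[]}       e = refl
csum-injective {m = m Vec.∷ ms} {m′ Vec.∷ ms′} e = cong₂ Vec._∷_ m≡
  (csum-injective λ x h → ℕₚ.+-cancelˡ-≡ m _ _ (trans (e (suc x) (s≤s h)) (cong (ℕ._+ csum ms′ x) (sym m≡))))
  where
  csum-zero : ∀ {k} (m : Vec ℕ k) → csum m 0 ≡ 0
  csum-zero Vec.[]      = refl
  csum-zero (_ Vec.∷ _) = refl
  m≡ : m ≡ m′
  m≡ = trans (sym (ℕₚ.+-identityʳ m)) (trans (cong (m ℕ.+_) (sym (csum-zero ms)))
    (trans (e 1 (s≤s z≤n)) (trans (cong (m′ ℕ.+_) (csum-zero ms′)) (ℕₚ.+-identityʳ m′))))

csum-+ : ∀ {k} (a b : Vec ℕ k) x → csum (Vec.zipWith ℕ._+_ a b) x ≡ csum a x ℕ.+ csum b x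
csum-+ Vec.[]       Vec.[]       x       = refl
csum-+ (a Vec.∷ as) (b Vec.∷ bs) zero    = refl
csum-+ (a Vec.∷ as) (b Vec.∷ bs) (suc x) = trans (cong (a ℕ.+ b ℕ.+_) (csum-+ as bs x)) (l a b (csum as x)
    (csum bs x))
  where
  l : ∀ a b c d → a ℕ.+ b ℕ.+ (c ℕ.+ d) ≡ a ℕ.+ c ℕ.+ (b ℕ.+ d)
  l a b c d = trans (ℕₚ.+-assoc a b _) (trans (cong (a ℕ.+_) (trans (sym (ℕₚ.+-assoc b c d))
    (trans (cong (ℕ._+ d) (ℕₚ.+-comm b c)) (ℕₚ.+-assoc c b d)))) (sym (ℕₚ.+-assoc a c _)))

occ : ∀ {k} → List (Fin k) → Fin k → ℕ
occ r i = length (filter (i Fin.≟_) r)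

csum-occ : ∀ {k} (r : List (Fin k)) x → csum (Vec.tabulate (occ r)) x ≡ cnt x r
csum-occ {k} []  x = zeros {k} x
  where
  zeros : ∀ {k} x → csum (Vec.tabulate {n = k} (λ _ → 0)) x ≡ 0
  zeros {zero}  x       = refl
  zeros {suc k} zero    = refl
  zeros {suc k} (suc x) = zeros {k} x
csum-occ (y ∷ r) x with Fin.toℕ y ℕ.<? x
... | yes p = trans (hit (occ (y ∷ r)) (occ r) y (cong length (Listₚ.filter-accept (y Fin.≟_) refl))
                (λ i i≢ → cong length (Listₚ.filter-reject (i Fin.≟_) i≢)) x p) (cong suc (csum-occ r x))
  where
  hit : ∀ {k} (f g : Fin k → ℕ) y → f y ≡ suc (g y) → (∀ i → i ≢ y → f i ≡ g i) → ∀ x → Fin.toℕ y < x →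
    csum (Vec.tabulate f) x ≡ suc (csum (Vec.tabulate g) x)
  hit f g Fin.zero    e ne (suc x) p       = cong₂ ℕ._+_ e (cong (λ v → csum v x) (Vecₚ.tabulate-cong
      (λ i → ne (Fin.suc i) λ ())))
  hit f g (Fin.suc y) e ne (suc x) (s≤s p) = trans (cong₂ ℕ._+_ (ne Fin.zero λ ())
    (hit (f ∘ Fin.suc) (g ∘ Fin.suc) y e (λ i i≢ → ne (Fin.suc i) (i≢ ∘ Finₚ.suc-injective)) x p)) (ℕₚ.+-suc _ _)
... | no ¬p = trans (miss (occ (y ∷ r)) (occ r) y (λ i i≢ → cong length (Listₚ.filter-reject (i Fin.≟_) i≢))
    x (ℕₚ.≮⇒≥ ¬p)) (csum-occ r x)
  where
  miss : ∀ {k} (f g : Fin k → ℕ) y → (∀ i → i ≢ y → f i ≡ g i) → ∀ x → x ≤ Fin.toℕ y →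
    csum (Vec.tabulate f) x ≡ csum (Vec.tabulate g) x
  miss {suc k} f g y           ne zero    p       = refl
  miss {suc k} f g (Fin.suc y) ne (suc x) (s≤s p) = cong₂ ℕ._+_ (ne Fin.zero λ ())
    (miss (f ∘ Fin.suc) (g ∘ Fin.suc) y (λ i i≢ → ne (Fin.suc i) (i≢ ∘ Finₚ.suc-injective)) x p)

-- Listing the semistandard tableaux of a shape

HasShape : ∀ {A : Set} → List ℕ → List (List A) → Set
HasShape ps t = map length t ≡ ps

module _ {A : Set} (xs : List A) where
  words : ℕ → List (List A)
  words p = choices (replicate p xs)

  private
    cons-unique : ∀ {B : Set} {ys : List B} {yss : List (List B)} → Unique ys → Unique yss →
      Unique (cartesianProductWith List._∷_ ys yss)
    cons-unique = Uniqueₚ.cartesianProductWith⁺ List._∷_ λ { refl → refl , refl }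

  module _ (u : Unique xs) (full : ∀ x → x ∈ xs) where
    words-unique : ∀ p → Unique (words p)
    words-unique zero    = [] ∷ []
    words-unique (suc p) = cons-unique u (words-unique p)

    arrays-unique : ∀ ps → Unique (choices (map words ps))
    arrays-unique []       = [] ∷ []
    arrays-unique (p ∷ ps) = cons-unique (words-unique p) (arrays-unique ps)

    words-sound : ∀ p {r} → r ∈ words p → length r ≡ p
    words-sound zero    (here refl) = refl
    words-sound (suc p) r∈ with ∈-cartesianProductWith⁻ List._∷_ xs (words p) r∈
    ... | _ , _ , _ , q , refl = cong suc (words-sound p q)

    arrays-sound : ∀ ps {t} → t ∈ choices (map words ps) → HasShape ps t
    arrays-sound []       (here refl) = refl
    arrays-sound (p ∷ ps) t∈ with ∈-cartesianProductWith⁻ List._∷_ (words p) (choices (map words ps)) t∈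
    ... | _ , _ , q , q′ , refl = cong₂ _∷_ (words-sound p q) (arrays-sound ps q′)

    words-complete : ∀ r → r ∈ words (length r)
    words-complete []      = here refl
    words-complete (x ∷ r) = ∈-cartesianProductWith⁺ List._∷_ (full x) (words-complete r)

    arrays-complete : ∀ t → t ∈ choices (map words (map length t))
    arrays-complete []      = here refl
    arrays-complete (r ∷ t) = ∈-cartesianProductWith⁺ List._∷_ (words-complete r) (arrays-complete t)

enum-fillings : ∀ k μ → Enum (HasShape {Fin k} (parts μ))
enum-fillings k μ = record
  { elements = fillings k μ
  ; unique   = arrays-unique (allFin k) u full (parts μ)
  ; sound    = arrays-sound (allFin k) u full (parts μ)
  ; complete = λ { refl → arrays-complete (allFin k) u full _ }
  }
  where
  u    = Uniqueₚ.allFin⁺ k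
  full = ∈-allFin

SSYT : ∀ {k} → Partition → Tableau k → Set
SSYT μ t = HasShape (parts μ) t × Semistandard t

abstract
  enum-SSYT : ∀ {k} μ → Enum (SSYT {k} μ)
  enum-SSYT {k} μ = enum-filter semistandard? (enum-fillings k μ)

  schur-size : ∀ {k} μ (m : Vec ℕ k) (E : Enum (λ t → SSYT μ t × content t ≡ m)) → schur μ m ≡ + size E
  schur-size {k} μ m E = cong +_ (size-≡
    (enum-filter (λ t → semistandard? t ×-dec Vecₚ.≡-dec ℕ._≟_ (content t) m) (enum-fillings k μ)) E
    (λ { (sh , ss , c) → (sh , ss) , c }) (λ { ((sh , ss) , c) → sh , ss , c }))

-- From tableaux to patterns and back

length-rowAt : ∀ {A : Set} (t : List (List A)) {ps} → HasShape ps t → ∀ i → length (rowAt t i) ≡ nth ps i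
length-rowAt []      refl i       = refl
length-rowAt (r ∷ t) refl zero    = refl
length-rowAt (r ∷ t) refl (suc i) = length-rowAt t refl i

linked-rowAt : ∀ {k} {t : Tableau k} → Linked _Above_ t → ∀ i → rowAt t i Above rowAt t (suc i)
linked-rowAt []      i       = []
linked-rowAt [-]     zero    = []
linked-rowAt [-]     (suc i) = []
linked-rowAt (p ∷ l) zero    = p
linked-rowAt (p ∷ l) (suc i) = linked-rowAt l i

rowAt-linked : ∀ {k} (t : Tableau k) → (∀ i → rowAt t i Above rowAt t (suc i)) → Linked _Above_ t
rowAt-linked []          h = []
rowAt-linked (r ∷ [])    h = [-]
rowAt-linked (r ∷ s ∷ t) h = h 0 ∷ rowAt-linked (s ∷ t) (h ∘ suc)

sorted-rowAt : ∀ {k} {t : Tableau k} → All Sorted t → ∀ i → Sorted (rowAt t i)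
sorted-rowAt []      i       = []
sorted-rowAt (p ∷ s) zero    = p
sorted-rowAt (p ∷ s) (suc i) = sorted-rowAt s i

rowAt-sorted : ∀ {k} (t : Tableau k) → (∀ i → Sorted (rowAt t i)) → All Sorted t
rowAt-sorted []      h = []
rowAt-sorted (r ∷ t) h = h 0 ∷ rowAt-sorted t (h ∘ suc)

rowAt-ext : ∀ {A : Set} {s t : List (List A)} {ps} → HasShape ps s → HasShape ps t →
    (∀ i → rowAt s i ≡ rowAt t i) → s ≡ t
rowAt-ext {s = []}    {[]}    e e′ h = refl
rowAt-ext {s = []}    {r ∷ t} refl () h
rowAt-ext {s = r ∷ s} {[]}    refl () h
rowAt-ext {s = r ∷ s} {q ∷ t} refl e′ h = cong₂ _∷_ (h 0) (rowAt-ext refl (Listₚ.∷-injectiveʳ e′) (h ∘ suc))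

module Rows {k} (t : Tableau k) (ss : Semistandard t) where
  column : ∀ x i → cnt (suc x) (rowAt t (suc i)) ≤ cnt x (rowAt t i)
  column x i = above⇒cnt (linked-rowAt (proj₂ ss) i) x

  -- Columns increase strictly, so row `i` has no letter smaller than `i`.
  cnt-below : ∀ x i → x ≤ i → cnt x (rowAt t i) ≡ 0
  cnt-below zero    i       h       = cnt-zero (rowAt t i)
  cnt-below (suc x) (suc i) (s≤s h) = ℕₚ.n≤0⇒n≡0 (ℕₚ.≤-trans (column x i) (ℕₚ.≤-reflexive (cnt-below x i h)))

psum-head : ∀ f n → psum f (suc n) ≡ f 0 ℤ.+ psum (f ∘ suc) n
psum-head f zero    = ℤₚ.+-comm 0ℤ (f 0)
psum-head f (suc n) = trans (cong (ℤ._+ f (suc n)) (psum-head f n)) (ℤₚ.+-assoc (f 0) _ _)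

cnt-concat : ∀ {k} x n (t : Tableau k) → (∀ i → n ≤ i → cnt x (rowAt t i) ≡ 0) →
  psum (λ i → + cnt x (rowAt t i)) n ≡ + cnt x (concat t)
cnt-concat x n       []      z = zeros n
  where
  zeros : ∀ n → psum (λ _ → 0ℤ) n ≡ 0ℤ
  zeros zero    = refl
  zeros (suc n) = cong (ℤ._+ 0ℤ) (zeros n)
cnt-concat x zero    (r ∷ t) z = sym (cong +_ (trans (cnt-++ x r (concat t))
  (cong₂ ℕ._+_ (z 0 z≤n) (ℤₚ.+-injective (sym (cnt-concat x zero t (λ i _ → z (suc i) z≤n)))))))
cnt-concat x (suc n) (r ∷ t) z = trans (psum-head (λ i → + cnt x (rowAt (r ∷ t) i)) n)
  (trans (cong (ℤ._+_ (+ cnt x r)) (cnt-concat x n t (λ i h → z (suc i) (s≤s h))))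
      (cong +_ (sym (cnt-++ x r (concat t)))))

at-out : ∀ {k} (g : Tri k) d i → k ≤ d ℕ.+ i → at g d i ≡ 0ℤ
at-out {zero}  g       d       i h       = refl
at-out {suc k} (r , g) zero    i h       = out r i h
  where
  out : ∀ {n} (r : Vec ℤ n) i → n ≤ i → r ! i ≡ 0ℤ
  out Vec.[]       i       h       = refl
  out (x Vec.∷ r)  (suc i) (s≤s h) = out r i h
at-out {suc k} (r , g) (suc d) i (s≤s h) = at-out g d i h

record Pattern {k} (κ : Partition) (g : Tri k) : Set where
  constructor pattern-of
  field
    gt  : IsGT k (at g)
    top : ∀ i → i < k → at g 0 i ≡ + entry κ i

-- Row `k ∸ x` of a pattern has `x` entries and describes the letters below `x`, so its sum is a
-- partial sum of the content.
HasWeight : ∀ {k} → Vec ℕ k → Tri k → Set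
HasWeight {k} m g = ∀ x → x ≤ k → rowSum g (k ℕ.∸ x) ≡ + csum m x

nth-out : ∀ ps i → length ps ≤ i → nth ps i ≡ 0
nth-out []       i       h       = refl
nth-out (p ∷ ps) (suc i) (s≤s h) = nth-out ps i h

nth-positive : ∀ {ps} → All (0 <_) ps → ∀ i → i < length ps → 0 < nth ps i
nth-positive (p ∷ ps) zero    h       = p
nth-positive (p ∷ ps) (suc i) (s≤s h) = nth-positive ps i h

toGT : ∀ {k} → Tableau k → Tri k
toGT {k} t = tri k (λ d i → + cnt (k ℕ.∸ d) (rowAt t i))

-- `N` will be the length of the shape: the parts are positive, so the empty rows beyond it have to
-- be cut off.
fromGT : ∀ {k} → ℕ → Tri k → Tableau k
fromGT {k} N g = applyUpTo (λ i → rowOf k (λ x → ℤ.∣ at g (k ℕ.∸ x) i ∣)) N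

rowAt-applyUpTo : ∀ {A : Set} (f : ℕ → List A) {N i} → i < N → rowAt (applyUpTo f N) i ≡ f i
rowAt-applyUpTo f {suc N} {zero}  h       = refl
rowAt-applyUpTo f {suc N} {suc i} (s≤s h) = rowAt-applyUpTo (f ∘ suc) h

rowAt-applyUpTo-out : ∀ {A : Set} (f : ℕ → List A) {N i} → N ≤ i → rowAt (applyUpTo f N) i ≡ []
rowAt-applyUpTo-out f {zero}          h       = refl
rowAt-applyUpTo-out f {suc N} {suc i} (s≤s h) = rowAt-applyUpTo-out (f ∘ suc) h

applyUpTo-shape : ∀ {A : Set} (f : ℕ → List A) ps → (∀ i → i < length ps → length (f i) ≡ nth ps i) →
  HasShape ps (applyUpTo f (length ps))
applyUpTo-shape f []       e = refl
applyUpTo-shape f (p ∷ ps) e = cong₂ _∷_ (e 0 (s≤s z≤n)) (applyUpTo-shape (f ∘ suc) ps (λ i h → e (suc i) (s≤s h)))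

∸-lt : ∀ {k x i} → x ≤ k → i < x → k ℕ.∸ x ℕ.+ i < k
∸-lt {k} {x} {i} h h′ = ℕₚ.≤-trans (ℕₚ.+-monoʳ-< (k ℕ.∸ x) h′) (ℕₚ.≤-reflexive (ℕₚ.m∸n+n≡m h))

∸-ge : ∀ {k x i} → x ≤ k → x ≤ i → k ≤ k ℕ.∸ x ℕ.+ i
∸-ge {k} {x} {i} h h′ = ℕₚ.≤-trans (ℕₚ.≤-reflexive (sym (ℕₚ.m∸n+n≡m h))) (ℕₚ.+-monoʳ-≤ (k ℕ.∸ x) h′)

lt-∸ : ∀ {k d i} → d ℕ.+ i < k → i < k ℕ.∸ d
lt-∸ {k} {d} {i} h = ℕₚ.m+n≤o⇒m≤o∸n (suc i) (subst (_≤ k) (cong suc (ℕₚ.+-comm d i)) h)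

suc-∸ : ∀ {k d} → d < k → k ℕ.∸ d ≡ suc (k ℕ.∸ suc d)
suc-∸ = ℕₚ.+-∸-assoc 1

module _ {k : ℕ} where
  -- Outside the triangle both sides vanish, the left one by the default value of `at` and the right
  -- one by `cnt-below`.
  toGT-at : ∀ (t : Tableau k) → Semistandard t → ∀ x i → x ≤ k → at (toGT t) (k ℕ.∸ x) i ≡ + cnt x (rowAt t i)
  toGT-at t ss x i h with i ℕ.<? x
  ... | yes p = trans (at-tri _ (k ℕ.∸ x) i (∸-lt h p)) (cong (λ y → + cnt y (rowAt t i)) (ℕₚ.m∸[m∸n]≡n h))
  ... | no ¬p = trans (at-out (toGT t) (k ℕ.∸ x) i (∸-ge h (ℕₚ.≮⇒≥ ¬p)))
      (cong +_ (sym (Rows.cnt-below t ss x i (ℕₚ.≮⇒≥ ¬p))))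

  toGT-rowSum : ∀ (t : Tableau k) → Semistandard t → ∀ x → x ≤ k → rowSum (toGT t) (k ℕ.∸ x) ≡ + csum (content t) x
  toGT-rowSum t ss x h = trans (cong (psum _) (ℕₚ.m∸[m∸n]≡n h))
    (trans (psum-cong x (λ i _ → toGT-at t ss x i h))
      (trans (cnt-concat x x t (Rows.cnt-below t ss x)) (cong +_ (sym (csum-occ (concat t) x)))))

module _ {k : ℕ} (κ : Partition) where
  private
    ps = parts κ

  toGT-pattern : ∀ t → SSYT κ t → Pattern κ (toGT t)
  toGT-pattern t (sh , ss) = record
    { gt = record
      { inter₁ = λ d i h → subst₂ ℤ._≤_ (sym (at-tri G (suc d) i h)) (sym (at-tri G d i (pred-< h)))
          (ℤ.+≤+ (cnt-mono (rowAt t i) (ℕₚ.∸-monoʳ-≤ k (ℕₚ.n≤1+n d))))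
      ; inter₂ = λ d i h → subst₂ ℤ._≤_ (sym (at-tri G d (suc i) (sucʳ-< d i h))) (sym (at-tri G (suc d) i h))
          (ℤ.+≤+ (subst (λ x → cnt x (rowAt t (suc i)) ≤ cnt (k ℕ.∸ suc d) (rowAt t i))
            (sym (suc-∸ {k} {d} (ℕₚ.≤-trans (s≤s (ℕₚ.≤-trans (ℕₚ.m≤m+n d i) (ℕₚ.n≤1+n _))) h)))
            (Rows.column t ss (k ℕ.∸ suc d) i)))
      ; nonneg = λ d i h → subst (0ℤ ℤ.≤_) (sym (at-tri G d i h)) (ℤ.+≤+ z≤n)
      }
    ; top    = λ i h → trans (at-tri G 0 i h) (cong +_ (trans (cnt-all (rowAt t i)) (length-rowAt t sh i)))
    }
    where
    G : Labels
    G d i = + cnt (k ℕ.∸ d) (rowAt t i)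

  module _ (g : Tri k) (P : Pattern κ g) where
    open Pattern P
    open IsGT gt

    ≤-top : ∀ d i → d ℕ.+ i < k → at g d i ℤ.≤ at g 0 i
    ≤-top zero    i h = ℤₚ.≤-refl
    ≤-top (suc d) i h = ℤₚ.≤-trans (inter₁ d i h) (≤-top d i (pred-< h))

    private
      f : ℕ → ℕ → ℕ
      f i x = ℤ.∣ at g (k ℕ.∸ x) i ∣

      f-out : ∀ i x → x ≤ k → x ≤ i → f i x ≡ 0
      f-out i x h h′ = cong ℤ.∣_∣ (at-out g (k ℕ.∸ x) i (∸-ge h h′))

      f-in : ∀ i x → x ≤ k → i < x → + f i x ≡ at g (k ℕ.∸ x) i
      f-in i x h h′ = ℤₚ.0≤i⇒+∣i∣≡i (nonneg (k ℕ.∸ x) i (∸-lt h h′))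

      f-mono : ∀ i → Monotone k (f i)
      f-mono i x h with i ℕ.<? x
      ... | no ¬p = ℕₚ.≤-trans (ℕₚ.≤-reflexive (f-out i x (ℕₚ.<⇒≤ h) (ℕₚ.≮⇒≥ ¬p))) z≤n
      ... | yes p = ℤₚ.drop‿+≤+ (subst₂ ℤ._≤_ (sym (f-in i x (ℕₚ.<⇒≤ h) p)) (sym (f-in i (suc x) h (ℕₚ.m≤n⇒m≤1+n p)))
          (subst (λ d → at g d i ℤ.≤ at g (k ℕ.∸ suc x) i) (sym (suc-∸ h))
            (inter₁ (k ℕ.∸ suc x) i (subst (λ d → d ℕ.+ i < k) (suc-∸ h) (∸-lt (ℕₚ.<⇒≤ h) p)))))

      f-column : ∀ i x → x < k → f (suc i) (suc x) ≤ f i x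
      f-column i x h with i ℕ.<? x
      ... | no ¬p = ℕₚ.≤-trans (ℕₚ.≤-reflexive (f-out (suc i) (suc x) h (s≤s (ℕₚ.≮⇒≥ ¬p)))) z≤n
      ... | yes p = ℤₚ.drop‿+≤+ (subst₂ ℤ._≤_ (sym (f-in (suc i) (suc x) h (s≤s p))) (sym (f-in i x (ℕₚ.<⇒≤ h) p))
          (subst (λ d → at g (k ℕ.∸ suc x) (suc i) ℤ.≤ at g d i) (sym (suc-∸ h))
            (inter₂ (k ℕ.∸ suc x) i (subst (λ d → d ℕ.+ i < k) (suc-∸ h) (∸-lt (ℕₚ.<⇒≤ h) p)))))

      T : Tableau k
      T = fromGT (ℓ κ) g

    module _ (ℓ≤ : ℓ κ ≤ k) where
      private
        f-beyond : ∀ i x → x ≤ k → ℓ κ ≤ i → f i x ≡ 0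
        f-beyond i x h h′ with i ℕ.<? x
        ... | no ¬p = f-out i x h (ℕₚ.≮⇒≥ ¬p)
        ... | yes p = ℕₚ.n≤0⇒n≡0 (ℤₚ.drop‿+≤+ (subst₂ ℤ._≤_ (sym (f-in i x h p))
            (trans (top i (ℕₚ.≤-trans p h)) (cong +_ (nth-out ps i h′))) (≤-top (k ℕ.∸ x) i (∸-lt h p))))

        f-zero : ∀ i → f i 0 ≡ 0
        f-zero i = f-out i 0 z≤n z≤n

        f-top : ∀ i → i < length ps → f i k ≡ nth ps i
        f-top i h = trans (cong (λ d → ℤ.∣ at g d i ∣) (ℕₚ.n∸n≡0 k)) (cong ℤ.∣_∣ (top i (ℕₚ.≤-trans h ℓ≤)))

        cnt-f : ∀ i x → x ≤ k → cnt x (rowOf k (f i)) ≡ f i x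
        cnt-f i = cnt-rowOf k (f-zero i) (f-mono i)

      fromGT-cnt : ∀ i x → x ≤ k → cnt x (rowAt T i) ≡ f i x
      fromGT-cnt i x h with i ℕ.<? ℓ κ
      ... | yes p = trans (cong (cnt x) (rowAt-applyUpTo _ p)) (cnt-f i x h)
      ... | no ¬p = trans (cong (cnt x) (rowAt-applyUpTo-out (λ i → rowOf k (f i)) (ℕₚ.≮⇒≥ ¬p)))
          (sym (f-beyond i x h (ℕₚ.≮⇒≥ ¬p)))

      private
        T-sorted : ∀ i → Sorted (rowAt T i)
        T-sorted i with i ℕ.<? ℓ κ
        ... | yes p = subst Sorted (sym (rowAt-applyUpTo _ p)) (rowOf-sorted k (f i))
        ... | no ¬p = subst Sorted (sym (rowAt-applyUpTo-out (λ i → rowOf k (f i)) (ℕₚ.≮⇒≥ ¬p))) []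

        T-shape : HasShape ps T
        T-shape = applyUpTo-shape _ ps λ i h →
          trans (sym (cnt-all (rowOf k (f i)))) (trans (cnt-f i k ℕₚ.≤-refl) (f-top i h))

        T-ss : Semistandard T
        T-ss = rowAt-sorted T T-sorted , rowAt-linked T λ i → cnt⇒above (T-sorted i) (T-sorted (suc i))
          λ x h → subst₂ _≤_ (sym (fromGT-cnt (suc i) (suc x) h)) (sym (fromGT-cnt i x (ℕₚ.<⇒≤ h))) (f-column i x h)

        T-at : ∀ x i → x ≤ k → i < x → + cnt x (rowAt T i) ≡ at g (k ℕ.∸ x) i
        T-at x i h h′ = trans (cong +_ (fromGT-cnt i x h)) (f-in i x h h′)

      fromGT-SSYT : SSYT κ T
      fromGT-SSYT = T-shape , T-ss

      toGT-fromGT : toGT T ≡ g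
      toGT-fromGT = at-ext λ d i h → trans (at-tri _ d i h)
        (trans (T-at (k ℕ.∸ d) i (ℕₚ.m∸n≤m k d) (lt-∸ {d = d} h))
          (cong (λ e → at g e i) (ℕₚ.m∸[m∸n]≡n (ℕₚ.≤-trans (ℕₚ.m≤m+n d i) (ℕₚ.<⇒≤ h)))))

  fromGT-toGT : ℓ κ ≤ k → ∀ t → SSYT κ t → fromGT (ℓ κ) (toGT t) ≡ t
  fromGT-toGT ℓ≤ t S@(sh , ss) = rowAt-ext (proj₁ (fromGT-SSYT (toGT t) P ℓ≤)) sh λ i →
      sorted-ext (sorted-rowAt (proj₁ (proj₂ (fromGT-SSYT (toGT t) P ℓ≤))) i) (sorted-rowAt (proj₁ ss) i)
        λ x h → trans (fromGT-cnt (toGT t) P ℓ≤ i x h) (cong ℤ.∣_∣ (toGT-at t ss x i h))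
    where P = toGT-pattern t S

  SSYT↔Pattern : ℓ κ ≤ k → Bij (SSYT κ) (Pattern κ)
  SSYT↔Pattern ℓ≤ = record
    { to      = λ {t} _ → toGT t
    ; from    = λ {g} _ → fromGT (ℓ κ) g
    ; to-ok   = λ {t} S → toGT-pattern t S
    ; from-ok = λ {g} P → fromGT-SSYT g P ℓ≤
    ; from-to = λ {t} S _ → fromGT-toGT ℓ≤ t S
    ; to-from = λ {g} P _ → toGT-fromGT g P ℓ≤
    }

  -- Row `k` would be nonempty, but its letters would have to be at least `k`.
  ¬SSYT : k < ℓ κ → ∀ t → ¬ SSYT κ t
  ¬SSYT k<ℓ t (sh , ss) = ℕₚ.<-irrefl (sym (trans (sym (length-rowAt t sh k))
      (trans (sym (cnt-all (rowAt t k))) (Rows.cnt-below t ss k k ℕₚ.≤-refl))))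
    (nth-positive (positive κ) k k<ℓ)

content⇒weight : ∀ {k} (t : Tableau k) → Semistandard t → ∀ m → content t ≡ m → HasWeight m (toGT t)
content⇒weight t ss m refl = toGT-rowSum t ss

weight⇒content : ∀ {k} (t : Tableau k) → Semistandard t → ∀ m → HasWeight m (toGT t) → content t ≡ m
weight⇒content t ss m w = csum-injective λ x h → ℤₚ.+-injective (trans (sym (toGT-rowSum t ss x h)) (w x h))

-- Partitions

⟦_⟧ : Partition → ℕ → ℤ
⟦ μ ⟧ i = + entry μ i

partition-≡ : ∀ {μ ν} → parts μ ≡ parts ν → μ ≡ ν
partition-≡ {mkPartition ps d p} {mkPartition .ps d′ p′} refl =
  cong₂ (mkPartition ps) (Linked.irrelevant ℕₚ.≤-irrelevant d d′) (All.irrelevant ℕₚ.≤-irrelevant p p′)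

_≟ᴾ_ : DecidableEquality Partition
μ ≟ᴾ ν = map′ partition-≡ (cong parts) (Listₚ.≡-dec ℕ._≟_ (parts μ) (parts ν))

nth-ext : ∀ {ps qs} → All (0 <_) ps → All (0 <_) qs → (∀ i → nth ps i ≡ nth qs i) → ps ≡ qs
nth-ext []       []       e = refl
nth-ext []       (q ∷ _)  e = contradiction q (ℕₚ.≤⇒≯ (ℕₚ.≤-reflexive (sym (e 0))))
nth-ext (p ∷ _)  []       e = contradiction p (ℕₚ.≤⇒≯ (ℕₚ.≤-reflexive (e 0)))
nth-ext (_ ∷ ps) (_ ∷ qs) e = cong₂ _∷_ (e 0) (nth-ext ps qs (e ∘ suc))

entry-ext : ∀ {k} μ ν → ℓ μ ≤ k → ℓ ν ≤ k → (∀ i → i < k → entry μ i ≡ entry ν i) → μ ≡ ν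
entry-ext {k} μ ν hμ hν e = partition-≡ (nth-ext (positive μ) (positive ν) go)
  where
  go : ∀ i → entry μ i ≡ entry ν i
  go i with i ℕ.<? k
  ... | yes p = e i p
  ... | no ¬p = let h = ℕₚ.≮⇒≥ ¬p in
    trans (nth-out (parts μ) i (ℕₚ.≤-trans hμ h)) (sym (nth-out (parts ν) i (ℕₚ.≤-trans hν h)))

entry-antitone : ∀ μ i → entry μ (suc i) ≤ entry μ i
entry-antitone μ = go (decreasing μ)
  where
  go : ∀ {ps} → Linked ℕ._≥_ ps → ∀ i → nth ps (suc i) ≤ nth ps i
  go []      i       = z≤n
  go [-]     i       = z≤n
  go (p ∷ l) zero    = p
  go (p ∷ l) (suc i) = go l i

ℓ≤-entry : ∀ μ k → entry μ k ≡ 0 → ℓ μ ≤ k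
ℓ≤-entry μ k e with ℓ μ ℕ.≤? k
... | yes p = p
... | no ¬p = contradiction (nth-positive (positive μ) k (ℕₚ.≰⇒> ¬p)) (ℕₚ.≤⇒≯ (ℕₚ.≤-reflexive e))

Antitone : ℕ → (ℕ → ℕ) → Set
Antitone k f = ∀ i → suc i < k → f (suc i) ≤ f i

infixr 5 _∷⁺_
_∷⁺_ : ℕ → List ℕ → List ℕ
zero  ∷⁺ ps = []
suc p ∷⁺ ps = suc p ∷ ps

-- The sequence is cut at its first zero; if `f` is antitone, only zeros are lost.
strip : ℕ → (ℕ → ℕ) → List ℕ
strip zero    f = []
strip (suc k) f = f 0 ∷⁺ strip k (f ∘ suc)

strip-positive : ∀ k f → All (0 <_) (strip k f)
strip-positive zero    f = []
strip-positive (suc k) f with f 0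
... | zero  = []
... | suc m = s≤s z≤n ∷ strip-positive k (f ∘ suc)

strip-length : ∀ k f → length (strip k f) ≤ k
strip-length zero    f = z≤n
strip-length (suc k) f with f 0
... | zero  = z≤n
... | suc m = s≤s (strip-length k (f ∘ suc))

strip-linked : ∀ k f → Antitone k f → Linked ℕ._≥_ (strip k f)
strip-linked zero          f a = []
strip-linked (suc zero)    f a with f 0
... | zero  = []
... | suc m = [-]
strip-linked (suc (suc k)) f a with f 0 | a 0 (s≤s (s≤s z≤n)) | strip-linked (suc k) (f ∘ suc) (λ i h → a (suc i) (s≤s h))
... | zero  | _ | _ = []
... | suc m | f1≤ | l with f 1
...   | zero  = [-]
...   | suc p = f1≤ ∷ l

strip-nth : ∀ k f → Antitone k f → ∀ i → i < k → nth (strip k f) i ≡ f i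
strip-nth (suc k) f a i h with f 0 in e
strip-nth (suc k) f a i h | zero = sym (zeros i h)
  where
  zeros : ∀ i → i < suc k → f i ≡ 0
  zeros zero    h = e
  zeros (suc i) h = ℕₚ.n≤0⇒n≡0 (ℕₚ.≤-trans (a i h) (ℕₚ.≤-reflexive (zeros i (ℕₚ.<⇒≤ h))))
strip-nth (suc k) f a zero    h       | suc m = sym e
strip-nth (suc k) f a (suc i) (s≤s h) | suc m = strip-nth k (f ∘ suc) (λ i h → a (suc i) (s≤s h)) i h

toPartition : ∀ k f → Antitone k f → Partition
toPartition k f a = mkPartition (strip k f) (strip-linked k f a) (strip-positive k f)

-- Combinators for bijections

module _ {A B : Set} {P : A → Set} {Q : B → Set} (β : Bij P Q) where
  open Bij β

  from-unique : ∀ {x y} (p : P x) → y ≡ to p → (q : Q y) → from q ≡ x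
  from-unique p refl q = from-to p q

  to-unique : ∀ {x y} (q : Q y) → x ≡ from q → (p : P x) → to p ≡ y
  to-unique q refl p = to-from q p

  bij-restrict : ∀ {R : A → Set} {S : B → Set} → (∀ {x} (p : P x) → R x → S (to p)) →
      (∀ {x} (p : P x) → S (to p) → R x) →
    Bij (λ x → P x × R x) (λ y → Q y × S y)
  bij-restrict {R} {S} f g = record
    { to      = to ∘ proj₁
    ; from    = from ∘ proj₁
    ; to-ok   = λ { (p , r) → to-ok p , f p r }
    ; from-ok = λ { (q , s) → from-ok q , g (from-ok q) (subst S (sym (to-from q (from-ok q))) s) }
    ; from-to = λ { (p , _) (q , _) → from-to p q }
    ; to-from = λ { (q , _) (p , _) → to-from q p }
    }

bij-trans : ∀ {A B C : Set} {P : A → Set} {Q : B → Set} {R : C → Set} → Bij P Q → Bij Q R → Bij P R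
bij-trans β γ = record
  { to      = γ.to ∘ β.to-ok
  ; from    = β.from ∘ γ.from-ok
  ; to-ok   = γ.to-ok ∘ β.to-ok
  ; from-ok = β.from-ok ∘ γ.from-ok
  ; from-to = λ p r → from-unique β p (γ.from-to (β.to-ok p) r) (γ.from-ok r)
  ; to-from = λ r p → to-unique γ r (β.to-from (γ.from-ok r) p) (β.to-ok p)
  }
  where
  module β = Bij β
  module γ = Bij γ

bij-× : ∀ {A B C D : Set} {P : A → Set} {Q : B → Set} {R : C → Set} {S : D → Set} → Bij P Q → Bij R S →
  Bij (P ⊗ R) (Q ⊗ S)
bij-× β γ = record
  { to      = λ p → β.to (proj₁ p) , γ.to (proj₂ p)
  ; from    = λ q → β.from (proj₁ q) , γ.from (proj₂ q)
  ; to-ok   = λ p → β.to-ok (proj₁ p) , γ.to-ok (proj₂ p)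
  ; from-ok = λ q → β.from-ok (proj₁ q) , γ.from-ok (proj₂ q)
  ; from-to = λ p q → cong₂ _,_ (β.from-to (proj₁ p) (proj₁ q)) (γ.from-to (proj₂ p) (proj₂ q))
  ; to-from = λ q p → cong₂ _,_ (β.to-from (proj₁ q) (proj₁ p)) (γ.to-from (proj₂ q) (proj₂ p))
  }
  where
  module β = Bij β
  module γ = Bij γ

-- Hives and pairs of tableaux

HiveSet : ∀ n → Partition → Partition → Partition → Tri (suc n) → Set
HiveSet n α β κ b = LRHive n ⟦ α ⟧ ⟦ β ⟧ ⟦ κ ⟧ (at b)

HivePattern : ∀ k → Partition → Partition → Tri (suc k) × Tri k → Set
HivePattern k μ ν z = LRHive k ⟦ μ ⟧ ⟦ ν ⟧ (at (proj₂ z) 0) (at (proj₁ z)) × IsGT k (at (proj₂ z))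

⟦⟧-≥0 : ∀ μ n → NonNeg n ⟦ μ ⟧
⟦⟧-≥0 μ n i h = ℤ.+≤+ z≤n

Φ-bij : ∀ k μ ν → Bij (Pattern {k} μ ⊗ Pattern {k} ν) (HivePattern k μ ν)
Φ-bij k μ ν = record
  { to      = λ {x} _ → uncurry (Φ k) x
  ; from    = λ {y} _ → uncurry (Ψ k) y
  ; to-ok   = λ { {g₁ , g₂} (pattern-of G₁ e₁ , pattern-of G₂ e₂) → let H , G = Φ-hive k g₁ g₂ G₁ G₂ in
                LRHive-cong e₁ e₂ (λ _ _ → refl) H , G }
  ; from-ok = λ { {b , g} (H , G) → let (G₁ , e₁) , (G₂ , e₂) = Ψ-GT k b g (⟦⟧-≥0 μ k) (⟦⟧-≥0 ν k) H G in
                pattern-of G₁ e₁ , pattern-of G₂ e₂ }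
  ; from-to = λ { {g₁ , g₂} (P₁ , P₂) _ → Ψ-Φ k g₁ g₂ (Pattern.gt P₁) (Pattern.gt P₂) }
  ; to-from = λ { {b , g} (H , G) _ → Φ-Ψ k b g H G }
  }

SSYTPair : ∀ {k} → Partition → Partition → Tableau k × Tableau k → Set
SSYTPair μ ν = SSYT μ ⊗ SSYT ν

module _ {k} μ ν (hμ : ℓ μ ≤ k) (hν : ℓ ν ≤ k) where
  tableaux↔hives : Bij (SSYTPair {k} μ ν) (HivePattern k μ ν)
  tableaux↔hives = bij-trans (bij-× (SSYT↔Pattern μ hμ) (SSYT↔Pattern ν hν)) (Φ-bij k μ ν)

  tableaux↔hives-weight : ∀ m → Bij
    (λ z → SSYTPair {k} μ ν z × Vec.zipWith ℕ._+_ (content (proj₁ z)) (content (proj₂ z)) ≡ m)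
    (λ z → HivePattern k μ ν z × HasWeight m (proj₂ z))
  tableaux↔hives-weight m = bij-restrict tableaux↔hives
    (λ { {s , t} p refl x h → trans (sums p x h) (cong +_ (sym (csum-+ (content s) (content t) x))) })
    (λ { {s , t} p w → csum-injective λ x h → trans (csum-+ (content s) (content t) x)
           (ℤₚ.+-injective (trans (sym (sums p x h)) (w x h))) })
    where
    sums : ∀ {s t : Tableau k} → SSYTPair μ ν (s , t) → ∀ x → x ≤ k →
      rowSum (proj₂ (Φ k (toGT s) (toGT t))) (k ℕ.∸ x) ≡ + (csum (content s) x ℕ.+ csum (content t) x)
    sums {s} {t} ((sh , ss) , (sh′ , ss′)) x h =
      trans (Φ-rowSum k (toGT s) (toGT t) (Pattern.gt (toGT-pattern μ s (sh , ss)))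
          (Pattern.gt (toGT-pattern ν t (sh′ , ss′))) (k ℕ.∸ x))
        (cong₂ ℤ._+_ (toGT-rowSum s ss x h) (toGT-rowSum t ss′ x h))

-- For `ℓ κ ≤ k` this is the pattern of the tableau whose row `i` consists of the letter `i` alone,
-- of shape and weight `κ`.
truncated : ∀ k → Partition → Tri k
truncated k κ = tri k (λ _ → ⟦ κ ⟧)

truncated-pattern : ∀ k κ → Pattern κ (truncated k κ)
truncated-pattern k κ = record
  { gt = record
    { inter₁ = λ d i h → subst₂ ℤ._≤_ (sym (at-tri _ (suc d) i h)) (sym (at-tri _ d i (pred-< h))) ℤₚ.≤-refl
    ; inter₂ = λ d i h → subst₂ ℤ._≤_ (sym (at-tri _ d (suc i) (sucʳ-< d i h))) (sym (at-tri _ (suc d) i h))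
        (ℤ.+≤+ (entry-antitone κ i))
    ; nonneg = λ d i h → subst (0ℤ ℤ.≤_) (sym (at-tri _ d i h)) (ℤ.+≤+ z≤n)
    }
  ; top = λ i h → at-tri _ 0 i h
  }

-- A hive with diagonal κ corresponds to a pair of tableaux whose image under the
-- bijection carries the pattern truncated n κ, so no bound on labels is needed.
abstract
  enum-hives : ∀ {n} μ ν κ → ℓ μ ≤ n → ℓ ν ≤ n → Enum (HiveSet n μ ν κ)
  enum-hives {n} μ ν κ hμ hν = transport β
      (enum-filter (λ z → proj₂ z ≟ᵀ truncated n κ)
        (transport (tableaux↔hives μ ν hμ hν) (enum-× (enum-SSYT μ) (enum-SSYT ν))))
    where
    module P = Pattern (truncated-pattern n κ)
    β : Bij (λ z → HivePattern n μ ν z × proj₂ z ≡ truncated n κ) (HiveSet n μ ν κ)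
    β = record
      { to      = λ {x} _ → proj₁ x
      ; from    = λ {b} _ → b , truncated n κ
      ; to-ok   = λ { {b , g} ((H , _) , refl) → LRHive-cong (λ _ _ → refl) (λ _ _ → refl) P.top H }
      ; from-ok = λ H → (LRHive-cong (λ _ _ → refl) (λ _ _ → refl) (λ i h → sym (P.top i h)) H , P.gt) , refl
      ; from-to = λ { {b , g} (_ , refl) _ → refl }
      ; to-from = λ _ _ → refl
      }

hive-⊆ˡ : ∀ {n} μ ν κ {b} → HiveSet n μ ν κ b → ∀ i → i < n → entry μ i ≤ entry κ i
hive-⊆ˡ {n} μ ν κ H i h = ℤₚ.drop‿+≤+ (left⊆diag H (⟦⟧-≥0 ν n) i h)

hive-⊆ʳ : ∀ {n} μ ν κ {b} → HiveSet n μ ν κ b → ∀ i → i < n → entry ν i ≤ entry κ i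
hive-⊆ʳ {n} μ ν κ H i h = ℤₚ.drop‿+≤+ (right⊆diag H (⟦⟧-≥0 μ n) i h)

-- Independence of the number of hives from their size

Rh-≡ : ∀ {a b c d a′ b′ c′ d′} → a ≡ a′ → b ≡ b′ → c ≡ c′ → d ≡ d′ → Rh a b c d → Rh a′ b′ c′ d′
Rh-≡ refl refl refl refl h = h

private
  fits : ∀ {m n} → suc m ≤ suc n → suc m ≤ n ⊎ m ≡ n
  fits (s≤s h) with ℕₚ.m≤n⇒m<n∨m≡n h
  ... | inj₁ p = inj₁ p
  ... | inj₂ e = inj₂ e

  rev-≤ : ∀ x y → 0ℤ ℤ.≤ y ℤ.- x → x ℤ.≤ y
  rev-≤ x y h = ℤₚ.0≤i-j⇒j≤i h

module Restrict {n α β κ} {b : Tri (suc (suc n))} (H : LRHive (suc n) α β κ (at b))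
  (α₀ : α n ≡ 0ℤ) (β₀ : β n ≡ 0ℤ) (κ₀ : κ n ≡ 0ℤ) where
  open LRHive H
  open IsHive hive
  private
    B = at b
    C = tri (suc n) B

    C-at : ∀ d i → d ℕ.+ i ≤ n → at C d i ≡ B d i
    C-at d i h = at-tri B d i (s≤s h)

  -- The increment is squeezed: `left-edge` bounds it below by `α n`, which is zero, and `r₂` bounds
  -- it above by the increment at the corner, which vanishes with `β n` and `κ n`.
  last-column : ∀ d i → d ℕ.+ i ≡ n → B (suc d) i ≡ B d i
  last-column d i e = ℤₚ.≤-antisym (go d i e)
    (rev-≤ (B d i) (B (suc d) i) (ℤₚ.≤-trans (ℤₚ.≤-reflexive (sym (trans (cong α e) α₀))) (left-edge H d i
        (s≤s (ℕₚ.≤-reflexive e)))))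
    where
    go : ∀ d i → d ℕ.+ i ≡ n → B (suc d) i ℤ.≤ B d i
    go zero    i refl = ℤₚ.≤-reflexive (trans (sym (trans (right 0 i refl) (trans (cong (ℤ._+_ (B 1 i)) β₀)
        (ℤₚ.+-identityʳ (B 1 i)))))
      (trans (diag i ℕₚ.≤-refl) (trans (cong (ℤ._+_ (B 0 i)) κ₀) (ℤₚ.+-identityʳ (B 0 i)))))
    go (suc d) i e = ℤₚ.i-j≤0⇒i≤j (ℤₚ.≤-trans (Δ-≤ (r₂ d i (s≤s (ℕₚ.≤-reflexive e))))
      (ℤₚ.i≤j⇒i-j≤0 (go d (suc i) (trans (ℕₚ.+-suc d i) e))))

  last-vertex : B 0 (suc n) ≡ B 0 n
  last-vertex = trans (diag n ℕₚ.≤-refl) (trans (cong (ℤ._+_ (B 0 n)) κ₀) (ℤₚ.+-identityʳ (B 0 n)))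

  restricted : LRHive n α β κ (at C)
  restricted = record
    { hive   = record
      { r₁ = λ d i h → Rh-≡ (c₁₁ d i h) (c₀₀ d i h) (c₁₀ d i h) (c₀₁ d i h) (r₁ d i (ℕₚ.m≤n⇒m≤1+n h))
      ; r₂ = λ d i h → Rh-≡ (c₂₀ d i h) (c₀₁ d i h) (c₁₀ d i h) (c₁₁ d i h) (r₂ d i (ℕₚ.m≤n⇒m≤1+n h))
      ; r₃ = λ d i h → Rh-≡ (c₀₂ d i h) (c₁₀ d i h) (c₀₁ d i h) (c₁₁ d i h) (r₃ d i (ℕₚ.m≤n⇒m≤1+n h))
      }
    ; origin = origin
    ; left   = λ j h → trans (C-at (suc j) 0 (subst (_≤ n) (sym (ℕₚ.+-identityʳ (suc j))) h))
        (trans (left j (ℕₚ.m≤n⇒m≤1+n h)) (cong (ℤ._+ α j)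
            (sym (C-at j 0 (subst (_≤ n) (sym (ℕₚ.+-identityʳ j)) (ℕₚ.<⇒≤ h))))))
    ; right  = λ d i e → trans (C-at d (suc i) (ℕₚ.≤-reflexive (trans (ℕₚ.+-suc d i) e)))
        (trans (sym (last-column d (suc i) (trans (ℕₚ.+-suc d i) e)))
          (trans (right (suc d) i (cong suc e)) (cong (ℤ._+ β i)
            (trans (last-column (suc d) i e) (sym (C-at (suc d) i (ℕₚ.≤-reflexive e)))))))
    ; diag   = λ i h → trans (C-at 0 (suc i) h) (trans (diag i (ℕₚ.m≤n⇒m≤1+n h)) (cong (ℤ._+ κ i)
        (sym (C-at 0 i (ℕₚ.<⇒≤ h)))))
    }
    where
    c₀₀ : ∀ d i → suc (d ℕ.+ i) < n → B d i ≡ at C d i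
    c₀₀ d i h = sym (C-at d i (ℕₚ.<⇒≤ (pred-< h)))
    c₁₀ : ∀ d i → suc (d ℕ.+ i) < n → B (suc d) i ≡ at C (suc d) i
    c₁₀ d i h = sym (C-at (suc d) i (ℕₚ.<⇒≤ h))
    c₂₀ : ∀ d i → suc (d ℕ.+ i) < n → B (2 ℕ.+ d) i ≡ at C (2 ℕ.+ d) i
    c₂₀ d i h = sym (C-at (2 ℕ.+ d) i h)
    c₀₁ : ∀ d i → suc (d ℕ.+ i) < n → B d (suc i) ≡ at C d (suc i)
    c₀₁ d i h = sym (C-at d (suc i) (ℕₚ.<⇒≤ (sucʳ-< d i h)))
    c₁₁ : ∀ d i → suc (d ℕ.+ i) < n → B (suc d) (suc i) ≡ at C (suc d) (suc i)
    c₁₁ d i h = sym (C-at (suc d) (suc i) (sucʳ-< d i h))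
    c₀₂ : ∀ d i → suc (d ℕ.+ i) < n → B d (2 ℕ.+ i) ≡ at C d (2 ℕ.+ i)
    c₀₂ d i h = sym (C-at d (2 ℕ.+ i) (subst (_≤ n) (sym (ℕₚ.+-suc d (suc i))) (sucʳ-< d i h)))

module Extend {n α β κ} {b : Tri (suc n)} (H : LRHive n α β κ (at b)) (α≥0 : NonNeg n α) (β≥0 : NonNeg n β)
  (α₀ : α n ≡ 0ℤ) (β₀ : β n ≡ 0ℤ) (κ₀ : κ n ≡ 0ℤ) where
  open LRHive H
  open IsHive hive
  private
    B = at b

  -- The new column repeats the last column of b.
  pick : ∀ {P : Set} → Dec P → ℤ → ℤ → ℤ
  pick (yes _) x y = x
  pick (no _)  x y = y

  ext : Labels
  ext zero    i = pick (i ℕ.≤? n) (B 0 i) (B 0 n)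
  ext (suc d) i = pick (suc d ℕ.+ i ℕ.≤? n) (B (suc d) i) (B d i)

  private
    pick-yes : ∀ {P : Set} (p : Dec P) {x y} → P → pick p x y ≡ x
    pick-yes (yes _) p = refl
    pick-yes (no ¬p) p = contradiction p ¬p
    pick-no : ∀ {P : Set} (p : Dec P) {x y} → ¬ P → pick p x y ≡ y
    pick-no (yes p) ¬p = contradiction p ¬p
    pick-no (no _)  ¬p = refl

  D : Labels
  D = at (tri (suc (suc n)) ext)

  D-in : ∀ d i → d ℕ.+ i ≤ n → D d i ≡ B d i
  D-in zero    i h = trans (at-tri ext 0 i (s≤s (ℕₚ.m≤n⇒m≤1+n h))) (pick-yes (i ℕ.≤? n) h)
  D-in (suc d) i h = trans (at-tri ext (suc d) i (s≤s (ℕₚ.m≤n⇒m≤1+n h))) (pick-yes (suc d ℕ.+ i ℕ.≤? n) h)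

  D-out : ∀ d i → d ℕ.+ i ≡ n → D (suc d) i ≡ B d i
  D-out d i e = trans (at-tri ext (suc d) i (s≤s (s≤s (ℕₚ.≤-reflexive e))))
    (pick-no (suc d ℕ.+ i ℕ.≤? n) (λ h → ℕₚ.1+n≰n (ℕₚ.≤-trans h (ℕₚ.≤-reflexive (sym e)))))

  D-last : D 0 (suc n) ≡ B 0 n
  D-last = trans (at-tri ext 0 (suc n) ℕₚ.≤-refl) (pick-no (suc n ℕ.≤? n) ℕₚ.1+n≰n)

  private
    module _ (d i : ℕ) (h : suc (d ℕ.+ i) ≤ n) where
      d₀₀ : B d i ≡ D d i
      d₀₀ = sym (D-in d i (ℕₚ.<⇒≤ h))
      d₁₀ : B (suc d) i ≡ D (suc d) i
      d₁₀ = sym (D-in (suc d) i h)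
      d₀₁ : B d (suc i) ≡ D d (suc i)
      d₀₁ = sym (D-in d (suc i) (subst (_≤ n) (sym (ℕₚ.+-suc d i)) h))

    module _ (d i : ℕ) (h : suc (suc (d ℕ.+ i)) ≤ n) where
      d₂₀ : B (2 ℕ.+ d) i ≡ D (2 ℕ.+ d) i
      d₂₀ = sym (D-in (2 ℕ.+ d) i h)
      d₁₁ : B (suc d) (suc i) ≡ D (suc d) (suc i)
      d₁₁ = sym (D-in (suc d) (suc i) (sucʳ-< d i h))
      d₀₂ : B d (2 ℕ.+ i) ≡ D d (2 ℕ.+ i)
      d₀₂ = sym (D-in d (2 ℕ.+ i) (subst (_≤ n) (sym (ℕₚ.+-suc d (suc i))) (sucʳ-< d i h)))

    module _ (d i : ℕ) (e : suc (d ℕ.+ i) ≡ n) where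
      e₂₀ : B (suc d) i ≡ D (2 ℕ.+ d) i
      e₂₀ = sym (D-out (suc d) i e)
      e₁₁ : B d (suc i) ≡ D (suc d) (suc i)
      e₁₁ = sym (D-out d (suc i) (trans (ℕₚ.+-suc d i) e))

    e₀₂ : ∀ d i → suc (suc d ℕ.+ i) ≡ n → B d (2 ℕ.+ i) ≡ D (suc d) (2 ℕ.+ i)
    e₀₂ d i e = sym (D-out d (2 ℕ.+ i) (trans (ℕₚ.+-suc d (suc i)) (trans (cong suc (ℕₚ.+-suc d i)) e)))

    Rh-refl : ∀ x y → Rh x y x y
    Rh-refl x y = rh ℤₚ.≤-refl

    Rh-≤ : ∀ x {y z} → y ℤ.≤ z → Rh x y z x
    Rh-≤ x {y} {z} h = rh (ℤₚ.≤-trans (ℤₚ.≤-reflexive (ℤₚ.+-comm x y)) (ℤₚ.+-monoˡ-≤ x h))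

  extended : LRHive (suc n) α β κ D
  extended = record
    { hive = record
      { r₁ = λ d i h → case fits h of λ
        { (inj₁ h) → let h₀ = ℕₚ.<⇒≤ h in Rh-≡ (d₁₁ d i h) (d₀₀ d i h₀) (d₁₀ d i h₀) (d₀₁ d i h₀) (r₁ d i h)
        ; (inj₂ e) → let h₀ = ℕₚ.≤-reflexive e in Rh-≡ (e₁₁ d i e) (d₀₀ d i h₀) (d₁₀ d i h₀) (d₀₁ d i h₀)
            (Rh-≤ (B d (suc i)) (rev-≤ (B d i) (B (suc d) i) (ℤₚ.≤-trans (α≥0 (d ℕ.+ i) h₀) (left-edge H d i h₀)))) }
      ; r₂ = λ d i h → case fits h of λ
        { (inj₁ h) → let h₀ = ℕₚ.<⇒≤ h in Rh-≡ (d₂₀ d i h) (d₀₁ d i h₀) (d₁₀ d i h₀) (d₁₁ d i h) (r₂ d i h)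
        ; (inj₂ e) → let h₀ = ℕₚ.≤-reflexive e in Rh-≡ (e₂₀ d i e) (d₀₁ d i h₀) (d₁₀ d i h₀) (e₁₁ d i e)
            (Rh-refl _ _) }
      ; r₃ = λ d i h → case fits h of λ
        { (inj₁ h) → let h₀ = ℕₚ.<⇒≤ h in Rh-≡ (d₀₂ d i h) (d₁₀ d i h₀) (d₀₁ d i h₀) (d₁₁ d i h) (r₃ d i h)
        ; (inj₂ e) → r₃-last d i e }
      }
    ; origin = trans (D-in 0 0 z≤n) origin
    ; left   = λ { j (s≤s h) → left′ j h }
    ; right  = λ { d i e → right′ d i (ℕₚ.suc-injective e) }
    ; diag   = λ { i (s≤s h) → diag′ i h }
    }
    where
    r₃-last : ∀ d i → suc (d ℕ.+ i) ≡ n → R₃ D d i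
    r₃-last zero i refl = Rh-≡ (sym D-last) (d₁₀ 0 i ℕₚ.≤-refl) (d₀₁ 0 i ℕₚ.≤-refl) (e₁₁ 0 i refl)
      (case right-edge H 0 i ℕₚ.≤-refl of λ { (j , h , βj≤) →
        sr (sr (Rh-≤ (B 0 (suc i)) (rev-≤ (B 1 i) (B 0 (suc i)) (ℤₚ.≤-trans (β≥0 j h) βj≤)))) })
    -- Both new vertices copy vertices of the old right edge, so the rhombus becomes concavity of
    -- that edge, the sum of an R₃ and an R₂ inequality.
    r₃-last (suc d) i e = let h = ℕₚ.≤-reflexive e in
      Rh-≡ (e₀₂ d i e) (d₁₀ (suc d) i h) (d₀₁ (suc d) i h) (e₁₁ (suc d) i e) (sr (r₃ d i h) ⨾ sl (r₂ d i h))
    left′ : ∀ j → j ≤ n → D (suc j) 0 ≡ D j 0 ℤ.+ α j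
    left′ j h with ℕₚ.m≤n⇒m<n∨m≡n h
    ... | inj₁ p = trans (D-in (suc j) 0 (subst (_≤ n) (sym (ℕₚ.+-identityʳ (suc j))) p))
      (trans (left j p) (cong (ℤ._+ α j) (sym (D-in j 0 (subst (_≤ n) (sym (ℕₚ.+-identityʳ j)) h)))))
    ... | inj₂ refl = trans (D-out n 0 (ℕₚ.+-identityʳ n)) (trans (sym (D-in n 0 (ℕₚ.≤-reflexive (ℕₚ.+-identityʳ n))))
      (trans (sym (ℤₚ.+-identityʳ (D n 0))) (cong (ℤ._+_ (D n 0)) (sym α₀))))
    right′ : ∀ d i → d ℕ.+ i ≡ n → D d (suc i) ≡ D (suc d) i ℤ.+ β i
    right′ zero    i refl = trans D-last (trans (sym (D-out 0 i refl))
      (trans (sym (ℤₚ.+-identityʳ (D 1 i))) (cong (ℤ._+_ (D 1 i)) (sym β₀))))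
    right′ (suc d) i e = trans (D-out d (suc i) (trans (ℕₚ.+-suc d i) e))
      (trans (right d i e) (cong (ℤ._+ β i) (sym (D-out (suc d) i e))))
    diag′ : ∀ i → i ≤ n → D 0 (suc i) ≡ D 0 i ℤ.+ κ i
    diag′ i h with ℕₚ.m≤n⇒m<n∨m≡n h
    ... | inj₁ p = trans (D-in 0 (suc i) p) (trans (diag i p) (cong (ℤ._+ κ i) (sym (D-in 0 i h))))
    ... | inj₂ refl = trans D-last (trans (sym (D-in 0 n ℕₚ.≤-refl))
      (trans (sym (ℤₚ.+-identityʳ (D 0 n))) (cong (ℤ._+_ (D 0 n)) (sym κ₀))))

hive-resize : ∀ {n} μ ν κ → ℓ μ ≤ n → ℓ ν ≤ n → ℓ κ ≤ n → Bij (HiveSet n μ ν κ) (HiveSet (suc n) μ ν κ)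
hive-resize {n} μ ν κ hμ hν hκ = record
  { to      = λ {b} H → tri (suc (suc n)) (X.ext H)
  ; from    = λ {b} _ → tri (suc n) (at b)
  ; to-ok   = λ H → X.extended H
  ; from-ok = λ H → Restrict.restricted H (out μ hμ) (out ν hν) (out κ hκ)
  ; from-to = λ { {b} H _ → at-ext λ { d i (s≤s h) → trans (at-tri (X.D H) d i (s≤s h)) (X.D-in H d i h) } }
  ; to-from = λ {b} H H′ → at-ext λ { d i (s≤s h) → back b H H′ d i h }
  }
  where
  out : ∀ μ → ℓ μ ≤ n → ⟦ μ ⟧ n ≡ 0ℤ
  out μ h = cong +_ (nth-out (parts μ) n h)
  module X {b : Tri (suc n)} (H : HiveSet n μ ν κ b) =
    Extend H (⟦⟧-≥0 μ n) (⟦⟧-≥0 ν n) (out μ hμ) (out ν hν) (out κ hκ)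
  module R {b : Tri (suc (suc n))} (H : HiveSet (suc n) μ ν κ b) = Restrict H (out μ hμ) (out ν hν) (out κ hκ)
  back : ∀ b (H : HiveSet (suc n) μ ν κ b) (H′ : HiveSet n μ ν κ (tri (suc n) (at b))) d i → d ℕ.+ i ≤ suc n →
    X.D H′ d i ≡ at b d i
  back b H H′ d       i h with ℕₚ.m≤n⇒m<n∨m≡n h
  back b H H′ d       i h | inj₁ (s≤s p) = trans (X.D-in H′ d i p) (at-tri (at b) d i (s≤s p))
  back b H H′ zero    i h | inj₂ refl = trans (X.D-last H′) (trans (at-tri (at b) 0 n ℕₚ.≤-refl)
      (sym (R.last-vertex H)))
  back b H H′ (suc d) i h | inj₂ e = let e′ = ℕₚ.suc-injective e in
    trans (X.D-out H′ d i e′) (trans (at-tri (at b) d i (s≤s (ℕₚ.≤-reflexive e′))) (sym (R.last-column H d i e′)))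

-- The Littlewood–Richardson rule

hiveCount : ∀ {n} μ ν κ → ℓ μ ≤ n → ℓ ν ≤ n → ℕ
hiveCount μ ν κ hμ hν = size (enum-hives μ ν κ hμ hν)

hiveCount-+ : ∀ {n} μ ν κ (hμ : ℓ μ ≤ n) (hν : ℓ ν ≤ n) → ℓ κ ≤ n → ∀ j (hμ′ : ℓ μ ≤ j ℕ.+ n) (hν′ : ℓ ν ≤ j ℕ.+ n) →
  hiveCount {j ℕ.+ n} μ ν κ hμ′ hν′ ≡ hiveCount μ ν κ hμ hν
hiveCount-+ μ ν κ hμ hν hκ zero    hμ′ hν′ = size-≡ (enum-hives μ ν κ hμ′ hν′) (enum-hives μ ν κ hμ hν) id id
hiveCount-+ {n} μ ν κ hμ hν hκ (suc j) hμ′ hν′ =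
  trans (sym (size-Bij (hive-resize μ ν κ (≤j hμ) (≤j hν) (≤j hκ)) (enum-hives μ ν κ (≤j hμ) (≤j hν))
      (enum-hives μ ν κ hμ′ hν′)))
    (hiveCount-+ μ ν κ hμ hν hκ j (≤j hμ) (≤j hν))
  where
  ≤j : ∀ {x} → x ≤ n → x ≤ j ℕ.+ n
  ≤j h = ℕₚ.≤-trans h (ℕₚ.m≤n+m n j)

-- Repeated resizing takes both counts to side `m + n`.
hiveCount-stable : ∀ {n m} μ ν κ (hμ : ℓ μ ≤ n) (hν : ℓ ν ≤ n) → ℓ κ ≤ n → (hμ′ : ℓ μ ≤ m) (hν′ : ℓ ν ≤ m) → ℓ κ ≤ m →
  hiveCount μ ν κ hμ hν ≡ hiveCount μ ν κ hμ′ hν′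
hiveCount-stable {n} {m} μ ν κ hμ hν hκ hμ′ hν′ hκ′ =
  trans (sym (hiveCount-+ μ ν κ hμ hν hκ m a b)) (trans (swap (ℕₚ.+-comm m n) a b a′ b′)
      (hiveCount-+ μ ν κ hμ′ hν′ hκ′ n a′ b′))
  where
  a = ℕₚ.≤-trans hμ (ℕₚ.m≤n+m n m)
  b = ℕₚ.≤-trans hν (ℕₚ.m≤n+m n m)
  a′ = ℕₚ.≤-trans hμ (ℕₚ.m≤m+n n m)
  b′ = ℕₚ.≤-trans hν (ℕₚ.m≤m+n n m)
  swap : ∀ {x y} → x ≡ y → (a : ℓ μ ≤ x) (b : ℓ ν ≤ x) (a′ : ℓ μ ≤ y) (b′ : ℓ ν ≤ y) → hiveCount μ ν κ a b ≡
      hiveCount μ ν κ a′ b′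
  swap refl a b a′ b′ = size-≡ (enum-hives μ ν κ a b) (enum-hives μ ν κ a′ b′) id id

size-empty : ∀ {A : Set} {P : A → Set} (E : Enum P) → (∀ x → ¬ P x) → size E ≡ 0
size-empty E none with elements E | sound E
... | []     | _ = refl
... | x ∷ xs | s = contradiction (s (here refl)) (none x)

-- Every side at least the three lengths gives the same count; this choice makes `lr` free of a size
-- parameter.
lrSize : Partition → Partition → Partition → ℕ
lrSize μ ν κ = ℓ μ ℕ.+ ℓ ν ℕ.+ ℓ κ

private
  μ≤ : ∀ μ ν κ → ℓ μ ≤ lrSize μ ν κ
  μ≤ μ ν κ = ℕₚ.≤-trans (ℕₚ.m≤m+n (ℓ μ) (ℓ ν)) (ℕₚ.m≤m+n _ (ℓ κ))
  ν≤ : ∀ μ ν κ → ℓ ν ≤ lrSize μ ν κ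
  ν≤ μ ν κ = ℕₚ.≤-trans (ℕₚ.m≤n+m (ℓ ν) (ℓ μ)) (ℕₚ.m≤m+n _ (ℓ κ))

abstract
  lr : Partition → Partition → Partition → ℕ
  lr μ ν κ = hiveCount μ ν κ (μ≤ μ ν κ) (ν≤ μ ν κ)

  lr-hives : ∀ {n} μ ν κ → ℓ μ ≤ n → ℓ ν ≤ n → ℓ κ ≤ n → (E : Enum (HiveSet n μ ν κ)) → lr μ ν κ ≡ size E
  lr-hives {n} μ ν κ hμ hν hκ E =
    trans (hiveCount-stable μ ν κ (μ≤ μ ν κ) (ν≤ μ ν κ) (ℕₚ.m≤n+m (ℓ κ) _) hμ hν hκ)
        (size-≡ (enum-hives μ ν κ hμ hν) E id id)

-- Hives exist only if both inner shapes are contained in the outer one.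
abstract
  lr-zero : ∀ μ ν κ → (ℓ κ < ℓ μ ⊎ ℓ κ < ℓ ν) → lr μ ν κ ≡ 0
  lr-zero μ ν κ h = size-empty (enum-hives μ ν κ (μ≤ μ ν κ) (ν≤ μ ν κ)) λ b H → case h of λ
    { (inj₁ p) → ℕₚ.<⇒≱ p (ℓ≤-entry μ (ℓ κ) (ℕₚ.n≤0⇒n≡0 (ℕₚ.≤-trans
        (hive-⊆ˡ μ ν κ H (ℓ κ) (ℕₚ.≤-trans p (μ≤ μ ν κ))) (ℕₚ.≤-reflexive (nth-out (parts κ) (ℓ κ) ℕₚ.≤-refl)))))
    ; (inj₂ p) → ℕₚ.<⇒≱ p (ℓ≤-entry ν (ℓ κ) (ℕₚ.n≤0⇒n≡0 (ℕₚ.≤-trans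
        (hive-⊆ʳ μ ν κ H (ℓ κ) (ℕₚ.≤-trans p (ν≤ μ ν κ))) (ℕₚ.≤-reflexive (nth-out (parts κ) (ℓ κ) ℕₚ.≤-refl))))) }

enum-∅ : ∀ {A : Set} {P : A → Set} → (∀ x → ¬ P x) → Enum P
enum-∅ none = record { elements = [] ; unique = [] ; sound = λ () ; complete = λ {x} p → contradiction p (none x) }

_≟ⱽ_ : ∀ {k} → DecidableEquality (Vec ℕ k)
_≟ⱽ_ = Vecₚ.≡-dec ℕ._≟_

enum-content : ∀ {k} μ (m : Vec ℕ k) → Enum (λ t → SSYT μ t × content t ≡ m)
enum-content μ m = enum-filter (λ t → content t ≟ⱽ m) (enum-SSYT μ)

schur-zero : ∀ {k} μ (m : Vec ℕ k) → k < ℓ μ → schur μ m ≡ 0ℤ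
schur-zero μ m h = trans (schur-size μ m (enum-content μ m))
  (cong +_ (size-empty (enum-content μ m) λ t p → ¬SSYT μ h t (proj₁ p)))

-- Products of Schur functions and their expansion

splits-unique : ∀ {k} (m : Vec ℕ k) → Unique (splits m)
splits-unique Vec.[]       = [] ∷ []
splits-unique (m Vec.∷ ms) = Uniqueₚ.cartesianProductWith⁺ _ (λ { refl → refl , refl }) (Uniqueₚ.upTo⁺
    (suc m)) (splits-unique ms)

splits-sound : ∀ {k} (m : Vec ℕ k) {z} → z ∈ splits m → Vec.zipWith ℕ._+_ (proj₁ z) (proj₂ z) ≡ m
splits-sound Vec.[]       (here refl) = refl
splits-sound (m Vec.∷ ms) z∈ with ∈-cartesianProductWith⁻ _ (upTo (suc m)) (splits ms) z∈
... | i , (a , b) , i∈ , ab∈ , refl = cong₂ Vec._∷_ (ℕₚ.m+[n∸m]≡n (ℕ.s≤s⁻¹ (∈-upTo⁻ i∈))) (splits-sound ms ab∈)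

splits-complete : ∀ {k} (a b : Vec ℕ k) → (a , b) ∈ splits (Vec.zipWith ℕ._+_ a b)
splits-complete Vec.[]       Vec.[]       = here refl
splits-complete (a Vec.∷ as) (b Vec.∷ bs) =
  subst (λ c → (a Vec.∷ as , c Vec.∷ bs) ∈ splits (a ℕ.+ b Vec.∷ Vec.zipWith ℕ._+_ as bs)) (ℕₚ.m+n∸m≡n a b)
    (∈-cartesianProductWith⁺ _ (∈-upTo⁺ (s≤s (ℕₚ.m≤m+n a b))) (splits-complete as bs))

hasSum-total : ∀ {A : Set} (_≟_ : DecidableEquality A) {f : A → ℤ} {s} → HasSum f s → ∀ {ys} → Unique ys →
  (∀ {x} → x ∉ ys → f x ≡ 0ℤ) → sumℤ (map f ys) ≡ s
hasSum-total _≟_ {f} F {ys} u van with common-support _≟_ F F ys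
... | zs , uz , sub , e , _ = trans (sum-support f u uz sub (λ _ → van)) e

PairOfContent : ∀ {k} → Partition → Partition → Vec ℕ k → Tableau k × Tableau k → Set
PairOfContent μ ν m z = SSYTPair μ ν z × Vec.zipWith ℕ._+_ (content (proj₁ z)) (content (proj₂ z)) ≡ m

enum-pairs : ∀ {k} μ ν (m : Vec ℕ k) → Enum (PairOfContent μ ν m)
enum-pairs μ ν m = enum-filter (λ z → Vec.zipWith ℕ._+_ (content (proj₁ z)) (content (proj₂ z)) ≟ⱽ m)
    (enum-× (enum-SSYT μ) (enum-SSYT ν))

-- Pairs of tableaux are fibred over the pair of their contents. The fibre over a pair with sum `m`
-- is a product of two finite sets, and it is empty over any pair outside `splits m`.
⊛-schur : ∀ μ ν {k} (m : Vec ℕ k) → (schur μ ⊛ schur ν) m ≡ + size (enum-pairs μ ν m)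
⊛-schur μ ν {k} m = trans (sum-cong (splits m) (λ {z} z∈ → on z (splits-sound m z∈)))
    (trans (hasSum-total _≟²_ (hasSum-fibres _≟²_ E F) (splits-unique m) (λ {z} z∉ → off z z∉))
        (cong +_ (sym (size-Bij β (enum-pairs μ ν m) E))))
  where
  _≟²_ : DecidableEquality (Vec ℕ k × Vec ℕ k)
  _≟²_ = ≡-dec _≟ⱽ_ _≟ⱽ_
  Q : Vec ℕ k × Vec ℕ k → Tableau k × Tableau k → Set
  Q ab z = ((λ t → SSYT μ t × content t ≡ proj₁ ab) ⊗ (λ t → SSYT ν t × content t ≡ proj₂ ab)) z
    × Vec.zipWith ℕ._+_ (proj₁ ab) (proj₂ ab) ≡ m
  β : Bij (PairOfContent μ ν m) (uncurry Q)
  β = record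
    { to      = λ {z} _ → (content (proj₁ z) , content (proj₂ z)) , z
    ; from    = λ {y} _ → proj₂ y
    ; to-ok   = λ { ((p , q) , e) → ((p , refl) , (q , refl)) , e }
    ; from-ok = λ { (((p , refl) , (q , refl)) , e) → (p , q) , e }
    ; from-to = λ _ _ → refl
    ; to-from = λ { (((p , refl) , (q , refl)) , e) _ → refl }
    }
  E : Enum (uncurry Q)
  E = transport β (enum-pairs μ ν m)
  F : ∀ ab → Enum (Q ab)
  F ab = enum-filter (λ _ → Vec.zipWith ℕ._+_ (proj₁ ab) (proj₂ ab) ≟ⱽ m) (enum-× (enum-content μ (proj₁ ab))
      (enum-content ν (proj₂ ab)))
  on : ∀ ab → Vec.zipWith ℕ._+_ (proj₁ ab) (proj₂ ab) ≡ m → schur μ (proj₁ ab) ℤ.* schur ν (proj₂ ab) ≡ + size (F ab)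
  on (a , b) e = trans (cong₂ ℤ._*_ (schur-size μ a (enum-content μ a)) (schur-size ν b (enum-content ν b)))
    (trans (sym (ℤₚ.pos-* (size (enum-content μ a)) (size (enum-content ν b))))
        (cong +_ (trans (sym (size-× (enum-content μ a) (enum-content ν b)))
      (size-≡ (enum-× (enum-content μ a) (enum-content ν b)) (F (a , b)) (_, e) proj₁))))
  off : ∀ ab → ab ∉ splits m → + size (F ab) ≡ 0ℤ
  off (a , b) ab∉ = cong +_ (size-empty (F (a , b)) λ z p → ab∉ (subst (λ m → (a , b) ∈ splits m) (proj₂ p)
      (splits-complete a b)))

enum-weight : ∀ {k} κ (m : Vec ℕ k) → ℓ κ ≤ k → Enum (λ g → Pattern κ g × HasWeight m g)
enum-weight κ m h = transport (bij-restrict (SSYT↔Pattern κ h)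
    (λ { {t} (_ , ss) → content⇒weight t ss m }) (λ { {t} (_ , ss) → weight⇒content t ss m }))
  (enum-content κ m)

schur-patterns : ∀ {k} κ (m : Vec ℕ k) (h : ℓ κ ≤ k) → schur κ m ≡ + size (enum-weight κ m h)
schur-patterns κ m h = trans (schur-size κ m (enum-content κ m)) (cong +_ (sym (size-transport _ (enum-content κ m))))

module _ {k} μ ν (hμ : ℓ μ ≤ k) (hν : ℓ ν ≤ k) (m : Vec ℕ k) where
  private
    HiveTop : Tri (suc k) × Tri k → Set
    HiveTop z = HivePattern k μ ν z × HasWeight m (proj₂ z)

    Over : Partition → Tri (suc k) × Tri k → Set
    Over κ z = ℓ κ ≤ k × (HiveSet k μ ν κ ⊗ λ g → Pattern κ g × HasWeight m g) z

    module Top {g : Tri k} (G : IsGT k (at g)) where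
      open IsGT G
      f : ℕ → ℕ
      f i = ℤ.∣ at g 0 i ∣
      f-at : ∀ i → i < k → + f i ≡ at g 0 i
      f-at i h = ℤₚ.0≤i⇒+∣i∣≡i (nonneg 0 i h)
      anti : Antitone k f
      anti i h = ℤₚ.drop‿+≤+ (subst₂ ℤ._≤_ (sym (f-at (suc i) h)) (sym (f-at i (ℕₚ.<⇒≤ h)))
        (ℤₚ.≤-trans (inter₂ 0 i h) (inter₁ 0 i h)))
      κ : Partition
      κ = toPartition k f anti
      top : ∀ i → i < k → at g 0 i ≡ ⟦ κ ⟧ i
      top i h = trans (sym (f-at i h)) (cong +_ (sym (strip-nth k f anti i h)))

    β : Bij HiveTop (uncurry Over)
    β = record
      { to      = λ { {z} ((H , G) , w) → Top.κ {proj₂ z} G , z }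
      ; from    = λ {y} _ → proj₂ y
      ; to-ok   = λ { {b , g} ((H , G) , w) → strip-length k _ ,
                    LRHive-cong (λ _ _ → refl) (λ _ _ → refl) (Top.top {g} G) H , pattern-of G (Top.top {g} G) , w }
      ; from-ok = λ { (_ , H , pattern-of G e , w) → (LRHive-cong (λ _ _ → refl) (λ _ _ → refl)
          (λ i h → sym (e i h)) H , G) , w }
      ; from-to = λ _ _ → refl
      ; to-from = λ { {κ , b , g} (h , H , pattern-of _ e , _) ((_ , G) , _) → cong (_, b , g)
                    (entry-ext {k} (Top.κ {g} G) κ (strip-length k _) h
                      λ i h → ℤₚ.+-injective (trans (sym (Top.top {g} G i h)) (e i h))) }
      }

  -- Pairs of tableaux become hives with a pattern whose top row is the diagonal. Over the partition
  -- `κ` read off the diagonal, the fibre is the product of the hives with diagonal `κ` and the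
  -- patterns of shape `κ` and weight `m`.
  lr-expansion : HasSum (λ κ → + lr μ ν κ ℤ.* schur κ m) (+ size (enum-pairs μ ν m))
  lr-expansion = subst (HasSum _) (cong +_ total) (hasSum-cong fibre (hasSum-fibres _≟ᴾ_ E F))
    where
    W : Enum HiveTop
    W = transport (tableaux↔hives-weight μ ν hμ hν m) (enum-pairs μ ν m)
    E : Enum (uncurry Over)
    E = transport β W
    F : ∀ κ → Enum (Over κ)
    F κ with ℓ κ ℕ.≤? k
    ... | yes h = enum-⇔ (h ,_) proj₂ (enum-× (enum-hives μ ν κ hμ hν) (enum-weight κ m h))
    ... | no ¬h = enum-∅ λ _ p → ¬h (proj₁ p)
    total : size E ≡ size (enum-pairs μ ν m)
    total = trans (size-transport β W) (size-transport (tableaux↔hives-weight μ ν hμ hν m) (enum-pairs μ ν m))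
    fibre : ∀ κ → + size (F κ) ≡ + lr μ ν κ ℤ.* schur κ m
    fibre κ with ℓ κ ℕ.≤? k
    ... | yes h = trans (cong +_ (size-× (enum-hives μ ν κ hμ hν) (enum-weight κ m h)))
            (trans (ℤₚ.pos-* (size (enum-hives μ ν κ hμ hν)) (size (enum-weight κ m h)))
              (cong₂ (λ x y → + x ℤ.* y) (sym (lr-hives μ ν κ hμ hν h (enum-hives μ ν κ hμ hν)))
                  (sym (schur-patterns κ m h))))
    ... | no ¬h = sym (trans (cong (ℤ._*_ (+ lr μ ν κ)) (schur-zero κ m (ℕₚ.≰⇒> ¬h))) (ℤₚ.*-zeroʳ (+ lr μ ν κ)))

-- If `μ` or `ν` has more parts than there are variables, the product is zero. Then each term
-- vanishes too, either because `κ` is itself too long or because it is shorter than that factor.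
lr-IsLR : IsLittlewoodRichardson (λ μ ν κ → + lr μ ν κ)
lr-IsLR μ ν {k} m = subst (HasSum _) (sym (⊛-schur μ ν m)) (go (ℓ μ ℕ.≤? k) (ℓ ν ℕ.≤? k))
  where
  vanish : ∀ {s} → s ≡ 0 → (k < ℓ μ ⊎ k < ℓ ν) → HasSum (λ κ → + lr μ ν κ ℤ.* schur κ m) (+ s)
  vanish refl big = record { support = [] ; distinct = [] ; vanishes = λ κ _ → zero-term κ ; total = refl }
    where
    zero-term : ∀ κ → + lr μ ν κ ℤ.* schur κ m ≡ 0ℤ
    zero-term κ with ℓ κ ℕ.≤? k
    ... | no ¬h = trans (cong (ℤ._*_ (+ lr μ ν κ)) (schur-zero κ m (ℕₚ.≰⇒> ¬h))) (ℤₚ.*-zeroʳ (+ lr μ ν κ))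
    ... | yes h = cong (λ x → + x ℤ.* schur κ m) (lr-zero μ ν κ (case big of λ
      { (inj₁ p) → inj₁ (ℕₚ.≤-<-trans h p) ; (inj₂ p) → inj₂ (ℕₚ.≤-<-trans h p) }))
  go : Dec (ℓ μ ≤ k) → Dec (ℓ ν ≤ k) → HasSum (λ κ → + lr μ ν κ ℤ.* schur κ m) (+ size (enum-pairs μ ν m))
  go (yes hμ) (yes hν) = lr-expansion μ ν hμ hν m
  go (no ¬hμ) _        = vanish (size-empty (enum-pairs μ ν m) λ z p → ¬SSYT μ (ℕₚ.≰⇒> ¬hμ) (proj₁ z)
      (proj₁ (proj₁ p))) (inj₁ (ℕₚ.≰⇒> ¬hμ))
  go (yes _)  (no ¬hν) = vanish (size-empty (enum-pairs μ ν m) λ z p → ¬SSYT ν (ℕₚ.≰⇒> ¬hν) (proj₂ z)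
      (proj₂ (proj₁ p))) (inj₂ (ℕₚ.≰⇒> ¬hν))

-- Littlewood–Richardson coefficients are unique

⊛-schur-comm : ∀ μ ν {k} (m : Vec ℕ k) → (schur μ ⊛ schur ν) m ≡ (schur ν ⊛ schur μ) m
⊛-schur-comm μ ν m = trans (⊛-schur μ ν m) (trans (cong +_ (size-Bij β (enum-pairs μ ν m)
    (enum-pairs ν μ m))) (sym (⊛-schur ν μ m)))
  where
  flip : ∀ μ ν {z} → PairOfContent μ ν m z → PairOfContent ν μ m (proj₂ z , proj₁ z)
  flip μ ν {s , t} ((p , q) , e) = (q , p) , trans (Vecₚ.zipWith-comm ℕₚ.+-comm (content t) (content s)) e
  β : Bij (PairOfContent μ ν m) (PairOfContent ν μ m)
  β = record
    { to      = λ {z} _ → proj₂ z , proj₁ z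
    ; from    = λ {z} _ → proj₂ z , proj₁ z
    ; to-ok   = flip μ ν
    ; from-ok = flip ν μ
    ; from-to = λ _ _ → refl
    ; to-from = λ _ _ → refl
    }

psum-mono : ∀ {f g : ℕ → ℤ} n → (∀ i → i < n → f i ℤ.≤ g i) → psum f n ℤ.≤ psum g n
psum-mono zero    h = ℤₚ.≤-refl
psum-mono (suc n) h = ℤₚ.+-mono-≤ (psum-mono n (λ i p → h i (ℕₚ.m≤n⇒m≤1+n p))) (h n ℕₚ.≤-refl)

padded : ∀ k → Partition → Vec ℕ k
padded k κ = Vec.tabulate (entry κ ∘ Fin.toℕ)

csum-tabulate : ∀ k (f : ℕ → ℕ) x → x ≤ k → + csum (Vec.tabulate {n = k} (f ∘ Fin.toℕ)) x ≡ psum (λ i → + f i) x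
csum-tabulate zero    f zero    h       = refl
csum-tabulate (suc k) f zero    h       = refl
csum-tabulate (suc k) f (suc x) (s≤s h) = trans (cong (ℤ._+_ (+ f 0)) (csum-tabulate k (f ∘ suc) x h))
    (sym (psum-head (λ i → + f i) x))

padded-csum : ∀ k κ x → x ≤ k → + csum (padded k κ) x ≡ psum ⟦ κ ⟧ x
padded-csum k κ = csum-tabulate k (entry κ)

padded-injective : ∀ {k} κ κ′ → ℓ κ ≤ k → ℓ κ′ ≤ k → padded k κ ≡ padded k κ′ → κ ≡ κ′
padded-injective {k} κ κ′ h h′ e = entry-ext κ κ′ h h′ λ i i<k →
  subst (λ j → entry κ j ≡ entry κ′ j) (Finₚ.toℕ-fromℕ< i<k)
    (trans (sym (Vecₚ.lookup∘tabulate _ (Fin.fromℕ< i<k)))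
      (trans (cong (λ v → Vec.lookup v (Fin.fromℕ< i<k)) e) (Vecₚ.lookup∘tabulate _ (Fin.fromℕ< i<k))))

csum-≤ : ∀ {k} (m : Vec ℕ k) x → csum m x ≤ csum m k
csum-≤ Vec.[]       x       = z≤n
csum-≤ (m Vec.∷ ms) zero    = z≤n
csum-≤ (m Vec.∷ ms) (suc x) = ℕₚ.+-monoʳ-≤ m (csum-≤ ms x)

nsum : ℕ → (ℕ → ℕ) → ℕ
nsum zero    f = 0
nsum (suc n) f = nsum n f ℕ.+ f n

nsum-bound : ∀ n {f d} → (∀ x → f x ≤ d) → nsum n f ≤ n ℕ.* d
nsum-bound zero    h = z≤n
nsum-bound (suc n) {f} {d} h = ℕₚ.≤-trans (ℕₚ.+-mono-≤ (nsum-bound n h) (h n)) (ℕₚ.≤-reflexive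
    (ℕₚ.+-comm (n ℕ.* d) d))

nsum-mono : ∀ n {f g : ℕ → ℕ} → (∀ x → x < n → f x ≤ g x) → nsum n f ≤ nsum n g
nsum-mono zero    h = z≤n
nsum-mono (suc n) h = ℕₚ.+-mono-≤ (nsum-mono n (λ x p → h x (ℕₚ.m≤n⇒m≤1+n p))) (h n ℕₚ.≤-refl)

nsum-equal : ∀ n {f g : ℕ → ℕ} → (∀ x → x < n → f x ≤ g x) → nsum n g ≤ nsum n f → ∀ x → x < n → f x ≡ g x
nsum-equal (suc n) {f} {g} h s x x<n with ℕₚ.m≤n⇒m<n∨m≡n (ℕ.s≤s⁻¹ x<n)
... | inj₁ p = nsum-equal n (λ x p → h x (ℕₚ.m≤n⇒m≤1+n p))
      (ℕₚ.+-cancelʳ-≤ (f n) (nsum n g) (nsum n f) (ℕₚ.≤-trans (ℕₚ.+-monoʳ-≤ (nsum n g) (h n ℕₚ.≤-refl)) s)) x p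
... | inj₂ refl = ℕₚ.≤-antisym (h n ℕₚ.≤-refl)
      (ℕₚ.+-cancelˡ-≤ (nsum n g) (g n) (f n) (ℕₚ.≤-trans s (ℕₚ.+-monoˡ-≤ (f n)
          (nsum-mono n (λ x p → h x (ℕₚ.m≤n⇒m≤1+n p))))))

-- Kostka numbers are unitriangular for the dominance order.

module _ {k : ℕ} (κ κ′ : Partition) {g : Tri k} (P : Pattern κ′ g) (w : HasWeight (padded k κ) g) where
  -- Row `k ∸ x` has as its sum the first `x` parts of `κ`, and each of its entries is at most the
  -- top entry in the same position, a part of `κ′`.
  dominance : ∀ x → x ≤ k → csum (padded k κ) x ≤ csum (padded k κ′) x
  dominance x h = ℤₚ.drop‿+≤+ (subst₂ ℤ._≤_ (trans (cong (psum _) (sym (ℕₚ.m∸[m∸n]≡n h))) (w x h))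
      (sym (padded-csum k κ′ x h))
    (psum-mono x λ i i<x → ℤₚ.≤-trans (≤-top κ′ g P (k ℕ.∸ x) i (∸-lt h i<x))
      (ℤₚ.≤-reflexive (Pattern.top P i (ℕₚ.≤-trans i<x h)))))

  same-size : csum (padded k κ) k ≡ csum (padded k κ′) k
  same-size = ℤₚ.+-injective (trans (sym (w k ℕₚ.≤-refl)) (trans (cong (rowSum g) (ℕₚ.n∸n≡0 k))
    (trans (psum-cong k (Pattern.top P)) (sym (padded-csum k κ′ k ℕₚ.≤-refl)))))

truncated-weight : ∀ k κ → HasWeight (padded k κ) (truncated k κ)
truncated-weight k κ x h = trans (cong (psum _) (ℕₚ.m∸[m∸n]≡n h))
  (trans (psum-cong x (λ i i<x → at-tri (λ _ → ⟦ κ ⟧) (k ℕ.∸ x) i (∸-lt h i<x))) (sym (padded-csum k κ x h)))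

size-inhabited : ∀ {A : Set} {P : A → Set} (E : Enum P) {x} → P x → ∃[ s ] size E ≡ suc s
size-inhabited E p with elements E | complete E p
... | y ∷ ys | _ = length ys , refl

-- The pattern `truncated k κ` is counted, so the coefficient is positive and can be cancelled.
kostka-diagonal : ∀ {k} κ → ℓ κ ≤ k → ∃[ s ] schur κ (padded k κ) ≡ + suc s
kostka-diagonal {k} κ h with size-inhabited (enum-weight κ (padded k κ) h) (truncated-pattern k κ , truncated-weight k κ)
... | s , e = s , trans (schur-patterns κ (padded k κ) h) (cong +_ e)

sum-Δ : ∀ {A : Set} (f g : A → ℤ) xs → sumℤ (map (λ x → f x ℤ.- g x) xs) ≡ sumℤ (map f xs) ℤ.- sumℤ (map g xs)
sum-Δ f g []       = refl
sum-Δ f g (x ∷ xs) = trans (cong (ℤ._+_ (f x ℤ.- g x)) (sum-Δ f g xs)) (l (f x) (g x) (sumℤ (map f xs))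
    (sumℤ (map g xs)))
  where
  l : ∀ a b c d → a ℤ.- b ℤ.+ (c ℤ.- d) ≡ a ℤ.+ c ℤ.- (b ℤ.+ d)
  l = solve-∀

-- Over a common support containing `x`, the differences of the summands add up to zero, and the
-- only one that might not vanish is that at `x`.
hasSum-agree : ∀ {A : Set} → DecidableEquality A → ∀ {f g : A → ℤ} {s} x → HasSum f s → HasSum g s →
  (∀ y → y ≢ x → f y ≡ g y) → f x ≡ g x
hasSum-agree _≟_ {f} {g} {s} x F G e with common-support _≟_ F G [ x ]
... | ys , u , sub , F≡ , G≡ = ℤₚ.i-j≡0⇒i≡j (f x) (g x)
  (trans (sym (sum-single (λ y → f y ℤ.- g y) u (sub (here refl)) (λ {y} _ y≢x → ℤₚ.i≡j⇒i-j≡0 (e y y≢x))))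
    (trans (sum-Δ f g ys) (ℤₚ.i≡j⇒i-j≡0 (trans F≡ (sym G≡)))))

-- Downward induction along the dominance order, measured by the sum S of all
-- partial sums of the parts.
lr-unique : ∀ c c′ → IsLittlewoodRichardson c → IsLittlewoodRichardson c′ → ∀ μ ν κ → c μ ν κ ≡ c′ μ ν κ
lr-unique c c′ C C′ μ ν κ₀ = go (suc (bound κ₀)) κ₀ ℕₚ.≤-refl (ℕₚ.m≤n+m _ (S κ₀))
  where
  -- All comparisons take place in `k` variables, where partitions with more than `k` parts
  -- contribute nothing.
  k = ℓ κ₀
  S bound : Partition → ℕ
  S κ = nsum (suc k) (csum (padded k κ))
  bound κ = suc k ℕ.* csum (padded k κ) k
  go : ∀ fuel κ → ℓ κ ≤ k → bound κ < S κ ℕ.+ fuel → c μ ν κ ≡ c′ μ ν κ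
  -- `S` never exceeds `bound`, so the hypothesis fails once the fuel is used up.
  go zero κ h f = contradiction (subst (bound κ <_) (ℕₚ.+-identityʳ (S κ)) f)
      (ℕₚ.≤⇒≯ (nsum-bound (suc k) (csum-≤ (padded k κ))))
  go (suc fuel) κ h f = let s , e = kostka-diagonal κ h in
    ℤₚ.*-cancelʳ-≡ (c μ ν κ) (c′ μ ν κ) (+ suc s)
      (subst (λ K → c μ ν κ ℤ.* K ≡ c′ μ ν κ ℤ.* K) e (hasSum-agree _≟ᴾ_ κ (C μ ν m) (C′ μ ν m) others))
    where
    m = padded k κ
    others : ∀ κ′ → κ′ ≢ κ → c μ ν κ′ ℤ.* schur κ′ m ≡ c′ μ ν κ′ ℤ.* schur κ′ m
    others κ′ κ′≢κ with ℓ κ′ ℕ.≤? k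
    ... | no ¬h = trans (cong (ℤ._*_ (c μ ν κ′)) z) (trans (ℤₚ.*-zeroʳ (c μ ν κ′))
        (sym (trans (cong (ℤ._*_ (c′ μ ν κ′)) z) (ℤₚ.*-zeroʳ (c′ μ ν κ′)))))
      where z = schur-zero κ′ m (ℕₚ.≰⇒> ¬h)
    ... | yes h′ with elements (enum-weight κ′ m h′) in eq
    ...   | [] = trans (cong (ℤ._*_ (c μ ν κ′)) z) (trans (ℤₚ.*-zeroʳ (c μ ν κ′))
        (sym (trans (cong (ℤ._*_ (c′ μ ν κ′)) z) (ℤₚ.*-zeroʳ (c′ μ ν κ′)))))
      where z = trans (schur-patterns κ′ m h′) (cong (λ l → + length l) eq)
    ...   | g ∷ _ = cong (ℤ._* schur κ′ m) (go fuel κ′ h′ f′)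
      where
      Pw = sound (enum-weight κ′ m h′) (subst (g ∈_) (sym eq) (here refl))
      -- By `dominance` no partial sum of `κ` exceeds that of `κ′`; if the totals did not increase,
      -- all partial sums would agree and `κ′` would be `κ`. Since `bound` is the same for both, one
      -- unit of fuel is gained.
      S< : S κ < S κ′
      S< = ℕₚ.≰⇒> λ le → κ′≢κ (sym (padded-injective κ κ′ h h′ (csum-injective λ x p →
        nsum-equal (suc k) (λ x q → dominance κ κ′ (proj₁ Pw) (proj₂ Pw) x (ℕ.s≤s⁻¹ q)) le x (s≤s p))))
      f′ : bound κ′ < S κ′ ℕ.+ fuel
      f′ = ℕₚ.≤-trans (subst (λ d → suc k ℕ.* d < S κ ℕ.+ suc fuel) (same-size κ κ′ (proj₁ Pw) (proj₂ Pw)) f)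
        (ℕₚ.≤-trans (ℕₚ.≤-reflexive (ℕₚ.+-suc (S κ) fuel)) (ℕₚ.+-monoˡ-≤ fuel S<))

lr-swap : ∀ c → IsLittlewoodRichardson c → IsLittlewoodRichardson (λ μ ν → c ν μ)
lr-swap c C μ ν m = subst (HasSum _) (⊛-schur-comm ν μ m) (C ν μ m)

-- The product of Schur functions commutes, so the swapped family has the same defining property and
-- uniqueness applies.
lr-comm : ∀ μ ν κ → lr μ ν κ ≡ lr ν μ κ
lr-comm μ ν κ = ℤₚ.+-injective (lr-unique c (λ μ ν → c ν μ) lr-IsLR (lr-swap c lr-IsLR) μ ν κ)
  where
  c : Partition → Partition → Partition → ℤ
  c μ ν κ = + lr μ ν κ

-- Cardinalities of setoids

index-lookup : ∀ {A : Set} {xs : List A} → Unique xs → ∀ i (p : Data.List.lookup xs i ∈ xs) → Any.index p ≡ i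
index-lookup (x∉ ∷ u) Fin.zero    (here _)  = refl
index-lookup (x∉ ∷ u) Fin.zero    (there p) = contradiction refl (All.lookup x∉ p)
index-lookup (x∉ ∷ u) (Fin.suc i) (here e)  = contradiction (sym e) (All.lookup x∉ (∈-lookup i))
index-lookup (x∉ ∷ u) (Fin.suc i) (there p) = cong Fin.suc (index-lookup u i p)

module _ {S : Setoid 0ℓ 0ℓ} {A : Set} {P : A → Set} (E : Enum P)
  (to : ∀ {x} → P x → Setoid.Carrier S) (from : Setoid.Carrier S → A) (from-ok : ∀ c → P (from c))
  (from-cong : ∀ {c c′} → Setoid._≈_ S c c′ → from c ≡ from c′)
  (from-to : ∀ {x} (p : P x) → from (to p) ≡ x)
  (to-from : ∀ c (p : P (from c)) → Setoid._≈_ S (to p) c) where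
  open Setoid S using (Carrier; _≈_)

  -- An element `c` is numbered by the position of `from c` in the listing; as nothing is repeated,
  -- the position does not depend on the membership proof.
  hasCardinality : HasCardinality S (size E)
  hasCardinality = record
    { to        = λ i → to (sound E (∈-lookup i))
    ; from      = idx
    ; to-cong   = λ { refl → Setoid.refl S }
    ; from-cong = idx-cong
    ; inverse   = (λ { {c} refl → to-idx c (sound E (∈-lookup (idx c))) (Anyₚ.lookup-index
        (complete E (from-ok c))) })
                , (λ { {i} {c} e → trans (idx-cong e)
                    (idx-to i (complete E (from-ok (to (sound E (∈-lookup i)))))
                    (from-to (sound E (∈-lookup i)))) })
    }
    where
    idx : Carrier → Fin (size E)
    idx c = Any.index (complete E (from-ok c))

    index-cong : ∀ {x y} (p : x ∈ elements E) (q : y ∈ elements E) → x ≡ y → Any.index p ≡ Any.index q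
    index-cong {x} p q refl = trans (go (Anyₚ.lookup-index p) p) (sym (go (Anyₚ.lookup-index p) q))
      where
      go : ∀ {z} → z ≡ Data.List.lookup (elements E) (Any.index p) → (r : z ∈ elements E) → Any.index r ≡ Any.index p
      go refl r = index-lookup (unique E) (Any.index p) r

    idx-cong : ∀ {c c′} → c ≈ c′ → idx c ≡ idx c′
    idx-cong e = index-cong (complete E (from-ok _)) (complete E (from-ok _)) (from-cong e)

    to-idx : ∀ c {x} (p : P x) → from c ≡ x → to p ≈ c
    to-idx c p refl = to-from c p

    idx-to : ∀ i {x} (p : x ∈ elements E) → x ≡ Data.List.lookup (elements E) i → Any.index p ≡ i
    idx-to i p refl = index-lookup (unique E) i p

-- Partitions inside a rectangle

-- A finite range for the unknown edges of hives, whose shapes are contained in those on the outer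
-- boundary.
Inside : ℕ → ℕ → Partition → Set
Inside n B κ = ℓ κ ≤ n × All (_≤ B) (parts κ)

enum-lists : ∀ n B → Enum (λ ps → length ps ≤ n × All (_≤ B) ps)
enum-lists zero    B = record
  { elements = [ [] ] ; unique = [] ∷ [] ; sound = λ { (here refl) → z≤n , [] }
  ; complete = λ { {[]} _ → here refl ; {_ ∷ _} (() , _) } }
enum-lists (suc n) B = record
  { elements = [] ∷ longer
  ; unique   = All.tabulate (λ ps∈ e → nonempty (subst (_∈ longer) (sym e) ps∈)) ∷
      Uniqueₚ.cartesianProductWith⁺ List._∷_ (λ { refl → refl , refl }) (Uniqueₚ.upTo⁺ (suc B)) (unique rec)
  ; sound    = λ { (here refl) → z≤n , [] ; (there ps∈) → longer-sound ps∈ }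
  ; complete = λ { {[]} _ → here refl ; {p ∷ ps} (s≤s h , p≤ ∷ ps≤) →
      there (∈-cartesianProductWith⁺ List._∷_ (∈-upTo⁺ (s≤s p≤)) (complete rec (h , ps≤))) }
  }
  where
  rec    = enum-lists n B
  longer = cartesianProductWith List._∷_ (upTo (suc B)) (elements rec)
  longer-sound : ∀ {ps} → ps ∈ longer → length ps ≤ suc n × All (_≤ B) ps
  longer-sound ps∈ with ∈-cartesianProductWith⁻ List._∷_ (upTo (suc B)) (elements rec) ps∈
  ... | p , ps , p∈ , q , refl = s≤s (proj₁ (sound rec q)) , ℕ.s≤s⁻¹ (∈-upTo⁻ p∈) ∷ proj₂ (sound rec q)
  nonempty : [] ∉ longer
  nonempty []∈ with ∈-cartesianProductWith⁻ List._∷_ (upTo (suc B)) (elements rec) []∈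
  ... | _ , _ , _ , _ , ()

abstract
  enum-inside : ∀ n B → Enum (Inside n B)
  enum-inside n B = transport β (enum-filter (λ ps → Linked.linked? (λ x y → y ℕ.≤? x) ps ×-dec All.all?
      (0 ℕ.<?_) ps) (enum-lists n B))
    where
    β : Bij (λ ps → (length ps ≤ n × All (_≤ B) ps) × (Linked ℕ._≥_ ps × All (0 <_) ps)) (Inside n B)
    β = record
      { to      = λ {ps} h → mkPartition ps (proj₁ (proj₂ h)) (proj₂ (proj₂ h))
      ; from    = λ {κ} _ → parts κ
      ; to-ok   = proj₁
      ; from-ok = λ {κ} h → h , decreasing κ , positive κ
      ; from-to = λ _ _ → refl
      ; to-from = λ {κ} _ h → partition-≡ {mkPartition (parts κ) (proj₁ (proj₂ h)) (proj₂ (proj₂ h))} {κ} refl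
      }

inside : ∀ {n} κ μ → ℓ κ ≤ n → (∀ i → i < n → entry κ i ≤ entry μ i) → Inside n (entry μ 0) κ
inside {n} κ μ h sub = h , all-nth (parts κ) λ i i< → ℕₚ.≤-trans (sub i (ℕₚ.≤-trans i< h)) (first i)
  where
  first : ∀ i → entry μ i ≤ entry μ 0
  first zero    = ℕₚ.≤-refl
  first (suc i) = ℕₚ.≤-trans (entry-antitone μ i) (first i)
  all-nth : ∀ {B} ps → (∀ i → i < length ps → nth ps i ≤ B) → All (_≤ B) ps
  all-nth []       h = []
  all-nth (p ∷ ps) h = h 0 (s≤s z≤n) ∷ all-nth ps (λ i p → h (suc i) (s≤s p))

-- Triples of hives with matching edges

Triple : Set
Triple = Partition × Partition × Partition

Hives : ℕ → Set
Hives n = Tri (suc n) × Tri (suc n) × Tri (suc n)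

Short : ℕ → Triple → Set
Short n (α , β , γ) = ℓ α ≤ n × ℓ β ≤ n × ℓ γ ≤ n

module _ (n : ℕ) (μ ν κ : Partition) where
  -- The order of the edges is that in which the charts below run through the sides; hence `γ` comes
  -- before `α` in the second hive.
  Edges : Triple → Hives n → Set
  Edges (α , β , γ) = HiveSet n α β μ ⊗ HiveSet n γ α ν ⊗ HiveSet n β γ κ

  Matching : Triple → Hives n → Set
  Matching t h = Short n t × Edges t h

  enum-edges : ∀ t → Short n t → Enum (Edges t)
  enum-edges (α , β , γ) (hα , hβ , hγ) = enum-× (enum-hives α β μ hα hβ) (enum-× (enum-hives γ α ν hγ hα)
      (enum-hives β γ κ hβ hγ))

  -- Only finitely many triples occur, since `α` and `β` are contained in `μ` and `γ` in `ν`.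
  enum-matching : Enum (uncurry Matching)
  enum-matching = enum-⇔ (λ {z} → proj₂′ {z}) (λ {z} → with-inside {z}) (enum-Σ candidates (λ {t} c →
      enum-edges t (short t c)))
    where
    Candidate : Triple → Set
    Candidate = Inside n (entry μ 0) ⊗ Inside n (entry μ 0) ⊗ Inside n (entry ν 0)
    candidates : Enum Candidate
    candidates = enum-× (enum-inside n (entry μ 0)) (enum-× (enum-inside n (entry μ 0)) (enum-inside n (entry ν 0)))
    short : ∀ t → Candidate t → Short n t
    short _ (a , b , c) = proj₁ a , proj₁ b , proj₁ c
    proj₂′ : ∀ {z} → Candidate (proj₁ z) × Edges (proj₁ z) (proj₂ z) → uncurry Matching z
    proj₂′ {t , _} (c , h) = short t c , h
    with-inside : ∀ {z} → uncurry Matching z → Candidate (proj₁ z) × Edges (proj₁ z) (proj₂ z)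
    with-inside {(α , β , γ) , _} ((hα , hβ , hγ) , h@(H₁ , H₂ , _)) =
      (inside α μ hα (hive-⊆ˡ α β μ H₁) , inside β μ hβ (hive-⊆ʳ α β μ H₁) , inside γ ν hγ (hive-⊆ˡ γ α ν H₂)) , h

  matching-fibre : ∀ t → Enum (Matching t)
  matching-fibre t@(α , β , γ) with ℓ α ℕ.≤? n | ℓ β ℕ.≤? n | ℓ γ ℕ.≤? n
  ... | yes a | yes b | yes c = enum-⇔ ((a , b , c) ,_) proj₂ (enum-edges t (a , b , c))
  ... | no ¬a | _     | _     = enum-∅ λ _ h → ¬a (proj₁ (proj₁ h))
  ... | _     | no ¬b | _     = enum-∅ λ _ h → ¬b (proj₁ (proj₂ (proj₁ h)))
  ... | _     | _     | no ¬c = enum-∅ λ _ h → ¬c (proj₂ (proj₂ (proj₁ h)))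

  -- `lr-comm` restores the order `α`, `γ` in the second factor. If some partition has more than `n`
  -- parts, the fibre is empty and one of the coefficients vanishes.
  matching-size : ℓ μ ≤ n → ℓ ν ≤ n → ℓ κ ≤ n → ∀ α β γ →
    size (matching-fibre (α , β , γ)) ≡ lr α β μ ℕ.* lr α γ ν ℕ.* lr β γ κ
  matching-size hμ hν hκ α β γ with ℓ α ℕ.≤? n | ℓ β ℕ.≤? n | ℓ γ ℕ.≤? n
  ... | yes a | yes b | yes c = trans (size-× E₁ (enum-× E₂ E₃)) (trans (cong (size E₁ ℕ.*_) (size-× E₂ E₃))
      (trans (sym (ℕₚ.*-assoc (size E₁) (size E₂) (size E₃)))
        (sym (cong₂ ℕ._*_ (cong₂ ℕ._*_ (lr-hives α β μ a b hμ E₁) (trans (lr-comm α γ ν) (lr-hives γ α ν c a hν E₂)))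
          (lr-hives β γ κ b c hκ E₃)))))
    where
    E₁ = enum-hives α β μ a b
    E₂ = enum-hives γ α ν c a
    E₃ = enum-hives β γ κ b c
  ... | no ¬a | _     | _     = sym (cong (λ x → x ℕ.* lr α γ ν ℕ.* lr β γ κ) (lr-zero α β μ
      (inj₁ (ℕₚ.≤-<-trans hμ (ℕₚ.≰⇒> ¬a)))))
  ... | yes _ | no ¬b | _     = sym (cong (λ x → x ℕ.* lr α γ ν ℕ.* lr β γ κ) (lr-zero α β μ
      (inj₂ (ℕₚ.≤-<-trans hμ (ℕₚ.≰⇒> ¬b)))))
  ... | yes _ | yes _ | no ¬c = sym (cong (ℕ._* lr β γ κ) (trans (cong (lr α β μ ℕ.*_) (lr-zero α γ ν
      (inj₂ (ℕₚ.≤-<-trans hν (ℕₚ.≰⇒> ¬c)))))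
      (ℕₚ.*-zeroʳ (lr α β μ))))

  newell-littlewood : ℓ μ ≤ n → ℓ ν ≤ n → ℓ κ ≤ n → IsNewellLittlewood μ ν κ (+ size enum-matching)
  newell-littlewood hμ hν hκ = ((λ α β κ → + lr α β κ) , lr-IsLR) , λ c C →
    hasSum-cong (λ { (α , β , γ) → trans (cong +_ (matching-size hμ hν hκ α β γ))
        (trans (ℤₚ.pos-* (lr α β μ ℕ.* lr α γ ν) (lr β γ κ))
        (cong₂ ℤ._*_ (trans (ℤₚ.pos-* (lr α β μ) (lr α γ ν)) (cong₂ ℤ._*_ (same c C α β μ) (same c C α γ ν)))
            (same c C β γ κ))) })
      (hasSum-fibres (≡-dec _≟ᴾ_ (≡-dec _≟ᴾ_ _≟ᴾ_)) enum-matching matching-fibre)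
    where
    same : ∀ c → IsLittlewoodRichardson c → ∀ α β κ → + lr α β κ ≡ c α β κ
    same c C = lr-unique (λ α β κ → + lr α β κ) c lr-IsLR C

-- Charts of the three triangles

Rh-shift : ∀ {x y z w} c → Rh x y z w → Rh (x ℤ.+ c) (y ℤ.+ c) (z ℤ.+ c) (w ℤ.+ c)
Rh-shift {x} {y} {z} {w} c (rh h) = rh (subst₂ ℤ._≤_ (l x y c) (l z w c) (ℤₚ.+-monoˡ-≤ (c ℤ.+ c) h))
  where
  l : ∀ x y c → x ℤ.+ y ℤ.+ (c ℤ.+ c) ≡ x ℤ.+ c ℤ.+ (y ℤ.+ c)
  l = solve-∀

Rh-unshift : ∀ {x y z w} c → Rh (x ℤ.+ c) (y ℤ.+ c) (z ℤ.+ c) (w ℤ.+ c) → Rh x y z w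
Rh-unshift {x} {y} {z} {w} c h = Rh-≡ (-c x) (-c y) (-c z) (-c w) (Rh-shift (ℤ.- c) h)
  where
  l : ∀ x c → x ℤ.+ c ℤ.+ ℤ.- c ≡ x
  l = solve-∀
  -c : ∀ x → x ℤ.+ c ℤ.+ ℤ.- c ≡ x
  -c x = l x c

Flip : ∀ {A : Set₁} → (ℕ → ℕ → A) → ℕ → ℕ → A
Flip Δ i j = Δ j i

flip : Labels → Labels
flip a i j = a j i

-- Transposition exchanges the rhombi of the first and third kind and preserves those of the second.
flip-rhombi : ∀ {Δ a} → Rhombi Δ a → Rhombi (Flip Δ) (flip a)
flip-rhombi {Δ} {a} R = record
  { rhombus₁ = λ i j p q r s → ℤₚ.≤-trans (ℤₚ.≤-reflexive (ℤₚ.+-comm (a (2 ℕ.+ j) (1 ℕ.+ i)) (a j i)))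
      (rhombus₃ j i p q s r)
  ; rhombus₂ = λ i j p q r s → ℤₚ.≤-trans (ℤₚ.≤-reflexive (ℤₚ.+-comm (a (1 ℕ.+ j) i) (a j (1 ℕ.+ i))))
      (rhombus₂ j i p q s r)
  ; rhombus₃ = λ i j p q r s → ℤₚ.≤-trans (ℤₚ.≤-reflexive (ℤₚ.+-comm (a j i) (a (1 ℕ.+ j) (2 ℕ.+ i))))
      (rhombus₁ j i p q s r)
  }
  where open Rhombi R

-- A chart sends the vertex with diagonal coordinates d and e of a hive to the
-- vertex (I e , d + K e) of Δ.
record Chart (n : ℕ) (Δ : ℕ → ℕ → Set) : Set where
  field
    I K    : ℕ → ℕ
    I-suc  : ∀ e → I (suc e) ≡ suc (I e)
    K-suc  : ∀ e → K (suc e) ≡ suc (K e)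
    inΔ    : ∀ d e → d ℕ.+ e ≤ n → Δ (I e) (d ℕ.+ K e)
    bound  : ∀ d e → Δ (I e) (d ℕ.+ K e) → d ℕ.+ e ≤ n
    strict : ∀ e → ¬ Δ (I (suc e)) (K e)
    decode : ∀ i j → Δ i j → ∃[ d ] ∃[ e ] i ≡ I e × j ≡ d ℕ.+ K e

  module _ (a : Labels) where
    read : Labels
    read d e = a (I e) (d ℕ.+ K e)

    read-01 : ∀ d e → a (suc (I e)) (suc (d ℕ.+ K e)) ≡ read d (suc e)
    read-01 d e = cong₂ a (sym (I-suc e)) (sym (trans (cong (d ℕ.+_) (K-suc e)) (ℕₚ.+-suc d (K e))))

    read-02 : ∀ d e → a (suc (suc (I e))) (suc (suc (d ℕ.+ K e))) ≡ read d (suc (suc e))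
    read-02 d e = trans (cong₂ a (cong suc (sym (I-suc e))) (cong suc (trans (sym (ℕₚ.+-suc d (K e)))
        (cong (d ℕ.+_) (sym (K-suc e)))))) (read-01 d (suc e))

  private
    Δ-01 : ∀ d e → d ℕ.+ suc e ≤ n → Δ (suc (I e)) (suc (d ℕ.+ K e))
    Δ-01 d e h = subst₂ Δ (I-suc e) (trans (cong (d ℕ.+_) (K-suc e)) (ℕₚ.+-suc d (K e))) (inΔ d (suc e) h)

    Δ-02 : ∀ d e → d ℕ.+ suc (suc e) ≤ n → Δ (suc (suc (I e))) (suc (suc (d ℕ.+ K e)))
    Δ-02 d e h = subst₂ Δ (trans (I-suc (suc e)) (cong suc (I-suc e)))
      (trans (cong (d ℕ.+_) (trans (K-suc (suc e)) (cong suc (K-suc e)))) (trans (ℕₚ.+-suc d (suc (K e)))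
          (cong suc (ℕₚ.+-suc d (K e)))))
      (inΔ d (suc (suc e)) h)

    bound-01 : ∀ d e → Δ (suc (I e)) (suc (d ℕ.+ K e)) → d ℕ.+ suc e ≤ n
    bound-01 d e p = bound d (suc e) (subst₂ Δ (sym (I-suc e)) (sym (trans (cong (d ℕ.+_) (K-suc e))
        (ℕₚ.+-suc d (K e)))) p)

    module _ {n} (d e : ℕ) (h : suc (d ℕ.+ e) < n) where
      h₁₀ : suc d ℕ.+ e ≤ n
      h₁₀ = ℕₚ.<⇒≤ h
      h₀₀ : d ℕ.+ e ≤ n
      h₀₀ = ℕₚ.<⇒≤ (pred-< h)
      h₀₁ : d ℕ.+ suc e ≤ n
      h₀₁ = ℕₚ.<⇒≤ (sucʳ-< d e h)
      h₁₁ : suc d ℕ.+ suc e ≤ n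
      h₁₁ = sucʳ-< d e h
      h₀₂ : d ℕ.+ suc (suc e) ≤ n
      h₀₂ = subst (_≤ n) (sym (ℕₚ.+-suc d (suc e))) (sucʳ-< d e h)

  -- A hive has label 0 at its origin, a triangle inside the trapezoid need not; the constant `c`
  -- makes up the difference and cancels in every rhombus inequality.
  module _ {a b : Labels} (c : ℤ) (val : ∀ d e → d ℕ.+ e ≤ n → read a d e ≡ b d e ℤ.+ c) where
    rhombi⇒hive : Rhombi Δ a → IsHive n b
    rhombi⇒hive R = record
      { r₁ = λ d e h → Rh-unshift c (Rh-≡ (trans (read-01 a (suc d) e) (val (suc d) (suc e) (h₁₁ d e h)))
          (val d e (h₀₀ d e h))
          (val (suc d) e (h₁₀ d e h)) (trans (read-01 a d e) (val d (suc e) (h₀₁ d e h)))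
          (rh (rhombus₁ (I e) (d ℕ.+ K e) (inΔ (suc d) e (h₁₀ d e h)) (Δ-01 d e (h₀₁ d e h)) (Δ-01 (suc d) e
              (h₁₁ d e h)) (inΔ d e (h₀₀ d e h)))))
      ; r₂ = λ d e h → Rh-unshift c (Rh-≡ (val (2 ℕ.+ d) e h) (trans (read-01 a d e) (val d (suc e) (h₀₁ d e h)))
          (val (suc d) e (h₁₀ d e h)) (trans (read-01 a (suc d) e) (val (suc d) (suc e) (h₁₁ d e h)))
          (rh (rhombus₂ (I e) (suc (d ℕ.+ K e)) (inΔ (suc d) e (h₁₀ d e h)) (Δ-01 (suc d) e (h₁₁ d e h))
              (inΔ (2 ℕ.+ d) e h) (Δ-01 d e (h₀₁ d e h)))))
      ; r₃ = λ d e h → Rh-unshift c (Rh-≡ (trans (read-02 a d e) (val d (2 ℕ.+ e) (h₀₂ d e h)))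
          (val (suc d) e (h₁₀ d e h))
          (trans (read-01 a d e) (val d (suc e) (h₀₁ d e h))) (trans (read-01 a (suc d) e)
              (val (suc d) (suc e) (h₁₁ d e h)))
          (sl (rh (rhombus₃ (I e) (suc (d ℕ.+ K e)) (Δ-01 d e (h₀₁ d e h)) (Δ-01 (suc d) e (h₁₁ d e h))
              (inΔ (suc d) e (h₁₀ d e h)) (Δ-02 d e (h₀₂ d e h))))))
      }
      where open Rhombi R

    hive⇒rhombi : IsHive n b → Rhombi Δ a
    hive⇒rhombi H = record
      { rhombus₁ = λ i j _ _ p q → case decode i j q of λ
          { (d , e , refl , refl) → let h = back d e (bound-01 (suc d) e p) in
            Rh.ineq (Rh-≡ (sym (trans (read-01 a (suc d) e) (val (suc d) (suc e) (h₁₁ d e h))))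
                (sym (val d e (h₀₀ d e h)))
              (sym (val (suc d) e (h₁₀ d e h))) (sym (trans (read-01 a d e) (val d (suc e) (h₀₁ d e h))))
                  (Rh-shift c (r₁ d e h))) }
      ; rhombus₂ = λ i j q p _ s → case decode i j q of λ
          { (zero , e , refl , refl) → ⊥-elim (strict e (subst (λ x → Δ x (K e)) (sym (I-suc e)) s))
          ; (suc d , e , refl , refl) → let h = back d e (bound-01 (suc d) e p) in
            Rh.ineq (Rh-≡ (sym (val (2 ℕ.+ d) e h)) (sym (trans (read-01 a d e) (val d (suc e) (h₀₁ d e h))))
              (sym (val (suc d) e (h₁₀ d e h))) (sym (trans (read-01 a (suc d) e) (val (suc d) (suc e)
                  (h₁₁ d e h)))) (Rh-shift c (r₂ d e h))) }
      ; rhombus₃ = λ i j s p q _ → case decode i j q of λ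
          { (zero , e , refl , refl) → ⊥-elim (strict e (subst (λ x → Δ x (K e)) (sym (I-suc e)) s))
          ; (suc d , e , refl , refl) → let h = back d e (bound-01 (suc d) e p) in
            Rh.ineq (sl (Rh-≡ (sym (trans (read-02 a d e) (val d (2 ℕ.+ e) (h₀₂ d e h))))
                (sym (val (suc d) e (h₁₀ d e h)))
              (sym (trans (read-01 a d e) (val d (suc e) (h₀₁ d e h)))) (sym (trans (read-01 a (suc d) e)
                  (val (suc d) (suc e) (h₁₁ d e h)))) (Rh-shift c (r₃ d e h)))) }
      }
      where
      open IsHive H
      back : ∀ d e → suc d ℕ.+ suc e ≤ n → suc (d ℕ.+ e) < n
      back d e h = subst (_≤ n) (cong suc (ℕₚ.+-suc d e)) h

  origin-of : Labels → ℤ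
  origin-of a = read a 0 0

  extract : Labels → Tri (suc n)
  extract a = tri (suc n) (λ d e → read a d e ℤ.- origin-of a)

  extract-at : ∀ a d e → d ℕ.+ e ≤ n → at (extract a) d e ≡ read a d e ℤ.- origin-of a
  extract-at a d e h = at-tri (λ d e → read a d e ℤ.- origin-of a) d e (s≤s h)

  extract-val : ∀ a d e → d ℕ.+ e ≤ n → read a d e ≡ at (extract a) d e ℤ.+ origin-of a
  extract-val a d e h = trans (sym (-+-cancel (read a d e) (origin-of a))) (cong (ℤ._+ origin-of a)
      (sym (extract-at a d e h)))

  extract-unique : ∀ a (b : Tri (suc n)) c → at b 0 0 ≡ 0ℤ → (∀ d e → d ℕ.+ e ≤ n → read a d e ≡ at b d e ℤ.+
      c) → extract a ≡ b
  extract-unique a b c z val = at-ext λ { d e (s≤s h) → trans (extract-at a d e h)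
    (trans (cong₂ ℤ._-_ (val d e h) (val 0 0 z≤n)) (trans (cong (λ o → at b d e ℤ.+ c ℤ.- (o ℤ.+ c)) z)
        (l (at b d e) c))) }
    where
    l : ∀ x c → x ℤ.+ c ℤ.- (0ℤ ℤ.+ c) ≡ x
    l = solve-∀

  extract-cong : ∀ a a′ → (∀ i j → Δ i j → a i j ≡ a′ i j) → extract a ≡ extract a′
  extract-cong a a′ eq = at-ext λ { d e (s≤s h) → trans (extract-at a d e h)
    (trans (cong₂ ℤ._-_ (eq _ _ (inΔ d e h)) (eq _ _ (inΔ 0 0 z≤n))) (sym (extract-at a′ d e h))) }

  extract-hive : ∀ a {α β κ} → Rhombi Δ a →
    (∀ j → j < n → read a (suc j) 0 ℤ.- read a j 0 ≡ α j) →
    (∀ d e → suc (d ℕ.+ e) ≡ n → read a d (suc e) ℤ.- read a (suc d) e ≡ β e) →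
    (∀ e → e < n → read a 0 (suc e) ℤ.- read a 0 e ≡ κ e) →
    LRHive n α β κ (at (extract a))
  extract-hive a {α} {β} {κ} R hα hβ hκ = record
    { hive   = rhombi⇒hive (origin-of a) (extract-val a) R
    ; origin = trans (extract-at a 0 0 z≤n) (ℤₚ.+-inverseʳ (origin-of a))
    ; left   = λ j h → edge-of (suc j) 0 j 0 (subst (_≤ n) (sym (ℕₚ.+-identityʳ (suc j))) h)
        (subst (_≤ n) (sym (ℕₚ.+-identityʳ j)) (ℕₚ.<⇒≤ h)) (hα j h)
    ; right  = λ d e p → edge-of d (suc e) (suc d) e (ℕₚ.≤-reflexive (trans (ℕₚ.+-suc d e) p))
        (ℕₚ.≤-reflexive p) (hβ d e p)
    ; diag   = λ e h → edge-of 0 (suc e) 0 e h (ℕₚ.<⇒≤ h) (hκ e h)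
    }
    where
    l : ∀ x y o → x ℤ.- o ≡ y ℤ.- o ℤ.+ (x ℤ.- y)
    l = solve-∀
    edge-of : ∀ d e d′ e′ {p} → d ℕ.+ e ≤ n → d′ ℕ.+ e′ ≤ n → read a d e ℤ.- read a d′ e′ ≡ p →
      at (extract a) d e ≡ at (extract a) d′ e′ ℤ.+ p
    edge-of d e d′ e′ h h′ refl = trans (extract-at a d e h) (trans (l (read a d e) (read a d′ e′) (origin-of a))
      (cong (ℤ._+ (read a d e ℤ.- read a d′ e′)) (sym (extract-at a d′ e′ h′))))

  module _ (a : Labels) {α β κ} {b : Labels} (H : LRHive n α β κ b) (c : ℤ) (val : ∀ d e → d ℕ.+ e ≤ n → read a d e ≡ b d e ℤ.+ c) where
    private
      l : ∀ x c p → x ℤ.+ p ℤ.+ c ℤ.- (x ℤ.+ c) ≡ p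
      l = solve-∀
      difference : ∀ d e d′ e′ {p} → d ℕ.+ e ≤ n → d′ ℕ.+ e′ ≤ n → b d e ≡ b d′ e′ ℤ.+ p → read a d e ℤ.-
          read a d′ e′ ≡ p
      difference d e d′ e′ {p} h h′ eq = trans (cong₂ ℤ._-_ (trans (val d e h) (cong (ℤ._+ c) eq))
          (val d′ e′ h′)) (l (b d′ e′) c p)

    read-left : ∀ j → j < n → read a (suc j) 0 ℤ.- read a j 0 ≡ α j
    read-left j h = difference (suc j) 0 j 0 (subst (_≤ n) (sym (ℕₚ.+-identityʳ (suc j))) h)
        (subst (_≤ n) (sym (ℕₚ.+-identityʳ j)) (ℕₚ.<⇒≤ h)) (LRHive.left H j h)

    read-right : ∀ d e → suc (d ℕ.+ e) ≡ n → read a d (suc e) ℤ.- read a (suc d) e ≡ β e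
    read-right d e p = difference d (suc e) (suc d) e (ℕₚ.≤-reflexive (trans (ℕₚ.+-suc d e) p))
        (ℕₚ.≤-reflexive p) (LRHive.right H d e p)

    read-diag : ∀ e → e < n → read a 0 (suc e) ℤ.- read a 0 e ≡ κ e
    read-diag e h = difference 0 (suc e) 0 e h (ℕₚ.<⇒≤ h) (LRHive.diag H e h)

module _ (n : ℕ) where
  leftChart : Chart n (LeftTriangle n)
  leftChart = record
    { I = id ; K = id ; I-suc = λ _ → refl ; K-suc = λ _ → refl
    ; inΔ    = λ d e h → ℕₚ.m≤n+m e d , h
    ; bound  = λ _ _ → proj₂
    ; strict = λ e p → ℕₚ.1+n≰n (proj₁ p)
    ; decode = λ i j p → j ℕ.∸ i , i , refl , sym (ℕₚ.m∸n+n≡m (proj₁ p))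
    }

  2n : 2 ℕ.* n ≡ n ℕ.+ n
  2n = cong (n ℕ.+_) (ℕₚ.+-identityʳ n)

  d+[n+e] : ∀ d e → d ℕ.+ (n ℕ.+ e) ≡ n ℕ.+ (d ℕ.+ e)
  d+[n+e] d e = trans (sym (ℕₚ.+-assoc d n e)) (trans (cong (ℕ._+ e) (ℕₚ.+-comm d n)) (ℕₚ.+-assoc n d e))

  rightChart : Chart n (RightTriangle n)
  rightChart = record
    { I = n ℕ.+_ ; K = n ℕ.+_ ; I-suc = ℕₚ.+-suc n ; K-suc = ℕₚ.+-suc n
    ; inΔ    = λ d e h → ℕₚ.m≤m+n n e , ℕₚ.m≤n+m (n ℕ.+ e) d ,
        ℕₚ.≤-trans (ℕₚ.≤-reflexive (d+[n+e] d e)) (ℕₚ.≤-trans (ℕₚ.+-monoʳ-≤ n h) (ℕₚ.≤-reflexive (sym 2n)))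
    ; bound  = λ d e p → ℕₚ.+-cancelˡ-≤ n (d ℕ.+ e) n
        (ℕₚ.≤-trans (ℕₚ.≤-reflexive (sym (d+[n+e] d e))) (ℕₚ.≤-trans (proj₂ (proj₂ p)) (ℕₚ.≤-reflexive 2n)))
    ; strict = λ e p → ℕₚ.1+n≰n (subst (_≤ n ℕ.+ e) (ℕₚ.+-suc n e) (proj₁ (proj₂ p)))
    ; decode = λ i j p → let e≡ = sym (ℕₚ.m+[n∸m]≡n (proj₁ p)) in
        j ℕ.∸ i , i ℕ.∸ n , e≡ , trans (sym (ℕₚ.m∸n+n≡m (proj₁ (proj₂ p)))) (cong (j ℕ.∸ i ℕ.+_) e≡)
    }

  -- After transposition the diagonal is the upper boundary, the left edge is the side shared with
  -- the left triangle and the right edge the side shared with the right triangle.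
  upperChart : Chart n (Flip (UpperTriangle n))
  upperChart = record
    { I = n ℕ.+_ ; K = id ; I-suc = ℕₚ.+-suc n ; K-suc = λ _ → refl
    ; inΔ    = λ d e h → h , ℕₚ.m≤m+n n e , ℕₚ.≤-trans (ℕₚ.≤-reflexive (ℕₚ.+-comm n e)) (ℕₚ.+-monoˡ-≤ n
        (ℕₚ.m≤n+m e d))
    ; bound  = λ _ _ → proj₁
    ; strict = λ e p → ℕₚ.1+n≰n
        (ℕₚ.≤-trans (ℕₚ.≤-reflexive (sym (trans (ℕₚ.+-suc n e) (cong suc (ℕₚ.+-comm n e)))))
        (proj₂ (proj₂ p)))
    ; decode = λ i j p → j ℕ.∸ (i ℕ.∸ n) , i ℕ.∸ n , sym (ℕₚ.m+[n∸m]≡n (proj₁ (proj₂ p))) ,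
        sym (ℕₚ.m∸n+n≡m (ℕₚ.≤-trans (ℕₚ.∸-monoˡ-≤ n (proj₂ (proj₂ p))) (ℕₚ.≤-reflexive (ℕₚ.m+n∸n≡m j n))))
    }

-- Composite hives

module _ {n f} (S : IsPartitionSeq n f) where
  open IsPartitionSeq S

  private
    abs : ℕ → ℕ
    abs j = ℤ.∣ f j ∣

    +abs : ∀ j → j < n → + abs j ≡ f j
    +abs j h = ℤₚ.0≤i⇒+∣i∣≡i (nonnegative j h)

    abs-antitone : Antitone n abs
    abs-antitone j h = ℤₚ.drop‿+≤+ (subst₂ ℤ._≤_ (sym (+abs (suc j) h)) (sym (+abs j (ℕₚ.<⇒≤ h))) (antitone j h))

  seqPartition : Partition
  seqPartition = toPartition n abs abs-antitone

  seqPartition-at : ∀ j → j < n → f j ≡ ⟦ seqPartition ⟧ j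
  seqPartition-at j h = trans (sym (+abs j h)) (cong +_ (sym (strip-nth n abs abs-antitone j h)))

partitionSeq : ∀ n {f : ℕ → ℤ} κ → (∀ j → j < n → f j ≡ ⟦ κ ⟧ j) → IsPartitionSeq n f
partitionSeq n κ e = record
  { antitone    = λ j h → subst₂ ℤ._≤_ (sym (e (suc j) h)) (sym (e j (ℕₚ.<⇒≤ h))) (ℤ.+≤+ (entry-antitone κ j))
  ; nonnegative = λ j h → subst (0ℤ ℤ.≤_) (sym (e j h)) (ℤ.+≤+ z≤n)
  }

-- Cutting composite hives and gluing triples of hives

module _ (n : ℕ) where
  private
    module Left  = Chart (leftChart n)
    module Right = Chart (rightChart n)
    module Upper = Chart (upperChart n)

    n+0 : n ℕ.+ 0 ≡ n
    n+0 = ℕₚ.+-identityʳ n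

    d+e+1 : ∀ d e → suc (d ℕ.+ e) ≡ n → d ℕ.+ suc e ≡ n
    d+e+1 d e = trans (ℕₚ.+-suc d e)

    d+n+e : ∀ d e → d ℕ.+ e ≡ n → d ℕ.+ (n ℕ.+ e) ≡ 2 ℕ.* n
    d+n+e d e p = trans (d+[n+e] n d e) (trans (cong (n ℕ.+_) p) (sym (2n n)))

  module Sides (a : Labels) where
    private
      diff : ∀ {i j i′ j′ k l k′ l′} → i ≡ i′ → j ≡ j′ → k ≡ k′ → l ≡ l′ → a i j ℤ.- a k l ≡ a i′ j′ ℤ.- a k′ l′
      diff refl refl refl refl = refl

    left₁ : ∀ j → Left.read a (suc j) 0 ℤ.- Left.read a j 0 ≡ a 0 (suc j) ℤ.- a 0 j
    left₁ j = diff refl (ℕₚ.+-identityʳ (suc j)) refl (ℕₚ.+-identityʳ j)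

    right₁ : ∀ d e → suc (d ℕ.+ e) ≡ n → Left.read a d (suc e) ℤ.- Left.read a (suc d) e ≡ a (suc e) n ℤ.- a e n
    right₁ d e p = diff refl (d+e+1 d e p) refl p

    left₂ : ∀ j → Right.read a (suc j) 0 ℤ.- Right.read a j 0 ≡ a n (n ℕ.+ suc j) ℤ.- a n (n ℕ.+ j)
    left₂ j = diff n+0 (s (suc j)) n+0 (s j)
      where
      s : ∀ j → j ℕ.+ (n ℕ.+ 0) ≡ n ℕ.+ j
      s j = trans (cong (j ℕ.+_) n+0) (ℕₚ.+-comm j n)

    right₂ : ∀ d e → suc (d ℕ.+ e) ≡ n →
      Right.read a d (suc e) ℤ.- Right.read a (suc d) e ≡ a (n ℕ.+ suc e) (2 ℕ.* n) ℤ.- a (n ℕ.+ e) (2 ℕ.* n)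
    right₂ d e p = diff refl (d+n+e d (suc e) (d+e+1 d e p)) refl (d+n+e (suc d) e p)

    left₃ : ∀ j → Upper.read (flip a) (suc j) 0 ℤ.- Upper.read (flip a) j 0 ≡ a (suc j) n ℤ.- a j n
    left₃ j = diff (ℕₚ.+-identityʳ (suc j)) n+0 (ℕₚ.+-identityʳ j) n+0

    right₃ : ∀ d e → suc (d ℕ.+ e) ≡ n →
      Upper.read (flip a) d (suc e) ℤ.- Upper.read (flip a) (suc d) e ≡ a n (n ℕ.+ suc e) ℤ.- a n (n ℕ.+ e)
    right₃ d e p = diff (d+e+1 d e p) refl p refl

  private
    last-< : ∀ d e → suc (d ℕ.+ e) ≡ n → e < n
    last-< d e p = ℕₚ.≤-trans (s≤s (ℕₚ.m≤n+m e d)) (ℕₚ.≤-reflexive p)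

    at-edge : ∀ e → e < n → ∃[ d ] suc (d ℕ.+ e) ≡ n
    at-edge e h = n ℕ.∸ suc e , edge e h

  module Split {μ ν κ} (c : CompositeHive n μ ν κ) where
    open CompositeHive c renaming (label to L; upper to upperSide)
    open Sides L

    α β γ : Partition
    α = seqPartition partitionα
    β = seqPartition partitionβ
    γ = seqPartition partitionγ

    hives : Hives n
    hives = Left.extract L , Right.extract L , Upper.extract (flip L)

    matches : Matching n μ ν κ (α , β , γ) hives
    matches = (strip-length n _ , strip-length n _ , strip-length n _) ,
      Left.extract-hive L rhombiLeft
        (λ j h → trans (left₁ j) (seqPartition-at partitionα j h))
        (λ d e p → trans (right₁ d e p) (seqPartition-at partitionβ e (last-< d e p)))
        lowerLeft ,
      Right.extract-hive L rhombiRight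
        (λ j h → trans (left₂ j) (seqPartition-at partitionγ j h))
        -- The matching condition turns this side into the left boundary of the trapezoid, whose
        -- increments are the parts of `α`.
        (λ d e p → trans (right₂ d e p) (trans (sym (matching e (last-< d e p))) (seqPartition-at partitionα
            e (last-< d e p))))
        lowerRight ,
      Upper.extract-hive (flip L) (flip-rhombi rhombiUpper)
        (λ j h → trans (left₃ j) (seqPartition-at partitionβ j h))
        (λ d e p → trans (right₃ d e p) (seqPartition-at partitionγ e (last-< d e p)))
        upperSide

  choose : ∀ {P Q : Set} → Dec P → Dec Q → ℤ → ℤ → ℤ → ℤ
  choose (yes _) _       x y z = x
  choose (no _)  (yes _) x y z = y
  choose (no _)  (no _)  x y z = z

  -- The right and the upper hive are translated to agree with the left one on
  -- the common edges.
  glued : Hives n → Labels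
  glued (b₁ , b₂ , b₃) i j = choose (j ℕ.≤? n) (n ℕ.≤? i)
    (at b₁ (j ℕ.∸ i) i)
    (at b₂ (j ℕ.∸ i) (i ℕ.∸ n) ℤ.+ at b₁ 0 n)
    (at b₃ (i ℕ.∸ (j ℕ.∸ n)) (j ℕ.∸ n) ℤ.+ at b₁ n 0)

  private
    choose₁ : ∀ {P Q : Set} (p : Dec P) (q : Dec Q) {x y z} → P → choose p q x y z ≡ x
    choose₁ (yes _) q p = refl
    choose₁ (no ¬p) q p = contradiction p ¬p

    choose₂ : ∀ {P Q : Set} (p : Dec P) (q : Dec Q) {x y z} → ¬ P → Q → choose p q x y z ≡ y
    choose₂ (yes p) q       ¬p _ = contradiction p ¬p
    choose₂ (no _)  (yes _) _  _ = refl
    choose₂ (no _)  (no ¬q) _  q = contradiction q ¬q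

    choose₃ : ∀ {P Q : Set} (p : Dec P) (q : Dec Q) {x y z} → ¬ P → ¬ Q → choose p q x y z ≡ z
    choose₃ (yes p) q       ¬p _  = contradiction p ¬p
    choose₃ (no _)  (yes q) _  ¬q = contradiction q ¬q
    choose₃ (no _)  (no _)  _  _  = refl

    n+e≤n : ∀ e → n ℕ.+ e ≤ n → e ≡ 0
    n+e≤n e h = ℕₚ.n≤0⇒n≡0 (ℕₚ.+-cancelˡ-≤ n e 0 (ℕₚ.≤-trans h (ℕₚ.≤-reflexive (sym n+0))))

  module Glue (μ ν κ α β γ : Partition) {b₁ b₂ b₃} (H₁ : HiveSet n α β μ b₁) (H₂ : HiveSet n γ α ν b₂) (H₃ : HiveSet n β γ κ b₃) where
    private
      module H₁ = LRHive H₁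
      module H₂ = LRHive H₂
      module H₃ = LRHive H₃
      G = glued (b₁ , b₂ , b₃)
      open Sides G

    val₁ : ∀ d e → d ℕ.+ e ≤ n → Left.read G d e ≡ at b₁ d e ℤ.+ 0ℤ
    val₁ d e h = trans (choose₁ (d ℕ.+ e ℕ.≤? n) (n ℕ.≤? e) h)
      (trans (cong (λ x → at b₁ x e) (ℕₚ.m+n∸n≡m d e)) (sym (ℤₚ.+-identityʳ _)))

    -- The left and right triangles share only the vertex (n , n), where `glued` reads the left
    -- hive; the translation makes the two labels equal there.
    val₂ : ∀ d e → d ℕ.+ e ≤ n → Right.read G d e ≡ at b₂ d e ℤ.+ at b₁ 0 n
    val₂ d e h with d ℕ.+ (n ℕ.+ e) ℕ.≤? n
    ... | no ¬p = trans (choose₂ (no ¬p) (n ℕ.≤? n ℕ.+ e) ¬p (ℕₚ.m≤m+n n e))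
            (cong₂ (λ x y → at b₂ x y ℤ.+ at b₁ 0 n) (ℕₚ.m+n∸n≡m d (n ℕ.+ e)) (ℕₚ.m+n∸m≡n n e))
    ... | yes p = trans (cong₂ (at b₁) (trans (ℕₚ.m+n∸n≡m d (n ℕ.+ e)) d≡0) (trans (cong (n ℕ.+_) e≡0) n+0))
            (sym (trans (cong (ℤ._+ at b₁ 0 n) (trans (cong₂ (at b₂) d≡0 e≡0) H₂.origin)) (ℤₚ.+-identityˡ _)))
      where
      d+e≡0 : d ℕ.+ e ≡ 0
      d+e≡0 = n+e≤n (d ℕ.+ e) (subst (_≤ n) (d+[n+e] n d e) p)
      d≡0 = ℕₚ.m+n≡0⇒m≡0 d d+e≡0
      e≡0 = ℕₚ.m+n≡0⇒n≡0 d d+e≡0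

    -- On the shared sides `glued` reads one of the other hives. The labels there are partial sums
    -- along `β` or `γ`, and the translation by the sum of `α` makes them agree with those of the
    -- upper hive.
    val₃ : ∀ d e → d ℕ.+ e ≤ n → Upper.read (flip G) d e ≡ at b₃ d e ℤ.+ at b₁ n 0
    val₃ d e h = go (n ℕ.+ e ℕ.≤? n) (n ℕ.≤? d ℕ.+ e)
      where
      A = psum ⟦ α ⟧ n
      A≡ : at b₁ n 0 ≡ A
      A≡ = H₁.left-psum n ℕₚ.≤-refl
      rot : ∀ a b c → c ℤ.+ (a ℤ.+ b) ≡ b ℤ.+ c ℤ.+ a
      rot = solve-∀
      go : Dec (n ℕ.+ e ≤ n) → Dec (n ≤ d ℕ.+ e) → G (d ℕ.+ e) (n ℕ.+ e) ≡ at b₃ d e ℤ.+ at b₁ n 0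
      go (yes p) _ = trans (choose₁ (n ℕ.+ e ℕ.≤? n) (n ℕ.≤? d ℕ.+ e) p)
          (trans (cong₂ (at b₁) (trans (cong₂ ℕ._∸_ (trans (cong (n ℕ.+_) e≡0) n+0) d+e) refl) d+e)
            (trans (H₁.right-psum (n ℕ.∸ d) d (ℕₚ.m∸n+n≡m d≤n))
              (trans (ℤₚ.+-comm A (psum ⟦ β ⟧ d)) (sym (cong₂ ℤ._+_ (trans (cong (at b₃ d) e≡0)
                  (H₃.left-psum d d≤n)) A≡)))))
        where
        e≡0 = n+e≤n e p
        d+e = trans (cong (d ℕ.+_) e≡0) (ℕₚ.+-identityʳ d)
        d≤n = ℕₚ.≤-trans (ℕₚ.m≤m+n d e) h
      go (no ¬p) (yes q) = trans (choose₂ (n ℕ.+ e ℕ.≤? n) (n ℕ.≤? d ℕ.+ e) ¬p q)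
          (trans (cong₂ (λ x y → at b₂ x y ℤ.+ at b₁ 0 n) (trans (cong (n ℕ.+ e ℕ.∸_) d+e) (ℕₚ.m+n∸m≡n n e))
              (trans (cong (ℕ._∸ n) d+e) (ℕₚ.n∸n≡0 n)))
            (trans (cong₂ ℤ._+_ (H₂.left-psum e (ℕₚ.≤-trans (ℕₚ.m≤n+m e d) h)) (H₁.right-psum 0 n refl))
              (trans (rot A (psum ⟦ β ⟧ n) (psum ⟦ γ ⟧ e)) (sym (cong₂ ℤ._+_ (H₃.right-psum d e d+e) A≡)))))
        where
        d+e : d ℕ.+ e ≡ n
        d+e = ℕₚ.≤-antisym h q
      go (no ¬p) (no ¬q) = trans (choose₃ (n ℕ.+ e ℕ.≤? n) (n ℕ.≤? d ℕ.+ e) ¬p ¬q)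
        (cong (ℤ._+ at b₁ n 0) (cong₂ (at b₃) (trans (cong (d ℕ.+ e ℕ.∸_) (ℕₚ.m+n∸m≡n n e)) (ℕₚ.m+n∸n≡m d e))
            (ℕₚ.m+n∸m≡n n e)))

    private
      α-side : ∀ j → j < n → G 0 (suc j) ℤ.- G 0 j ≡ ⟦ α ⟧ j
      α-side j h = trans (sym (left₁ j)) (Left.read-left G H₁ 0ℤ val₁ j h)

      β-side : ∀ j → j < n → G (suc j) n ℤ.- G j n ≡ ⟦ β ⟧ j
      β-side j h = let d , p = at-edge j h in trans (sym (right₁ d j p)) (Left.read-right G H₁ 0ℤ val₁ d j p)

      γ-side : ∀ j → j < n → G n (n ℕ.+ suc j) ℤ.- G n (n ℕ.+ j) ≡ ⟦ γ ⟧ j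
      γ-side j h = trans (sym (left₂ j)) (Right.read-left G H₂ (at b₁ 0 n) val₂ j h)

      α′-side : ∀ j → j < n → G (n ℕ.+ suc j) (2 ℕ.* n) ℤ.- G (n ℕ.+ j) (2 ℕ.* n) ≡ ⟦ α ⟧ j
      α′-side j h = let d , p = at-edge j h in trans (sym (right₂ d j p)) (Right.read-right G H₂ (at b₁ 0 n)
          val₂ d j p)

    composite : CompositeHive n μ ν κ
    composite = record
      { label       = G
      ; origin      = trans (val₁ 0 0 z≤n) (cong (ℤ._+ 0ℤ) H₁.origin)
      ; lowerLeft   = Left.read-diag G H₁ 0ℤ val₁
      ; lowerRight  = Right.read-diag G H₂ (at b₁ 0 n) val₂
      ; upper       = Upper.read-diag (flip G) H₃ (at b₁ n 0) val₃
      ; rhombiLeft  = Left.hive⇒rhombi 0ℤ val₁ H₁.hive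
      ; rhombiRight = Right.hive⇒rhombi (at b₁ 0 n) val₂ H₂.hive
      ; rhombiUpper = flip-rhombi (Upper.hive⇒rhombi (at b₁ n 0) val₃ H₃.hive)
      ; matching    = λ j h → trans (α-side j h) (sym (α′-side j h))
      ; partitionα  = partitionSeq n α α-side
      ; partitionβ  = partitionSeq n β β-side
      ; partitionγ  = partitionSeq n γ γ-side
      }

    split-glue : Split.hives composite ≡ (b₁ , b₂ , b₃)
    split-glue = cong₂ _,_ (Left.extract-unique G b₁ 0ℤ H₁.origin val₁)
      (cong₂ _,_ (Right.extract-unique G b₂ (at b₁ 0 n) H₂.origin val₂) (Upper.extract-unique (flip G) b₃
          (at b₁ n 0) H₃.origin val₃))

  private
    n≤2n : n ≤ 2 ℕ.* n
    n≤2n = ℕₚ.m≤m+n n _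

    left⊆ : ∀ {i j} → LeftTriangle n i j → InTrapezoid n i j
    left⊆ {i} (i≤j , j≤n) = ℕₚ.≤-trans i≤j (ℕₚ.≤-trans j≤n n≤2n) , i≤j ,
      ℕₚ.⊓-glb (ℕₚ.≤-trans j≤n (ℕₚ.m≤n+m n i)) (ℕₚ.≤-trans j≤n n≤2n)

    right⊆ : ∀ {i j} → RightTriangle n i j → InTrapezoid n i j
    right⊆ {i} (n≤i , i≤j , j≤2n) = ℕₚ.≤-trans i≤j j≤2n , i≤j ,
      ℕₚ.⊓-glb (ℕₚ.≤-trans j≤2n (ℕₚ.≤-trans (ℕₚ.≤-reflexive (2n n)) (ℕₚ.+-monoˡ-≤ n n≤i))) j≤2n

    upper⊆ : ∀ {i j} → UpperTriangle n i j → InTrapezoid n i j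
    upper⊆ {i} (i≤n , n≤j , j≤i+n) = ℕₚ.≤-trans i≤n n≤2n , ℕₚ.≤-trans i≤n n≤j ,
      ℕₚ.⊓-glb j≤i+n (ℕₚ.≤-trans j≤i+n (ℕₚ.≤-trans (ℕₚ.+-monoˡ-≤ n i≤n) (ℕₚ.≤-reflexive (sym (2n n)))))

    triangles : ∀ i j → InTrapezoid n i j → LeftTriangle n i j ⊎ RightTriangle n i j ⊎ UpperTriangle n i j
    triangles i j (i≤2n , i≤j , j≤) with j ℕ.≤? n | n ℕ.≤? i
    ... | yes j≤n | _       = inj₁ (i≤j , j≤n)
    ... | no _    | yes n≤i = inj₂ (inj₁ (n≤i , i≤j , ℕₚ.m≤n⊓o⇒m≤o (i ℕ.+ n) (2 ℕ.* n) j≤))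
    ... | no j≰n  | no n≰i  = inj₂ (inj₂ (ℕₚ.<⇒≤ (ℕₚ.≰⇒> n≰i) , ℕₚ.<⇒≤ (ℕₚ.≰⇒> j≰n) , ℕₚ.m≤n⊓o⇒m≤n (i ℕ.+ n)
        (2 ℕ.* n) j≤))

  split-cong : ∀ {μ ν κ} (c c′ : CompositeHive n μ ν κ) → (∀ i j → InTrapezoid n i j → label c i j ≡ label c′ i j) →
    Split.hives c ≡ Split.hives c′
  split-cong c c′ e = cong₂ _,_ (Left.extract-cong (label c) (label c′) (λ i j p → e i j (left⊆ p)))
    (cong₂ _,_ (Right.extract-cong (label c) (label c′) (λ i j p → e i j (right⊆ p)))
      (Upper.extract-cong (flip (label c)) (flip (label c′)) (λ i j p → e j i (upper⊆ p))))

  glue-split : ∀ {μ ν κ} (c : CompositeHive n μ ν κ) i j → InTrapezoid n i j → glued (Split.hives c) i j ≡ label c i j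
  glue-split {μ} {ν} {κ} c i j p = go (triangles i j p)
    where
    open CompositeHive c renaming (label to L)
    S = proj₂ (Split.matches c)
    module G = Glue μ ν κ (Split.α c) (Split.β c) (Split.γ c) (proj₁ S) (proj₁ (proj₂ S)) (proj₂ (proj₂ S))
    b₁ = Left.extract L
    origin₁ : ∀ d e → d ℕ.+ e ≤ n → at b₁ d e ≡ Left.read L d e
    origin₁ d e h = sym (trans (Left.extract-val L d e h) (trans (cong (ℤ._+_ (at b₁ d e)) origin)
        (ℤₚ.+-identityʳ _)))
    go : LeftTriangle n i j ⊎ RightTriangle n i j ⊎ UpperTriangle n i j → glued (Split.hives c) i j ≡ L i j
    go (inj₁ q) with Left.decode i j q
    ... | d , e , refl , refl = let h = Left.bound d e q in
          trans (G.val₁ d e h) (trans (ℤₚ.+-identityʳ _) (origin₁ d e h))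
    go (inj₂ (inj₁ q)) with Right.decode i j q
    ... | d , e , refl , refl = let h = Right.bound d e q in
          trans (G.val₂ d e h) (trans (cong (ℤ._+_ (at (Right.extract L) d e))
              (trans (origin₁ 0 n ℕₚ.≤-refl) (sym (cong₂ L n+0 n+0))))
            (sym (Right.extract-val L d e h)))
    go (inj₂ (inj₂ q)) with Upper.decode j i q
    ... | d , e , refl , refl = let h = Upper.bound d e q in
          trans (G.val₃ d e h) (trans (cong (ℤ._+_ (at (Upper.extract (flip L)) d e))
              (origin₁ n 0 (ℕₚ.≤-reflexive n+0)))
            (sym (Upper.extract-val (flip L) d e h)))

  -- The partitions are the edge increments of the hives. Hence equality of the hives already gives
  -- equality of the whole data, as the setoid of labellings demands.
  matching-unique : ∀ {μ ν κ t t′ h} → Matching n μ ν κ t h → Matching n μ ν κ t′ h → t ≡ t′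
  matching-unique {t = α , β , γ} {α′ , β′ , γ′} {b₁ , b₂ , _} ((a , b , c) , H₁ , H₂ , _)
      ((a′ , b′ , c′) , H₁′ , H₂′ , _) =
    cong₂ _,_ (entry-ext α α′ a a′ (λ j h → same (at b₁ j 0) (LRHive.left H₁ j h) (LRHive.left H₁′ j h)))
      (cong₂ _,_
        (entry-ext β β′ b b′ (λ j h → let d , p = at-edge j h in same (at b₁ (suc d) j)
            (LRHive.right H₁ d j p) (LRHive.right H₁′ d j p)))
        (entry-ext γ γ′ c c′ (λ j h → same (at b₂ j 0) (LRHive.left H₂ j h) (LRHive.left H₂′ j h))))
    where
    same : ∀ {x : ℤ} {p q : ℕ} y → x ≡ y ℤ.+ + p → x ≡ y ℤ.+ + q → p ≡ q
    same {x} y e e′ = ℤₚ.+-injective (trans (sym (unΔ {x} {y} e)) (unΔ {x} {y} e′))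

  compositeHives-size : ∀ μ ν κ → HasCardinality (compositeHives n μ ν κ) (size (enum-matching n μ ν κ))
  compositeHives-size μ ν κ = hasCardinality {S = compositeHives n μ ν κ} (enum-matching n μ ν κ)
      (λ {x} → glue {x}) split Split.matches
      (λ {c} {c′} → cong′ c c′) (λ {x} → back {x}) forth
    where
    Match : Triple × Hives n → Set
    Match = uncurry (Matching n μ ν κ)

    glue : ∀ {x} → Match x → CompositeHive n μ ν κ
    glue {(α , β , γ) , _} (_ , H₁ , H₂ , H₃) = Glue.composite μ ν κ α β γ H₁ H₂ H₃

    split : CompositeHive n μ ν κ → Triple × Hives n
    split c = (Split.α c , Split.β c , Split.γ c) , Split.hives c

    split-≡ : ∀ x y → Match x → Match y → proj₂ x ≡ proj₂ y → x ≡ y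
    split-≡ x y m m′ refl = cong (_, proj₂ x) (matching-unique {μ} {ν} {κ} m m′)

    cong′ : ∀ c c′ → (∀ i j → InTrapezoid n i j → label c i j ≡ label c′ i j) → split c ≡ split c′
    cong′ c c′ e = split-≡ (split c) (split c′) (Split.matches c) (Split.matches c′) (split-cong c c′ e)

    back : ∀ {x} (m : Match x) → split (glue {x} m) ≡ x
    back {x@((α , β , γ) , _)} m@(_ , H₁ , H₂ , H₃) =
      split-≡ (split (glue {x} m)) x (Split.matches (glue {x} m)) m (Glue.split-glue μ ν κ α β γ H₁ H₂ H₃)

    forth : ∀ c (m : Match (split c)) i j → InTrapezoid n i j → label (glue {split c} m) i j ≡ label c i j
    forth c m = glue-split c

proposition4p4 : ∀ (n : ℕ) → .{{NonZero n}} →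
    ∀ (μ ν κ : Partition) → ℓ μ ≤ n → ℓ ν ≤ n → ℓ κ ≤ n →
    ∃[ N ] (IsNewellLittlewood μ ν κ (+ N) × HasCardinality (compositeHives n μ ν κ) N)
proposition4p4 n μ ν κ hμ hν hκ =
  size (enum-matching n μ ν κ) , newell-littlewood n μ ν κ hμ hν hκ , compositeHives-size n μ ν κ
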